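{- Let $e$ be a resource expression with $e\asymp e$ and let $e'\in\mathrm{supp}(\mathrm{NF}(e))$. Then $(\mathrm{NF}(e))_{e'}=\dfrac{m(e)}{m(e')}$.
   Context: Resource terms and monomials: $s,t ::= x\mid\lambda x.s\mid\langle s\rangle\bar t\mid s\oplus\bullet\mid\bullet\oplus s$, $\bar t::=[t_1,\dots,t_n]$ (finite multisets), up to $\alpha$-equivalence; a resource expression is a term or monomial. Finite formal sums with coefficients in $\mathbb N$; $E_e$ is the coefficient of $e$ and $\mathrm{supp}(E)$ the support; constructors extended by multilinearity. For $\bar u=[u_1,\dots,u_n]$, $\partial_xe\cdot\bar u$: $\partial_xy\cdot\bar u$ is $y$ if $y\ne x$ and $n=0$, $u_1$ if $y=x$ and $n=1$, $0$ otherwise; it commutes with $\lambda y.$ ($y$ fresh), $-\oplus\bullet$, $\bullet\oplus-$; $\partial_x(\langle s\rangle\bar t)\cdot\bar u=\sum_{(I_1,I_2)}\langle\partial_xs\cdot\bar u_{I_1}\rangle(\partial_x\bar t\cdot\bar u_{I_2})$; $\partial_x[t_1,\dots,t_k]\cdot\bar u=\sum_{(I_1,\dots,I_k)}[\partial_xt_1\cdot\bar u_{I_1},\dots,\partial_xt_k\cdot\bar u_{I_k}]$, sums over tuples of pairwise disjoint possibly empty subsets of $\{1,\dots,n\}$ covering it, $\bar u_I=[u_i\mid i\in I]$. The reduction $\to_\partial$ is generated by $\langle\lambda x.s\rangle\bar t\to_\partial\partial_xs\cdot\bar t$, $\langle s\oplus\bullet\rangle\bar t\to_\partial(\langle s\rangle\bar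 t)\oplus\bullet$, $\langle\bullet\oplus s\rangle\bar t\to_\partial\bullet\oplus\langle s\rangle\bar t$, $\lambda x.(s\oplus\bullet)\to_\partial(\lambda x.s)\oplus\bullet$, $\lambda x.(\bullet\oplus s)\to_\partial\bullet\oplus\lambda x.s$, closed under all contexts and extended to sums by $e+F\to_\partial E'+F$ when $e\to_\partial E'$; it is confluent and strongly normalizing and $\mathrm{NF}(E)$ is the normal form. Coherence $\asymp$: $x\asymp x$; $\lambda x.s\asymp\lambda x.s'$ if $s\asymp s'$; $\langle s\rangle\bar t\asymp\langle s'\rangle\bar t'$ if $s\asymp s'$ and $\bar t\asymp\bar t'$; $[t_1,\dots,t_n]\asymp[t_{n+1},\dots,t_{n+m}]$ if $t_i\asymp t_j$ for all $1\le i,j\le n+m$; $s\oplus\bullet\asymp s'\oplus\bullet$ and $\bullet\oplus s\asymp\bullet\oplus s'$ if $s\asymp s'$; $s\oplus\bullet\asymp\bullet\oplus s'$ for all $s,s'$ (symmetric). The multiplicity: $m(x)=1$; $m(\lambda x.s)=m(s\oplus\bullet)=m(\bullet\oplus s)=m(s)$; $m(\langle s\rangle\bar t)=m(s)m(\bar t)$; $m([t_1]^{n_1}\cdot\ldots\cdot[t_k]^{n_k})=\prod_{i=1}^kn_i!\,m(t_i)^{n_i}$ for pairwise distinct $t_i$ ($[t]^n$ is the multiset with $n$ copies of $t$, $\cdot$ is multiset union). -}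

module Defs where

open import Data.Nat using (ℕ; zero; suc; _+_; _*_; _∸_; _<ᵇ_; _≡ᵇ_; _^_; _≤_; _!)
open import Data.Bool using (Bool; true; false; if_then_else_)
open import Data.List using (List; []; _∷_; _++_; map; concatMap; replicate)
open import Data.Nat.ListAction using (product)
open import Data.List.Relation.Unary.All using (All)
open import Data.List.Relation.Unary.AllPairs using (AllPairs)
open import Data.Product using (_×_; _,_; proj₁; proj₂)
open import Relation.Nullary using (¬_)
open import Relation.Binary.Construct.Closure.ReflexiveTransitive using (Star)

-- Resource terms, with de Bruijn indices (so α-equivalence is built in).
--   var n          : variable
--   lam s          : λx.s
--   app s ts       : ⟨s⟩ t̄   (the monomial t̄ is represented by a list;
--                              multiset equality is _≈ₘ_ below)
--   inl s          : s ⊕ •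
--   inr s          : • ⊕ s

data Term : Set where
  var : ℕ → Term
  lam : Term → Term
  app : Term → List Term → Term
  inl : Term → Term
  inr : Term → Term

Monomial : Set
Monomial = List Term

mutual
  data _≈_ : Term → Term → Set where
    var≈ : ∀ {x} → var x ≈ var x
    lam≈ : ∀ {s s'} → s ≈ s' → lam s ≈ lam s'
    app≈ : ∀ {s s' ts ts'} → s ≈ s' → ts ≈ₘ ts' → app s ts ≈ app s' ts'
    inl≈ : ∀ {s s'} → s ≈ s' → inl s ≈ inl s'
    inr≈ : ∀ {s s'} → s ≈ s' → inr s ≈ inr s'

  data _≈ₘ_ : Monomial → Monomial → Set where
    []≈ : [] ≈ₘ []
    ∷≈  : ∀ {t t' ts l₁ l₂} → t ≈ t' → ts ≈ₘ (l₁ ++ l₂) →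
          (t ∷ ts) ≈ₘ (l₁ ++ t' ∷ l₂)

mutual
  shift : ℕ → ℕ → Term → Term
  shift c d (var y) = if y <ᵇ c then var y else var (y + d)
  shift c d (lam s) = lam (shift (suc c) d s)
  shift c d (app s ts) = app (shift c d s) (shiftM c d ts)
  shift c d (inl s) = inl (shift c d s)
  shift c d (inr s) = inr (shift c d s)

  shiftM : ℕ → ℕ → Monomial → Monomial
  shiftM c d [] = []
  shiftM c d (t ∷ ts) = shift c d t ∷ shiftM c d ts

split2 : List Term → List (List Term × List Term)
split2 [] = ([] , []) ∷ []
split2 (u ∷ us) =
  concatMap (λ p → (u ∷ proj₁ p , proj₂ p) ∷ (proj₁ p , u ∷ proj₂ p) ∷ [])
            (split2 us)

-- Linear substitution ∂_x e · ū (a finite sum, represented as a list).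
-- D k s ū : s lives in a context Γ,x,Δ with |Δ| = k, so x has index k;
-- the terms of ū live in Γ. The result lives in Γ,Δ.
-- A sum over tuples (I₁,…,I_k) of a partition of the indices of ū is
-- computed multilinearly by repeatedly splitting into two bins.

mutual
  D : ℕ → Term → List Term → List Term
  D k (var y) [] =
    if y ≡ᵇ k then [] else (if y <ᵇ k then var y ∷ [] else var (y ∸ 1) ∷ [])
  D k (var y) (u ∷ []) = if y ≡ᵇ k then shift 0 k u ∷ [] else []
  D k (var y) (_ ∷ _ ∷ _) = []
  D k (lam s) us = map lam (D (suc k) s us)
  D k (app s ts) us =
    concatMap (λ p → concatMap (λ s' → map (app s') (DM k ts (proj₂ p)))
                               (D k s (proj₁ p)))
              (split2 us)
  D k (inl s) us = map inl (D k s us)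
  D k (inr s) us = map inr (D k s us)

  DM : ℕ → Monomial → List Term → List Monomial
  DM k [] [] = [] ∷ []
  DM k [] (_ ∷ _) = []
  DM k (t ∷ ts) us =
    concatMap (λ p → concatMap (λ t' → map (t' ∷_) (DM k ts (proj₂ p)))
                               (D k t (proj₁ p)))
              (split2 us)

mutual
  data _⟶_ : Term → List Term → Set where
    β     : ∀ {s ts} → app (lam s) ts ⟶ D 0 s ts
    appL  : ∀ {s ts} → app (inl s) ts ⟶ (inl (app s ts) ∷ [])
    appR  : ∀ {s ts} → app (inr s) ts ⟶ (inr (app s ts) ∷ [])
    lamL  : ∀ {s} → lam (inl s) ⟶ (inl (lam s) ∷ [])
    lamR  : ∀ {s} → lam (inr s) ⟶ (inr (lam s) ∷ [])
    ctx-lam  : ∀ {s S} → s ⟶ S → lam s ⟶ map lam S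
    ctx-fun  : ∀ {s ts S} → s ⟶ S → app s ts ⟶ map (λ s' → app s' ts) S
    ctx-arg  : ∀ {s ts T} → ts ⟶ₘ T → app s ts ⟶ map (app s) T
    ctx-inl  : ∀ {s S} → s ⟶ S → inl s ⟶ map inl S
    ctx-inr  : ∀ {s S} → s ⟶ S → inr s ⟶ map inr S

  data _⟶ₘ_ : Monomial → List Monomial → Set where
    ctx-mono : ∀ {l₁ t l₂ T} → t ⟶ T →
               (l₁ ++ t ∷ l₂) ⟶ₘ map (λ t' → l₁ ++ t' ∷ l₂) T

mutual
  data _≍_ : Term → Term → Set where
    var≍ : ∀ {x} → var x ≍ var x
    lam≍ : ∀ {s s'} → s ≍ s' → lam s ≍ lam s'
    app≍ : ∀ {s s' ts ts'} → s ≍ s' → ts ≍ₘ ts' → app s ts ≍ app s' ts'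
    inl≍ : ∀ {s s'} → s ≍ s' → inl s ≍ inl s'
    inr≍ : ∀ {s s'} → s ≍ s' → inr s ≍ inr s'
    inl-inr≍ : ∀ {s s'} → inl s ≍ inr s'
    inr-inl≍ : ∀ {s s'} → inr s ≍ inl s'

  data _≍ₘ_ : Monomial → Monomial → Set where
    mono≍ : ∀ {ts ts'} →
            All (λ t → All (λ t' → t ≍ t') (ts ++ ts')) (ts ++ ts') →
            ts ≍ₘ ts'

-- Multiplicity (as a relation: Mult e μ means m(e) = μ).
-- For a monomial: t̄ = [t₁]^{n₁}·…·[t_k]^{n_k} with pairwise distinct tᵢ,
-- nᵢ ≥ 1, and m(t̄) = ∏ nᵢ! m(tᵢ)^{nᵢ}.

record Block : Set where
  constructor block
  field
    tm  : Term
    cnt : ℕ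
    mul : ℕ

open Block public

mutual
  data Mult : Term → ℕ → Set where
    mvar : ∀ {x} → Mult (var x) 1
    mlam : ∀ {s μ} → Mult s μ → Mult (lam s) μ
    mapp : ∀ {s ts μ ν} → Mult s μ → MultM ts ν → Mult (app s ts) (μ * ν)
    minl : ∀ {s μ} → Mult s μ → Mult (inl s) μ
    minr : ∀ {s μ} → Mult s μ → Mult (inr s) μ

  data MultM : Monomial → ℕ → Set where
    mmono : ∀ {ts} (bs : List Block) →
            AllPairs (λ b b' → ¬ (tm b ≈ tm b')) bs →
            All (λ b → 1 ≤ cnt b) bs →
            All (λ b → Mult (tm b) (mul b)) bs →
            ts ≈ₘ concatMap (λ b → replicate (cnt b) (tm b)) bs →
            MultM ts (product (map (λ b → (cnt b !) * (mul b ^ cnt b)) bs))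

data Sort : Set where
  term mono : Sort

Exp : Sort → Set
Exp term = Term
Exp mono = Monomial

EqE : (σ : Sort) → Exp σ → Exp σ → Set
EqE term = _≈_
EqE mono = _≈ₘ_

StepE : (σ : Sort) → Exp σ → List (Exp σ) → Set
StepE term = _⟶_
StepE mono = _⟶ₘ_

CohE : (σ : Sort) → Exp σ → Exp σ → Set
CohE term = _≍_
CohE mono = _≍ₘ_

MultE : (σ : Sort) → Exp σ → ℕ → Set
MultE term = Mult
MultE mono = MultM

-- Finite formal sums with ℕ coefficients: lists of expressions
-- (the coefficient of e is the number of entries equal to e).

Sum : Sort → Set
Sum σ = List (Exp σ)

data Coef (σ : Sort) : Sum σ → Exp σ → ℕ → Set where
  c-nil : ∀ {e} → Coef σ [] e 0
  c-yes : ∀ {x E e n} → EqE σ x e → Coef σ E e n → Coef σ (x ∷ E) e (suc n)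
  c-no  : ∀ {x E e n} → ¬ EqE σ x e → Coef σ E e n → Coef σ (x ∷ E) e n

data StepΣ (σ : Sort) : Sum σ → Sum σ → Set where
  sum-step : ∀ {F₁ e F₂ E'} → StepE σ e E' →
             StepΣ σ (F₁ ++ e ∷ F₂) (F₁ ++ E' ++ F₂)

StepΣ* : (σ : Sort) → Sum σ → Sum σ → Set
StepΣ* σ = Star (StepΣ σ)

Normal : (σ : Sort) → Sum σ → Set
Normal σ N = ∀ {N'} → ¬ StepΣ σ N N'

-- N is the normal form of the sum E: E →∂* N and N is normal
-- (unique up to equality of coefficients, by confluence and strong normalization).
IsNF : (σ : Sort) → Sum σ → Sum σ → Set
IsNF σ E N = StepΣ* σ E N × Normal σ N

{-# OPTIONS --safe #-}

-- Let iso s t be the number of isomorphisms between s and t, a bag contributing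
-- a permanent. It is m(s) if s ≈ t and 0 otherwise, so ∑_{x ∈ E} iso x b is the
-- coefficient of b in E times m(b). The uniformity lemma is then an identity: if
-- s ≍ s₀ and b occurs in ∂ s₀ · us₀, then
--   ∑_{x ∈ ∂ s · us} iso x b = iso s s₀ * iso us us₀,
-- proved by Laplace expansion. It passes to a parallel reduction contracting
-- coherent expressions in lockstep, whence ∑_{x ∈ NF s} iso x b = iso s s₀
-- whenever s ≍ s₀ and b occurs in NF s₀; the theorem is the case s = s₀.
-- An arbitrary strategy need not preserve coherence of the intermediate sums, so
-- its normal form is related to the parallel one by confluence. Confluence is
-- phrased dually: a functional f on terms is invariant when f e = ∑_{x ∈ E} f x
-- for every step e ⟶ E, and local confluence says that ∑ E₁ f = ∑ E₂ f for the
-- two sides of a peak at e if f is invariant below e. This avoids comparing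
-- formal sums up to permutation.

module Submission where

open import Defs
open import Data.Bool using (true; false; if_then_else_; T)
open import Data.Empty using (⊥-elim)
open import Data.List using (List; []; _∷_; _++_; map; concatMap; replicate)
open import Data.List.Properties using (++-identityʳ; map-∘; map-id)
open import Data.List.Membership.Propositional using (_∈_; find; lose)
open import Data.List.Membership.Propositional.Properties
  using (∈-map⁺; ∈-map⁻; ∈-concatMap⁺; ∈-concatMap⁻; ∈-++⁺ˡ; ∈-++⁺ʳ; ∈-++⁻; ∈-∃++)
open import Data.List.Relation.Unary.All as All using (All; []; _∷_)
open import Data.List.Relation.Unary.Any using (here; there)
open import Data.List.Relation.Unary.AllPairs using (AllPairs; []; _∷_)
open import Data.List.Relation.Binary.Permutation.Propositional
  using (_↭_; refl; prep; swap; trans; ↭-sym; ↭-trans)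
open import Data.List.Relation.Binary.Permutation.Propositional.Properties
  using (++⁺ˡ; shifts) renaming (shift to ↭-shift)
open import Data.Nat using (ℕ; zero; suc; _+_; _*_; _^_; _≤_; _<_; _!; _<ᵇ_; _≡ᵇ_; z≤n; s≤s)
open import Data.Nat.ListAction using (product)
open import Data.Nat.Properties
open import Data.Nat.Tactic.RingSolver using (solve-∀)
open import Data.Product using (∃; ∃-syntax; _×_; _,_; proj₁; proj₂)
open import Data.Sum using (_⊎_; inj₁; inj₂; [_,_]′)
open import Data.Unit using (tt)
open import Function using (_∘_)
open import Relation.Nullary using (¬_; yes; no)
open import Relation.Binary.PropositionalEquality
  using (_≡_; _≢_; refl; sym; cong; cong₂; subst; module ≡-Reasoning)
  renaming (trans to infixl 3 _∙_)
open import Data.Product.Relation.Binary.Lex.Strict using (×-Lex; ×-wellFounded)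
open import Data.Nat.Induction using (<-wellFounded)
open import Induction.WellFounded using (WellFounded; Acc; acc)
import Relation.Binary.Construct.On as On
open import Relation.Binary.Construct.Closure.ReflexiveTransitive using (ε; _◅_)

-- Incoherent terms violate the formula: ⟨λx.⟨y⟩[x,z]⟩[z] has multiplicity 1 and reduces, with
-- coefficient 1, to ⟨y⟩[z,z] of multiplicity 2. The result has forgotten which z replaced x.
-- Coherent terms share their shape except at opposite injections, where both sides of the identity
-- vanish, so that b determines its origin. Two terms s and s₀ are compared, instead of s with
-- itself, because the expansion of a permanent pairs every entry of one bag with every entry of the
-- other. The hypothesis that b occurs on the side of s₀ provides a decomposition of b, and the sum
-- on the side of s is computed along it. Single steps break coherence already inside a bag: for t =
-- λx.(y⊕•), contracting one copy in [t,t] yields [(λx.y)⊕•, t], and an injection is not coherent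
-- with an abstraction. Hence the detour through a parallel reduction.

private variable
  A B C : Set

-- Finite sums over lists, over choices of an entry and over splittings.

+-exchange : ∀ a b c d → a + b + (c + d) ≡ a + c + (b + d)
+-exchange = solve-∀

+-rotate : ∀ a b c → a + (b + c) ≡ b + (a + c)
+-rotate = solve-∀

swap-last : ∀ a b c → a + b + c ≡ a + c + b
swap-last = solve-∀

+-assoc-comm : ∀ a b c → a + b + c ≡ a + (c + b)
+-assoc-comm = solve-∀

*-rotate : ∀ a b c → a * (b * c) ≡ b * (a * c)
*-rotate = solve-∀

*-exchange : ∀ a b c d → a * b * (c * d) ≡ a * c * (b * d)
*-exchange = solve-∀

∑ : List A → (A → ℕ) → ℕ
∑ []       f = 0
∑ (x ∷ xs) f = f x + ∑ xs f

∑-cong-∈ : ∀ {f g : A → ℕ} xs → (∀ {x} → x ∈ xs → f x ≡ g x) → ∑ xs f ≡ ∑ xs g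
∑-cong-∈ []       h = refl
∑-cong-∈ (x ∷ xs) h = cong₂ _+_ (h (here refl)) (∑-cong-∈ xs (h ∘ there))

∑-cong : ∀ {f g : A → ℕ} xs → (∀ x → f x ≡ g x) → ∑ xs f ≡ ∑ xs g
∑-cong xs h = ∑-cong-∈ xs (λ {x} _ → h x)

∑-++ : ∀ xs {ys} {f : A → ℕ} → ∑ (xs ++ ys) f ≡ ∑ xs f + ∑ ys f
∑-++ []       = refl
∑-++ (x ∷ xs) {f = f} = cong (f x +_) (∑-++ xs) ∙ sym (+-assoc (f x) _ _)

∑-map : ∀ (h : A → B) xs {f : B → ℕ} → ∑ (map h xs) f ≡ ∑ xs (λ x → f (h x))
∑-map h []       = refl
∑-map h (x ∷ xs) {f} = cong (f (h x) +_) (∑-map h xs)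

∑-concatMap : ∀ (h : A → List B) xs {f : B → ℕ} →
  ∑ (concatMap h xs) f ≡ ∑ xs (λ x → ∑ (h x) f)
∑-concatMap h []       = refl
∑-concatMap h (x ∷ xs) {f} = ∑-++ (h x) ∙ cong (∑ (h x) f +_) (∑-concatMap h xs)

∑-zero : ∀ (xs : List A) → ∑ xs (λ _ → 0) ≡ 0
∑-zero []       = refl
∑-zero (x ∷ xs) = ∑-zero xs

∑-+ : ∀ xs {f g : A → ℕ} → ∑ xs (λ x → f x + g x) ≡ ∑ xs f + ∑ xs g
∑-+ []       = refl
∑-+ (x ∷ xs) {f} {g} = cong (f x + g x +_) (∑-+ xs) ∙ +-exchange (f x) (g x) _ _

∑-*ˡ : ∀ c xs {f : A → ℕ} → ∑ xs (λ x → c * f x) ≡ c * ∑ xs f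
∑-*ˡ c []       = sym (*-zeroʳ c)
∑-*ˡ c (x ∷ xs) {f} = cong (c * f x +_) (∑-*ˡ c xs) ∙ sym (*-distribˡ-+ c (f x) _)

∑-*ʳ : ∀ c xs {f : A → ℕ} → ∑ xs (λ x → f x * c) ≡ ∑ xs f * c
∑-*ʳ c []       = refl
∑-*ʳ c (x ∷ xs) {f} = cong (f x * c +_) (∑-*ʳ c xs) ∙ sym (*-distribʳ-+ c (f x) _)

∑-swap : ∀ xs (ys : List B) {f : A → B → ℕ} →
  ∑ xs (λ x → ∑ ys (f x)) ≡ ∑ ys (λ y → ∑ xs (λ x → f x y))
∑-swap []       ys = sym (∑-zero ys)
∑-swap (x ∷ xs) ys {f} = cong (∑ ys (f x) +_) (∑-swap xs ys) ∙ sym (∑-+ ys)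

∑-* : ∀ xs (ys : List B) {f : A → ℕ} {g : B → ℕ} →
  ∑ xs (λ x → ∑ ys (λ y → f x * g y)) ≡ ∑ xs f * ∑ ys g
∑-* xs ys {f} {g} = ∑-cong xs (λ x → ∑-*ˡ (f x) ys) ∙ ∑-*ʳ (∑ ys g) xs

0<∑ : ∀ xs {f : A → ℕ} → 0 < ∑ xs f → ∃[ x ] x ∈ xs × 0 < f x
0<∑ (x ∷ xs) {f} p with f x in eq
... | suc n = x , here refl , subst (0 <_) (sym eq) (s≤s z≤n)
... | zero  with 0<∑ xs p
...   | y , i , q = y , there i , q

-- Choices are made by position: equal entries give separate choices, so that summing over `pick`
-- yields permanents with the right repetition counts.
pick : List A → List (A × List A)
pick []       = []
pick (x ∷ xs) = (x , xs) ∷ map (λ (y , ys) → y , x ∷ ys) (pick xs)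

∑-pick-∷ : ∀ x (xs : List A) {f : A × List A → ℕ} →
  ∑ (pick (x ∷ xs)) f ≡ f (x , xs) + ∑ (pick xs) (λ (y , ys) → f (y , x ∷ ys))
∑-pick-∷ x xs {f} = cong (f (x , xs) +_) (∑-map _ (pick xs))

∑-pick-++ : ∀ xs (ys : List A) {f : A × List A → ℕ} →
  ∑ (pick (xs ++ ys)) f ≡
  ∑ (pick xs) (λ (x , xs′) → f (x , xs′ ++ ys)) + ∑ (pick ys) (λ (y , ys′) → f (y , xs ++ ys′))
∑-pick-++ []       ys = refl
∑-pick-++ (x ∷ xs) ys {f} = begin
  ∑ (pick (x ∷ xs ++ ys)) f
    ≡⟨ ∑-pick-∷ x (xs ++ ys) ⟩
  f (x , xs ++ ys) + ∑ (pick (xs ++ ys)) (λ (y , zs) → f (y , x ∷ zs))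
    ≡⟨ cong (f (x , xs ++ ys) +_) (∑-pick-++ xs ys) ⟩
  f (x , xs ++ ys) + (∑ (pick xs) (λ (y , zs) → f (y , x ∷ zs ++ ys)) + rest)
    ≡⟨ sym (+-assoc (f (x , xs ++ ys)) _ rest) ⟩
  f (x , xs ++ ys) + ∑ (pick xs) (λ (y , zs) → f (y , x ∷ zs ++ ys)) + rest
    ≡⟨ cong (_+ rest) (sym (∑-pick-∷ x xs)) ⟩
  ∑ (pick (x ∷ xs)) (λ (y , zs) → f (y , zs ++ ys)) + rest ∎
  where
  open ≡-Reasoning
  rest : ℕ
  rest = ∑ (pick ys) (λ (y , ys′) → f (y , x ∷ xs ++ ys′))

-- Both sides range over ordered pairs of distinct positions. The pairs that use the head in first
-- and in second place are interchanged; the others are left to the induction.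
∑-pick-swap : ∀ (xs : List A) {f : A → A → List A → ℕ} →
  ∑ (pick xs) (λ (x , ys) → ∑ (pick ys) (λ (y , zs) → f x y zs)) ≡
  ∑ (pick xs) (λ (x , ys) → ∑ (pick ys) (λ (y , zs) → f y x zs))
∑-pick-swap []       = refl
∑-pick-swap {A} (x ∷ xs) {f} = begin
  ∑ (pick (x ∷ xs)) (λ (y , ys) → ∑ (pick ys) (λ (z , zs) → f y z zs))
    ≡⟨ expand f ⟩
  first f + (first (λ a b → f b a) + both f)
    ≡⟨ cong (λ n → first f + (first (λ a b → f b a) + n)) (∑-pick-swap xs) ⟩
  first f + (first (λ a b → f b a) + both (λ a b → f b a))
    ≡⟨ +-rotate (first f) (first (λ a b → f b a)) (both (λ a b → f b a)) ⟩
  first (λ a b → f b a) + (first f + both (λ a b → f b a))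
    ≡⟨ sym (expand (λ a b → f b a)) ⟩
  ∑ (pick (x ∷ xs)) (λ (y , ys) → ∑ (pick ys) (λ (z , zs) → f z y zs)) ∎
  where
  open ≡-Reasoning
  first both : (A → A → List A → ℕ) → ℕ
  first g = ∑ (pick xs) (λ (y , ys) → g x y ys)
  both g = ∑ (pick xs) (λ (y , ys) → ∑ (pick ys) (λ (z , zs) → g y z (x ∷ zs)))
  expand : ∀ g → ∑ (pick (x ∷ xs)) (λ (y , ys) → ∑ (pick ys) (λ (z , zs) → g y z zs)) ≡
                 first g + (first (λ a b → g b a) + both g)
  expand g = ∑-pick-∷ x xs ∙ cong (first g +_)
    (∑-cong (pick xs) (λ (y , ys) → ∑-pick-∷ x ys) ∙ ∑-+ (pick xs))

∑-split-∷ : ∀ u us {f : List Term × List Term → ℕ} →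
  ∑ (split2 (u ∷ us)) f ≡ ∑ (split2 us) (λ (a , b) → f (u ∷ a , b) + f (a , u ∷ b))
∑-split-∷ u us {f} = ∑-concatMap _ (split2 us) ∙
  ∑-cong (split2 us) (λ (a , b) → cong (f (u ∷ a , b) +_) (+-identityʳ _))

∈-split2-∷⁻ : ∀ u us {a b} → (a , b) ∈ split2 (u ∷ us) →
  (∃[ a′ ] (a′ , b) ∈ split2 us × a ≡ u ∷ a′) ⊎ (∃[ b′ ] (a , b′) ∈ split2 us × b ≡ u ∷ b′)
∈-split2-∷⁻ u us i with find (∈-concatMap⁻ _ {xs = split2 us} i)
... | _ , j , here refl         = inj₁ (_ , j , refl)
... | _ , j , there (here refl) = inj₂ (_ , j , refl)

∈-split2-↭ : ∀ us {a b} → (a , b) ∈ split2 us → us ↭ a ++ b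
∈-split2-↭ []       (here refl) = refl
∈-split2-↭ (u ∷ us) {a} i with ∈-split2-∷⁻ u us i
... | inj₁ (_ , j , refl) = prep u (∈-split2-↭ us j)
... | inj₂ (b , j , refl) = ↭-trans (prep u (∈-split2-↭ us j)) (↭-sym (↭-shift u a b))

-- The common shape of D at an application and of DM at a non-empty bag.
Bilinear : (A → B → C) → List (List Term × List Term) →
  (List Term → List A) → (List Term → List B) → List C
Bilinear con L F G =
  concatMap (λ p → concatMap (λ x → map (con x) (G (proj₂ p))) (F (proj₁ p))) L

∑-Bilinear : ∀ (con : A → B → C) L F G {f : C → ℕ} → ∑ (Bilinear con L F G) f ≡
  ∑ L (λ (a , b) → ∑ (F a) (λ x → ∑ (G b) (λ y → f (con x y))))
∑-Bilinear con L F G = ∑-concatMap _ L ∙ ∑-cong L (λ (a , b) →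
  ∑-concatMap _ (F a) ∙ ∑-cong (F a) (λ x → ∑-map (con x) (G b)))

∈-Bilinear⁻ : ∀ (con : A → B → C) L F G {z} → z ∈ Bilinear con L F G →
  ∃[ a ] ∃[ b ] ∃[ x ] ∃[ y ] (a , b) ∈ L × x ∈ F a × y ∈ G b × z ≡ con x y
∈-Bilinear⁻ con L F G i with find (∈-concatMap⁻ _ {xs = L} i)
... | (a , b) , j , i′ with find (∈-concatMap⁻ _ {xs = F a} i′)
... | x , k , i″ with ∈-map⁻ _ i″
... | y , l , eq = a , b , x , y , j , k , l , eq

∈-Bilinear⁺ : ∀ (con : A → B → C) L F G {a b x y} →
  (a , b) ∈ L → x ∈ F a → y ∈ G b → con x y ∈ Bilinear con L F G
∈-Bilinear⁺ con L F G j k l =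
  ∈-concatMap⁺ _ (lose j (∈-concatMap⁺ _ (lose k (∈-map⁺ _ l))))

∑-D-app : ∀ k s ts us {f} → ∑ (D k (app s ts) us) f ≡
  ∑ (split2 us) (λ (a , b) → ∑ (D k s a) (λ x → ∑ (DM k ts b) (λ y → f (app x y))))
∑-D-app k s ts us = ∑-Bilinear app (split2 us) (D k s) (DM k ts)

∑-DM-∷ : ∀ k t ts us {f} → ∑ (DM k (t ∷ ts) us) f ≡
  ∑ (split2 us) (λ (a , b) → ∑ (D k t a) (λ x → ∑ (DM k ts b) (λ y → f (x ∷ y))))
∑-DM-∷ k t ts us = ∑-Bilinear _∷_ (split2 us) (D k t) (DM k ts)

-- Isomorphism counts and permanents.

-- The number of isomorphisms between two resource expressions: a bag
-- contributes a permanent, expanded here along the first row.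
mutual
  iso : Term → Term → ℕ
  iso (var x)    (var y)    = if x ≡ᵇ y then 1 else 0
  iso (lam s)    (lam t)    = iso s t
  iso (app s ss) (app t ts) = iso s t * isoM ss ts
  iso (inl s)    (inl t)    = iso s t
  iso (inr s)    (inr t)    = iso s t
  iso _          _          = 0

  isoM : Monomial → Monomial → ℕ
  isoM []       []      = 1
  isoM []       (_ ∷ _) = 0
  isoM (t ∷ ts) vs      = ∑ (pick vs) (λ (v , vs′) → iso t v * isoM ts vs′)

-- The term in which the first row meets the first column is split off. In every other term the
-- expansions along that row and that column are independent and commute. This is the source of the
-- symmetry of `isoM`.
isoM-column : ∀ us v vs →
  isoM us (v ∷ vs) ≡ ∑ (pick us) (λ (u , us′) → iso u v * isoM us′ vs)
isoM-column []       v vs = refl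
isoM-column (u ∷ us) v vs = begin
  ∑ (pick (v ∷ vs)) (λ (w , ws) → iso u w * isoM us ws)
    ≡⟨ ∑-pick-∷ v vs ⟩
  iso u v * isoM us vs + ∑ (pick vs) (λ (w , ws) → iso u w * isoM us (v ∷ ws))
    ≡⟨ cong (iso u v * isoM us vs +_) (∑-cong (pick vs) (λ (w , ws) →
         cong (iso u w *_) (isoM-column us v ws) ∙ sym (∑-*ˡ (iso u w) (pick us)))) ⟩
  iso u v * isoM us vs +
  ∑ (pick vs) (λ (w , ws) → ∑ (pick us) (λ (x , xs) → iso u w * (iso x v * isoM xs ws)))
    ≡⟨ cong (iso u v * isoM us vs +_) (∑-swap (pick vs) (pick us)) ⟩
  iso u v * isoM us vs +
  ∑ (pick us) (λ (x , xs) → ∑ (pick vs) (λ (w , ws) → iso u w * (iso x v * isoM xs ws)))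
    ≡⟨ cong (iso u v * isoM us vs +_) (∑-cong (pick us) (λ (x , xs) →
         ∑-cong (pick vs) (λ (w , ws) → *-rotate (iso u w) (iso x v) (isoM xs ws)) ∙
         ∑-*ˡ (iso x v) (pick vs))) ⟩
  iso u v * isoM us vs + ∑ (pick us) (λ (x , xs) → iso x v * isoM (u ∷ xs) vs)
    ≡⟨ sym (∑-pick-∷ u us) ⟩
  ∑ (pick (u ∷ us)) (λ (x , xs) → iso x v * isoM xs vs) ∎
  where open ≡-Reasoning

mutual
  iso-sym : ∀ s t → iso s t ≡ iso t s
  iso-sym (var x)    (var y)    = cong (if_then 1 else 0) (≡ᵇ-sym x y)
    where
    ≡ᵇ-sym : ∀ m n → (m ≡ᵇ n) ≡ (n ≡ᵇ m)
    ≡ᵇ-sym zero    zero    = refl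
    ≡ᵇ-sym zero    (suc n) = refl
    ≡ᵇ-sym (suc m) zero    = refl
    ≡ᵇ-sym (suc m) (suc n) = ≡ᵇ-sym m n
  iso-sym (lam s)    (lam t)    = iso-sym s t
  iso-sym (app s ss) (app t ts) = cong₂ _*_ (iso-sym s t) (isoM-sym ss ts)
  iso-sym (inl s)    (inl t)    = iso-sym s t
  iso-sym (inr s)    (inr t)    = iso-sym s t
  iso-sym (var x)    (lam t)    = refl
  iso-sym (var x)    (app t ts) = refl
  iso-sym (var x)    (inl t)    = refl
  iso-sym (var x)    (inr t)    = refl
  iso-sym (lam s)    (var y)    = refl
  iso-sym (lam s)    (app t ts) = refl
  iso-sym (lam s)    (inl t)    = refl
  iso-sym (lam s)    (inr t)    = refl
  iso-sym (app s ss) (var y)    = refl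
  iso-sym (app s ss) (lam t)    = refl
  iso-sym (app s ss) (inl t)    = refl
  iso-sym (app s ss) (inr t)    = refl
  iso-sym (inl s)    (var y)    = refl
  iso-sym (inl s)    (lam t)    = refl
  iso-sym (inl s)    (app t ts) = refl
  iso-sym (inl s)    (inr t)    = refl
  iso-sym (inr s)    (var y)    = refl
  iso-sym (inr s)    (lam t)    = refl
  iso-sym (inr s)    (app t ts) = refl
  iso-sym (inr s)    (inl t)    = refl

  isoM-sym : ∀ us vs → isoM us vs ≡ isoM vs us
  isoM-sym []       []       = refl
  isoM-sym []       (v ∷ vs) = refl
  isoM-sym (u ∷ us) vs       =
    ∑-cong (pick vs) (λ (v , vs′) → cong₂ _*_ (iso-sym u v) (isoM-sym us vs′)) ∙
    sym (isoM-column vs u us)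

-- A permanent does not change when two adjacent rows are exchanged, by `∑-pick-swap`; the row of t
-- climbs to the top by such exchanges.
isoM-insert : ∀ l₁ t l₂ vs → isoM (l₁ ++ t ∷ l₂) vs ≡ isoM (t ∷ l₁ ++ l₂) vs
isoM-insert []       t l₂ vs = refl
isoM-insert (x ∷ l₁) t l₂ vs = begin
  ∑ (pick vs) (λ (v , ws) → iso x v * isoM (l₁ ++ t ∷ l₂) ws)
    ≡⟨ ∑-cong (pick vs) (λ (v , ws) → cong (iso x v *_) (isoM-insert l₁ t l₂ ws) ∙
         sym (∑-*ˡ (iso x v) (pick ws))) ⟩
  ∑ (pick vs) (λ (v , ws) → ∑ (pick ws) (λ (w , zs) → iso x v * (iso t w * isoM (l₁ ++ l₂) zs)))
    ≡⟨ ∑-pick-swap vs ⟩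
  ∑ (pick vs) (λ (w , ws) → ∑ (pick ws) (λ (v , zs) → iso x v * (iso t w * isoM (l₁ ++ l₂) zs)))
    ≡⟨ ∑-cong (pick vs) (λ (w , ws) →
         ∑-cong (pick ws) (λ (v , zs) → *-rotate (iso x v) (iso t w) (isoM (l₁ ++ l₂) zs)) ∙
         ∑-*ˡ (iso t w) (pick ws)) ⟩
  ∑ (pick vs) (λ (w , ws) → iso t w * isoM (x ∷ l₁ ++ l₂) ws) ∎
  where open ≡-Reasoning

isoM-cong-∷ : ∀ t us vs → (∀ ws → isoM us ws ≡ isoM vs ws) →
  ∀ ws → isoM (t ∷ us) ws ≡ isoM (t ∷ vs) ws
isoM-cong-∷ t us vs h ws = ∑-cong (pick ws) (λ (w , ws′) → cong (iso t w *_) (h ws′))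

isoM-↭ : ∀ {us vs} → us ↭ vs → ∀ ws → isoM us ws ≡ isoM vs ws
isoM-↭ refl ws = refl
isoM-↭ {_ ∷ us} {_ ∷ vs} (prep x p) ws = isoM-cong-∷ x us vs (isoM-↭ p) ws
isoM-↭ {_ ∷ _ ∷ us} {_ ∷ _ ∷ vs} (swap x y p) ws =
  isoM-cong-∷ x (y ∷ us) (y ∷ vs) (isoM-cong-∷ y us vs (isoM-↭ p)) ws ∙
  isoM-insert (x ∷ []) y vs ws
isoM-↭ (trans p q) ws = isoM-↭ p ws ∙ isoM-↭ q ws

isoM-↭ʳ : ∀ ws {us vs} → us ↭ vs → isoM ws us ≡ isoM ws vs
isoM-↭ʳ ws {us} {vs} p = isoM-sym ws us ∙ isoM-↭ p ws ∙ isoM-sym vs ws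

mutual
  iso-≈ : ∀ {s t} → s ≈ t → ∀ c → iso s c ≡ iso t c
  iso-≈ var≈ c = refl
  iso-≈ (lam≈ p) (var x)    = refl
  iso-≈ (lam≈ p) (lam c)    = iso-≈ p c
  iso-≈ (lam≈ p) (app c cs) = refl
  iso-≈ (lam≈ p) (inl c)    = refl
  iso-≈ (lam≈ p) (inr c)    = refl
  iso-≈ (app≈ p q) (var x)    = refl
  iso-≈ (app≈ p q) (lam c)    = refl
  iso-≈ (app≈ p q) (app c cs) = cong₂ _*_ (iso-≈ p c) (isoM-≈ q cs)
  iso-≈ (app≈ p q) (inl c)    = refl
  iso-≈ (app≈ p q) (inr c)    = refl
  iso-≈ (inl≈ p) (var x)    = refl
  iso-≈ (inl≈ p) (lam c)    = refl
  iso-≈ (inl≈ p) (app c cs) = refl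
  iso-≈ (inl≈ p) (inl c)    = iso-≈ p c
  iso-≈ (inl≈ p) (inr c)    = refl
  iso-≈ (inr≈ p) (var x)    = refl
  iso-≈ (inr≈ p) (lam c)    = refl
  iso-≈ (inr≈ p) (app c cs) = refl
  iso-≈ (inr≈ p) (inl c)    = refl
  iso-≈ (inr≈ p) (inr c)    = iso-≈ p c

  isoM-≈ : ∀ {us vs} → us ≈ₘ vs → ∀ cs → isoM us cs ≡ isoM vs cs
  isoM-≈ []≈ cs = refl
  isoM-≈ (∷≈ {t} {t′} {ts} {l₁} {l₂} p q) cs =
    ∑-cong (pick cs) (λ (c , cs′) → cong₂ _*_ (iso-≈ p c) (isoM-≈ q cs′)) ∙
    sym (isoM-insert l₁ t′ l₂ cs)

∈-pick⁻ : ∀ {x xs′} (xs : List A) → (x , xs′) ∈ pick xs →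
  ∃[ l₁ ] ∃[ l₂ ] xs ≡ l₁ ++ x ∷ l₂ × xs′ ≡ l₁ ++ l₂
∈-pick⁻ (x ∷ xs) (here refl) = [] , xs , refl , refl
∈-pick⁻ (x ∷ xs) (there i) with ∈-map⁻ _ i
... | (y , ys) , j , refl with ∈-pick⁻ xs j
... | l₁ , l₂ , refl , refl = x ∷ l₁ , l₂ , refl , refl

0<*⁻ : ∀ m n → 0 < m * n → 0 < m × 0 < n
0<*⁻ (suc m) (suc n) p = s≤s z≤n , s≤s z≤n
0<*⁻ (suc m) zero    p = ⊥-elim (<-irrefl refl (subst (0 <_) (*-zeroʳ m) p))

mutual
  -- A positive permanent has a positive term in its first row, and that column is the partner which
  -- `∷≈` asks for.
  0<iso⇒≈ : ∀ s t → 0 < iso s t → s ≈ t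
  0<iso⇒≈ (var x) (var y) p with x ≡ᵇ y in eq
  ... | true with refl ← ≡ᵇ⇒≡ x y (subst T (sym eq) tt) = var≈
  0<iso⇒≈ (lam s)    (lam t)    p = lam≈ (0<iso⇒≈ s t p)
  0<iso⇒≈ (app s ss) (app t ts) p = app≈
    (0<iso⇒≈ s t (proj₁ (0<*⁻ (iso s t) _ p))) (0<isoM⇒≈ ss ts (proj₂ (0<*⁻ (iso s t) _ p)))
  0<iso⇒≈ (inl s)    (inl t)    p = inl≈ (0<iso⇒≈ s t p)
  0<iso⇒≈ (inr s)    (inr t)    p = inr≈ (0<iso⇒≈ s t p)

  0<isoM⇒≈ : ∀ us vs → 0 < isoM us vs → us ≈ₘ vs
  0<isoM⇒≈ []       []       p = []≈
  0<isoM⇒≈ (u ∷ us) vs       p with 0<∑ (pick vs) p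
  ... | (v , vs′) , i , q with ∈-pick⁻ vs i
  ... | l₁ , l₂ , refl , refl = ∷≈
    (0<iso⇒≈ u v (proj₁ (0<*⁻ (iso u v) _ q)))
    (0<isoM⇒≈ us (l₁ ++ l₂) (proj₂ (0<*⁻ (iso u v) _ q)))

≡ᵇ-refl : ∀ n → (n ≡ᵇ n) ≡ true
≡ᵇ-refl zero    = refl
≡ᵇ-refl (suc n) = ≡ᵇ-refl n

mutual
  0<iso-refl : ∀ s → 0 < iso s s
  0<iso-refl (var x) rewrite ≡ᵇ-refl x = s≤s z≤n
  0<iso-refl (lam s)    = 0<iso-refl s
  0<iso-refl (app s ts) = *-mono-≤ (0<iso-refl s) (0<isoM-refl ts)
  0<iso-refl (inl s)    = 0<iso-refl s
  0<iso-refl (inr s)    = 0<iso-refl s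

  0<isoM-refl : ∀ ts → 0 < isoM ts ts
  0<isoM-refl []       = s≤s z≤n
  0<isoM-refl (t ∷ ts) =
    ≤-trans (*-mono-≤ (0<iso-refl t) (0<isoM-refl ts)) (m≤m+n (iso t t * isoM ts ts) _)

-- Laplace expansion of a permanent along the columns v₁, v₂.
isoM-split : ∀ us v₁ v₂ →
  ∑ (split2 us) (λ (a , b) → isoM a v₁ * isoM b v₂) ≡ isoM us (v₁ ++ v₂)
isoM-split []       []       []      = refl
isoM-split []       []       (_ ∷ _) = refl
isoM-split []       (_ ∷ _)  _       = refl
isoM-split (u ∷ us) v₁ v₂ = begin
  ∑ (split2 (u ∷ us)) (λ (a , b) → isoM a v₁ * isoM b v₂)
    ≡⟨ ∑-split-∷ u us ∙ ∑-+ (split2 us) ⟩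
  ∑ (split2 us) (λ (a , b) → isoM (u ∷ a) v₁ * isoM b v₂) +
  ∑ (split2 us) (λ (a , b) → isoM a v₁ * isoM (u ∷ b) v₂)
    ≡⟨ cong₂ _+_ left right ⟩
  ∑ (pick v₁) (λ (v , vs) → iso u v * isoM us (vs ++ v₂)) +
  ∑ (pick v₂) (λ (v , vs) → iso u v * isoM us (v₁ ++ vs))
    ≡⟨ sym (∑-pick-++ v₁ v₂) ⟩
  isoM (u ∷ us) (v₁ ++ v₂) ∎
  where
  open ≡-Reasoning
  left : ∑ (split2 us) (λ (a , b) → isoM (u ∷ a) v₁ * isoM b v₂) ≡
         ∑ (pick v₁) (λ (v , vs) → iso u v * isoM us (vs ++ v₂))
  left = ∑-cong (split2 us) (λ (a , b) → sym (∑-*ʳ (isoM b v₂) (pick v₁))) ∙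
    ∑-swap (split2 us) (pick v₁) ∙
    ∑-cong (pick v₁) (λ (v , vs) →
      ∑-cong (split2 us) (λ (a , b) → *-assoc (iso u v) _ _) ∙
      ∑-*ˡ (iso u v) (split2 us) ∙ cong (iso u v *_) (isoM-split us vs v₂))
  right : ∑ (split2 us) (λ (a , b) → isoM a v₁ * isoM (u ∷ b) v₂) ≡
          ∑ (pick v₂) (λ (v , vs) → iso u v * isoM us (v₁ ++ vs))
  right = ∑-cong (split2 us) (λ (a , b) → sym (∑-*ˡ (isoM a v₁) (pick v₂))) ∙
    ∑-swap (split2 us) (pick v₂) ∙
    ∑-cong (pick v₂) (λ (v , vs) →
      ∑-cong (split2 us) (λ (a , b) → *-rotate (isoM a v₁) (iso u v) (isoM b vs)) ∙
      ∑-*ˡ (iso u v) (split2 us) ∙ cong (iso u v *_) (isoM-split us v₁ vs))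

-- Splittings into three and four bins.

module _ (h : List Term → List Term → List Term → ℕ) where
  splitʳ splitˡ splitᵐ : List Term → ℕ
  splitʳ us = ∑ (split2 us) λ (a , v) → ∑ (split2 v) λ (b , c) → h a b c
  splitˡ us = ∑ (split2 us) λ (v , c) → ∑ (split2 v) λ (a , b) → h a b c
  splitᵐ us = ∑ (split2 us) λ (b , v) → ∑ (split2 v) λ (a , c) → h a b c

module _ (u : Term) (us : List Term) (h : List Term → List Term → List Term → ℕ) where
  private
    h₁ h₂ h₃ : List Term → List Term → List Term → ℕ
    h₁ a b c = h (u ∷ a) b c
    h₂ a b c = h a (u ∷ b) c
    h₃ a b c = h a b (u ∷ c)

  splitʳ-∷ : splitʳ h (u ∷ us) ≡
    splitʳ h₁ us + (splitʳ h₂ us + splitʳ h₃ us)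
  splitʳ-∷ = ∑-split-∷ u us ∙ ∑-+ (split2 us) ∙ cong (splitʳ h₁ us +_)
    (∑-cong (split2 us) (λ (a , v) → ∑-split-∷ u v ∙ ∑-+ (split2 v)) ∙ ∑-+ (split2 us))

  splitˡ-∷ : splitˡ h (u ∷ us) ≡
    splitˡ h₁ us + splitˡ h₂ us + splitˡ h₃ us
  splitˡ-∷ = ∑-split-∷ u us ∙ ∑-+ (split2 us) ∙ cong (_+ splitˡ h₃ us)
    (∑-cong (split2 us) (λ (v , c) → ∑-split-∷ u v ∙ ∑-+ (split2 v)) ∙ ∑-+ (split2 us))

  splitᵐ-∷ : splitᵐ h (u ∷ us) ≡
    splitᵐ h₂ us + (splitᵐ h₁ us + splitᵐ h₃ us)
  splitᵐ-∷ = ∑-split-∷ u us ∙ ∑-+ (split2 us) ∙ cong (splitᵐ h₂ us +_)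
    (∑-cong (split2 us) (λ (b , v) → ∑-split-∷ u v ∙ ∑-+ (split2 v)) ∙ ∑-+ (split2 us))

-- Both nestings of `split2` place each entry in exactly one of three bins; the recurrences for a
-- new entry have the same three terms.
splitʳ≡splitˡ : ∀ us h → splitʳ h us ≡ splitˡ h us
splitʳ≡splitˡ []       h = refl
splitʳ≡splitˡ (u ∷ us) h = splitʳ-∷ u us h ∙
  cong₂ _+_ (splitʳ≡splitˡ us _) (cong₂ _+_ (splitʳ≡splitˡ us _) (splitʳ≡splitˡ us _)) ∙
  sym (+-assoc (splitˡ _ us) (splitˡ _ us) (splitˡ _ us)) ∙
  sym (splitˡ-∷ u us h)

splitʳ≡splitᵐ : ∀ us h → splitʳ h us ≡ splitᵐ h us
splitʳ≡splitᵐ []       h = refl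
splitʳ≡splitᵐ (u ∷ us) h = splitʳ-∷ u us h ∙
  cong₂ _+_ (splitʳ≡splitᵐ us _) (cong₂ _+_ (splitʳ≡splitᵐ us _) (splitʳ≡splitᵐ us _)) ∙
  +-rotate (splitᵐ _ us) (splitᵐ _ us) (splitᵐ _ us) ∙
  sym (splitᵐ-∷ u us h)

-- The four bins form a two by two table, filled by rows on one side and by columns on the other.
split-exchange : ∀ us {h : List Term → List Term → List Term → List Term → ℕ} →
  ∑ (split2 us) (λ (v , w) → ∑ (split2 v) λ (a , b) → ∑ (split2 w) λ (c , d) → h a b c d) ≡
  ∑ (split2 us) (λ (v , w) → ∑ (split2 v) λ (a , c) → ∑ (split2 w) λ (b , d) → h a b c d)
split-exchange [] = refl
split-exchange (u ∷ us) {h} = begin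
  X h (u ∷ us)
    ≡⟨ X-∷ h ⟩
  X h₁ us + X h₂ us + (X h₃ us + X h₄ us)
    ≡⟨ cong₂ _+_ (cong₂ _+_ (split-exchange us) (split-exchange us))
                 (cong₂ _+_ (split-exchange us) (split-exchange us)) ⟩
  X′ h₁ + X′ h₂ + (X′ h₃ + X′ h₄)
    ≡⟨ +-exchange (X′ h₁) (X′ h₂) (X′ h₃) (X′ h₄) ⟩
  X′ h₁ + X′ h₃ + (X′ h₂ + X′ h₄)
    ≡⟨ sym (X-∷ (λ a c b d → h a b c d)) ⟩
  X (λ a c b d → h a b c d) (u ∷ us) ∎
  where
  open ≡-Reasoning
  Fun : Set
  Fun = List Term → List Term → List Term → List Term → ℕ
  X : Fun → List Term → ℕ
  X h us = ∑ (split2 us) λ (v , w) → ∑ (split2 v) λ (a , b) → ∑ (split2 w) λ (c , d) → h a b c d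
  X′ : Fun → ℕ
  X′ h = X (λ a c b d → h a b c d) us
  h₁ h₂ h₃ h₄ : Fun
  h₁ a b c d = h (u ∷ a) b c d
  h₂ a b c d = h a (u ∷ b) c d
  h₃ a b c d = h a b (u ∷ c) d
  h₄ a b c d = h a b c (u ∷ d)
  X-∷ : ∀ h → X h (u ∷ us) ≡
    X (λ a → h (u ∷ a)) us + X (λ a b → h a (u ∷ b)) us +
    (X (λ a b c → h a b (u ∷ c)) us + X (λ a b c d → h a b c (u ∷ d)) us)
  X-∷ h = ∑-split-∷ u us ∙ ∑-+ (split2 us) ∙ cong₂ _+_
    (∑-cong (split2 us) (λ (v , w) → ∑-split-∷ u v ∙ ∑-+ (split2 v)) ∙ ∑-+ (split2 us))
    (∑-cong (split2 us) (λ (v , w) →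
       ∑-cong (split2 v) (λ (a , b) → ∑-split-∷ u w ∙ ∑-+ (split2 w)) ∙ ∑-+ (split2 v)) ∙
     ∑-+ (split2 us))

split-[]ˡ : ∀ us {f} → (∀ u a b → f (u ∷ a , b) ≡ 0) → ∑ (split2 us) f ≡ f ([] , us)
split-[]ˡ []       h = +-identityʳ _
split-[]ˡ (u ∷ us) {f} h = ∑-split-∷ u us ∙
  ∑-cong (split2 us) (λ (a , b) → cong (_+ f (a , u ∷ b)) (h u a b)) ∙
  split-[]ˡ us (λ v a b → h v a (u ∷ b))

split-[]ʳ : ∀ us {f} → (∀ a u b → f (a , u ∷ b) ≡ 0) → ∑ (split2 us) f ≡ f (us , [])
split-[]ʳ []       h = +-identityʳ _
split-[]ʳ (u ∷ us) {f} h = ∑-split-∷ u us ∙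
  ∑-cong (split2 us) (λ (a , b) → cong (f (u ∷ a , b) +_) (h a u b) ∙ +-identityʳ _) ∙
  split-[]ʳ us (λ a → h (u ∷ a))

split-shiftM : ∀ c d us {f} →
  ∑ (split2 (shiftM c d us)) f ≡ ∑ (split2 us) (λ (a , b) → f (shiftM c d a , shiftM c d b))
split-shiftM c d []       = refl
split-shiftM c d (u ∷ us) = ∑-split-∷ (shift c d u) (shiftM c d us) ∙ split-shiftM c d us ∙
  sym (∑-split-∷ u us)

-- De Bruijn arithmetic.
<ᵇ-true : ∀ {m n} → m < n → (m <ᵇ n) ≡ true
<ᵇ-true {zero}  {suc n} p       = refl
<ᵇ-true {suc m} {suc n} (s≤s p) = <ᵇ-true p

<ᵇ-false : ∀ {m n} → n ≤ m → (m <ᵇ n) ≡ false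
<ᵇ-false {m}     {zero}  p       = refl
<ᵇ-false {suc m} {suc n} (s≤s p) = <ᵇ-false p

≡ᵇ-false : ∀ {m n} → m ≢ n → (m ≡ᵇ n) ≡ false
≡ᵇ-false {zero}  {zero}  p = ⊥-elim (p refl)
≡ᵇ-false {zero}  {suc n} p = refl
≡ᵇ-false {suc m} {zero}  p = refl
≡ᵇ-false {suc m} {suc n} p = ≡ᵇ-false (p ∘ cong suc)

shift-< : ∀ {c} d {y} → y < c → shift c d (var y) ≡ var y
shift-< d p rewrite <ᵇ-true p = refl

shift-≥ : ∀ {c} d {y} → c ≤ y → shift c d (var y) ≡ var (y + d)
shift-≥ d p rewrite <ᵇ-false p = refl

-- `D` on a variable inspects the bag before the variable. `only` (the variable is not the one
-- derived) and `hit` (it is) restate that rule with the position of the variable decided first.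
only : List A → B → List B
only []      x = x ∷ []
only (_ ∷ _) x = []

hit : ℕ → List Term → List Term
hit k []          = []
hit k (u ∷ [])    = shift 0 k u ∷ []
hit k (_ ∷ _ ∷ _) = []

-- In `gt` the variable is presented as a successor because the derivative binds off one index below
-- it: the result is `var y`, free of truncated subtraction.
data Cmp (k : ℕ) : ℕ → Set where
  lt : ∀ {y} → y < k → Cmp k y
  eq : Cmp k k
  gt : ∀ {y} → k ≤ y → Cmp k (suc y)

cmp : ∀ k y → Cmp k y
cmp zero    zero    = eq
cmp zero    (suc y) = gt z≤n
cmp (suc k) zero    = lt (s≤s z≤n)
cmp (suc k) (suc y) with cmp k y
... | lt p = lt (s≤s p)
... | eq   = eq
... | gt p = gt (s≤s p)

D-lt : ∀ {k y} → y < k → ∀ us → D k (var y) us ≡ only us (var y)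
D-lt p [] rewrite ≡ᵇ-false (<⇒≢ p) | <ᵇ-true p = refl
D-lt p (u ∷ []) rewrite ≡ᵇ-false (<⇒≢ p) = refl
D-lt p (u ∷ _ ∷ _) = refl

D-eq : ∀ k us → D k (var k) us ≡ hit k us
D-eq k [] rewrite ≡ᵇ-refl k = refl
D-eq k (u ∷ []) rewrite ≡ᵇ-refl k = refl
D-eq k (u ∷ _ ∷ _) = refl

D-gt : ∀ {k y} → k ≤ y → ∀ us → D k (var (suc y)) us ≡ only us (var y)
D-gt {k} {y} p [] rewrite ≡ᵇ-false {suc y} {k} (λ q → <⇒≢ (s≤s p) (sym q))
                        | <ᵇ-false {suc y} {k} (m≤n⇒m≤1+n p) = refl
D-gt {k} {y} p (u ∷ []) rewrite ≡ᵇ-false {suc y} {k} (λ q → <⇒≢ (s≤s p) (sym q)) = refl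
D-gt p (u ∷ _ ∷ _) = refl

∑≡ : ∀ {xs ys : List A} {f} → xs ≡ ys → ∑ xs f ≡ ∑ ys f
∑≡ refl = refl

only-shiftM : ∀ c d us {x : Term} {f} → ∑ (only (shiftM c d us) x) f ≡ ∑ (only us x) f
only-shiftM c d []      = refl
only-shiftM c d (_ ∷ _) = refl

only-const : ∀ (us : List B) (x : A) {f} → ∑ (only us x) f ≡ ∑ (only us tt) (λ _ → f x)
only-const []      x = refl
only-const (_ ∷ _) x = refl

only-cong : ∀ (us : List B) {x : A} {y : C} {f : A → ℕ} {g : C → ℕ} →
  f x ≡ g y → ∑ (only us x) f ≡ ∑ (only us y) g
only-cong []      p = cong (_+ 0) p
only-cong (_ ∷ _) p = refl

DM-[] : ∀ k us → DM k [] us ≡ only us []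
DM-[] k []      = refl
DM-[] k (_ ∷ _) = refl

-- Linear substitution and shifts.

mutual
  -- The cutoff of the d new variables lies above the block of j variables inserted at b, hence it
  -- moves by j once that block is present.
  shift-comm : ∀ b j c d u →
    shift (b + j + c) d (shift b j u) ≡ shift b j (shift (b + c) d u)
  shift-comm b j c d (var y) with y <? b
  ... | yes p rewrite shift-< j p
                    | shift-< {b + j + c} d (≤-trans p (≤-trans (m≤m+n b j) (m≤m+n (b + j) c)))
                    | shift-< {b + c} d (≤-trans p (m≤m+n b c)) | shift-< j p = refl
  ... | no p with y <? b + c
  ... | yes q rewrite shift-≥ j (≮⇒≥ p) | shift-< d q | shift-≥ j (≮⇒≥ p) =
    shift-< d (subst (y + j <_) (swap-last b c j) (+-monoˡ-< j q))
  ... | no q rewrite shift-≥ j (≮⇒≥ p) | shift-≥ d (≮⇒≥ q)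
                   | shift-≥ {b} j {y + d} (≤-trans (≮⇒≥ p) (m≤m+n y d)) =
    shift-≥ d (subst (_≤ y + j) (swap-last b c j) (+-monoˡ-≤ j (≮⇒≥ q))) ∙
    cong var (swap-last y j d)
  shift-comm b j c d (lam s)    = cong lam (shift-comm (suc b) j c d s)
  shift-comm b j c d (app s ts) = cong₂ app (shift-comm b j c d s) (shiftM-comm b j c d ts)
  shift-comm b j c d (inl s)    = cong inl (shift-comm b j c d s)
  shift-comm b j c d (inr s)    = cong inr (shift-comm b j c d s)

  shiftM-comm : ∀ b j c d us →
    shiftM (b + j + c) d (shiftM b j us) ≡ shiftM b j (shiftM (b + c) d us)
  shiftM-comm b j c d []       = refl
  shiftM-comm b j c d (u ∷ us) = cong₂ _∷_ (shift-comm b j c d u) (shiftM-comm b j c d us)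

mutual
  -- The second cutoff falls inside the block of c + k variables inserted at b, so the second
  -- insertion just enlarges the block.
  shift-merge : ∀ b c j k u →
    shift (b + c) j (shift b (c + k) u) ≡ shift b (c + (j + k)) u
  shift-merge b c j k (var y) with y <? b
  ... | yes p rewrite shift-< (c + k) p | shift-< (c + (j + k)) p =
    shift-< j (≤-trans p (m≤m+n b c))
  ... | no p rewrite shift-≥ (c + k) (≮⇒≥ p) | shift-≥ (c + (j + k)) (≮⇒≥ p) =
    shift-≥ j (+-mono-≤ (≮⇒≥ p) (m≤m+n c k)) ∙ cong var (arith y c k j)
    where
    arith : ∀ y c k j → y + (c + k) + j ≡ y + (c + (j + k))
    arith = solve-∀
  shift-merge b c j k (lam s)    = cong lam (shift-merge (suc b) c j k s)
  shift-merge b c j k (app s ts) = cong₂ app (shift-merge b c j k s) (shiftM-merge b c j k ts)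
  shift-merge b c j k (inl s)    = cong inl (shift-merge b c j k s)
  shift-merge b c j k (inr s)    = cong inr (shift-merge b c j k s)

  shiftM-merge : ∀ b c j k us →
    shiftM (b + c) j (shiftM b (c + k) us) ≡ shiftM b (c + (j + k)) us
  shiftM-merge b c j k []       = refl
  shiftM-merge b c j k (u ∷ us) = cong₂ _∷_ (shift-merge b c j k u) (shiftM-merge b c j k us)

mutual
  -- The j new variables are inserted at or below the derived variable, whose index rises from c + k
  -- to c + (j + k). The bag stays as it is: it lives outside all these binders and is shifted only
  -- where it is inserted.
  D-weaken : ∀ c j k t us {f} →
    ∑ (D (c + (j + k)) (shift c j t) us) f ≡ ∑ (D (c + k) t us) (λ x → f (shift c j x))
  D-weaken c j k (var y) us {f} with y <? c
  ... | yes p rewrite shift-< j p | D-lt {c + (j + k)} (≤-trans p (m≤m+n c _)) us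
                    | D-lt {c + k} (≤-trans p (m≤m+n c k)) us =
    only-cong us (cong f (sym (shift-< j p)))
  ... | no p rewrite shift-≥ j (≮⇒≥ p) with cmp (c + k) y
  ... | lt q rewrite D-lt q us | D-lt (subst (y + j <_) (+-assoc-comm c k j) (+-monoˡ-< j q)) us =
    only-cong us (cong f (sym (shift-≥ j (≮⇒≥ p))))
  ... | eq rewrite D-eq (c + k) us | +-assoc-comm c k j | D-eq (c + (j + k)) us = hits us
    where
    hits : ∀ us → ∑ (hit (c + (j + k)) us) f ≡ ∑ (hit (c + k) us) (λ x → f (shift c j x))
    hits []          = refl
    hits (u ∷ [])    = cong (λ x → f x + 0) (sym (shift-merge 0 c j k u))
    hits (_ ∷ _ ∷ _) = refl
  ... | gt {y = y′} q rewrite D-gt q us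
                            | D-gt (subst (_≤ y′ + j) (+-assoc-comm c k j) (+-monoˡ-≤ j q)) us =
    only-cong us (cong f (sym (shift-≥ j (≤-trans (m≤m+n c k) q))))
  D-weaken c j k (lam s) us = ∑-map lam (D (suc (c + (j + k))) (shift (suc c) j s) us) ∙
    D-weaken (suc c) j k s us ∙ sym (∑-map lam (D (suc (c + k)) s us))
  D-weaken c j k (app s ts) us =
    ∑-D-app (c + (j + k)) (shift c j s) (shiftM c j ts) us ∙
    ∑-cong (split2 us) (λ (a , b) → D-weaken c j k s a ∙
      ∑-cong (D (c + k) s a) (λ x → DM-weaken c j k ts b)) ∙
    sym (∑-D-app (c + k) s ts us)
  D-weaken c j k (inl s) us = ∑-map inl (D (c + (j + k)) (shift c j s) us) ∙
    D-weaken c j k s us ∙ sym (∑-map inl (D (c + k) s us))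
  D-weaken c j k (inr s) us = ∑-map inr (D (c + (j + k)) (shift c j s) us) ∙
    D-weaken c j k s us ∙ sym (∑-map inr (D (c + k) s us))

  DM-weaken : ∀ c j k ts us {f} →
    ∑ (DM (c + (j + k)) (shiftM c j ts) us) f ≡ ∑ (DM (c + k) ts us) (λ x → f (shiftM c j x))
  DM-weaken c j k []       []      = refl
  DM-weaken c j k []       (_ ∷ _) = refl
  DM-weaken c j k (t ∷ ts) us =
    ∑-DM-∷ (c + (j + k)) (shift c j t) (shiftM c j ts) us ∙
    ∑-cong (split2 us) (λ (a , b) → D-weaken c j k t a ∙
      ∑-cong (D (c + k) t a) (λ x → DM-weaken c j k ts b)) ∙
    sym (∑-DM-∷ (c + k) t ts us)

mutual
  -- The derived variable lies in the block inserted by the shift, so it does not occur. Only the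
  -- empty bag contributes, and removing the variable makes the block one shorter.
  D-cancel : ∀ c j m t us {f} →
    ∑ (D (c + j) (shift c (suc (j + m)) t) us) f ≡ ∑ (only us (shift c (j + m) t)) f
  D-cancel c j m (var y) us with y <? c
  ... | yes p rewrite shift-< (suc (j + m)) p | shift-< (j + m) p =
    ∑≡ (D-lt (≤-trans p (m≤m+n c j)) us)
  ... | no p rewrite shift-≥ (suc (j + m)) (≮⇒≥ p) | shift-≥ (j + m) (≮⇒≥ p) | +-suc y (j + m) =
    ∑≡ (D-gt (+-mono-≤ (≮⇒≥ p) (m≤m+n j m)) us)
  D-cancel c j m (lam s) us = ∑-map lam (D (suc c + j) (shift (suc c) (suc (j + m)) s) us) ∙
    D-cancel (suc c) j m s us ∙ only-cong us refl
  D-cancel c j m (app s ts) us {f} =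
    ∑-D-app (c + j) (shift c (suc (j + m)) s) (shiftM c (suc (j + m)) ts) us ∙
    ∑-cong (split2 us) (λ (a , b) → D-cancel c j m s a ∙
      only-const a (shift c (j + m) s) ∙
      ∑-cong (only a tt) (λ _ → DM-cancel c j m ts b)) ∙
    split-[]ˡ us (λ u a b → refl) ∙ +-identityʳ _ ∙ only-cong us refl
  D-cancel c j m (inl s) us = ∑-map inl (D (c + j) (shift c (suc (j + m)) s) us) ∙
    D-cancel c j m s us ∙ only-cong us refl
  D-cancel c j m (inr s) us = ∑-map inr (D (c + j) (shift c (suc (j + m)) s) us) ∙
    D-cancel c j m s us ∙ only-cong us refl

  DM-cancel : ∀ c j m ts us {f} →
    ∑ (DM (c + j) (shiftM c (suc (j + m)) ts) us) f ≡ ∑ (only us (shiftM c (j + m) ts)) f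
  DM-cancel c j m []       us = ∑≡ (DM-[] (c + j) us)
  DM-cancel c j m (t ∷ ts) us =
    ∑-DM-∷ (c + j) (shift c (suc (j + m)) t) (shiftM c (suc (j + m)) ts) us ∙
    ∑-cong (split2 us) (λ (a , b) → D-cancel c j m t a ∙
      only-const a (shift c (j + m) t) ∙
      ∑-cong (only a tt) (λ _ → DM-cancel c j m ts b)) ∙
    split-[]ˡ us (λ u a b → refl) ∙ +-identityʳ _ ∙ only-cong us refl

mutual
  shift-D : ∀ j c d s ts {f} →
    ∑ (D j s ts) (λ x → f (shift (j + c) d x)) ≡
    ∑ (D j (shift (suc (j + c)) d s) (shiftM c d ts)) f
  shift-D j c d (var y) ts {f} with cmp j y
  ... | lt p rewrite D-lt p ts | shift-< {suc (j + c)} d (m≤n⇒m≤1+n (≤-trans p (m≤m+n j c)))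
                  | D-lt p (shiftM c d ts) =
    only-cong ts (cong f (shift-< d (≤-trans p (m≤m+n j c)))) ∙ sym (only-shiftM c d ts)
  ... | eq rewrite shift-< {suc (j + c)} d (s≤s (m≤m+n j c)) | D-eq j ts | D-eq j (shiftM c d ts) =
    hits ts
    where
    hits : ∀ ts → ∑ (hit j ts) (λ x → f (shift (j + c) d x)) ≡ ∑ (hit j (shiftM c d ts)) f
    hits []          = refl
    hits (t ∷ [])    = cong (λ x → f x + 0) (shift-comm 0 j c d t)
    hits (_ ∷ _ ∷ _) = refl
  ... | gt {y = y′} p with y′ <? j + c
  ... | yes q rewrite D-gt p ts | shift-< {suc (j + c)} d (s≤s q) | D-gt p (shiftM c d ts) =
    only-cong ts (cong f (shift-< d q)) ∙ sym (only-shiftM c d ts)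
  ... | no q rewrite D-gt p ts | shift-≥ {suc (j + c)} d (s≤s (≮⇒≥ q))
                   | D-gt {j} {y′ + d} (≤-trans p (m≤m+n y′ d)) (shiftM c d ts) =
    only-cong ts (cong f (shift-≥ d (≮⇒≥ q))) ∙ sym (only-shiftM c d ts)
  shift-D j c d (lam s) ts = ∑-map lam (D (suc j) s ts) ∙ shift-D (suc j) c d s ts ∙
    sym (∑-map lam (D (suc j) (shift (suc (suc (j + c))) d s) (shiftM c d ts)))
  shift-D j c d (app s r) ts = ∑-D-app j s r ts ∙
    ∑-cong (split2 ts) (λ (a , b) →
      ∑-cong (D j s a) (λ x → shiftM-D j c d r b) ∙ shift-D j c d s a) ∙
    sym (split-shiftM c d ts) ∙
    sym (∑-D-app j (shift (suc (j + c)) d s) (shiftM (suc (j + c)) d r) (shiftM c d ts))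
  shift-D j c d (inl s) ts = ∑-map inl (D j s ts) ∙ shift-D j c d s ts ∙
    sym (∑-map inl (D j (shift (suc (j + c)) d s) (shiftM c d ts)))
  shift-D j c d (inr s) ts = ∑-map inr (D j s ts) ∙ shift-D j c d s ts ∙
    sym (∑-map inr (D j (shift (suc (j + c)) d s) (shiftM c d ts)))

  shiftM-D : ∀ j c d r ts {f} →
    ∑ (DM j r ts) (λ x → f (shiftM (j + c) d x)) ≡
    ∑ (DM j (shiftM (suc (j + c)) d r) (shiftM c d ts)) f
  shiftM-D j c d []      []      = refl
  shiftM-D j c d []      (_ ∷ _) = refl
  shiftM-D j c d (t ∷ r) ts = ∑-DM-∷ j t r ts ∙
    ∑-cong (split2 ts) (λ (a , b) →
      ∑-cong (D j t a) (λ x → shiftM-D j c d r b) ∙ shift-D j c d t a) ∙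
    sym (split-shiftM c d ts) ∙
    sym (∑-DM-∷ j (shift (suc (j + c)) d t) (shiftM (suc (j + c)) d r) (shiftM c d ts))

-- The substitution lemma for linear substitution.

∑-zeros : ∀ (xs : List A) {f} → (∀ x → f x ≡ 0) → ∑ xs f ≡ 0
∑-zeros xs h = ∑-cong xs h ∙ ∑-zero xs

-- A derived entry carries its share of us with it into the half where it lands. Landing left or
-- right amounts to regrouping the three shares of us, by `splitʳ≡splitˡ` and `splitʳ≡splitᵐ`
-- respectively.
DM-split : ∀ k ts us {g : List Term × List Term → ℕ} →
  ∑ (DM k ts us) (λ c → ∑ (split2 c) g) ≡
  ∑ (split2 ts) (λ (t₁ , t₂) → ∑ (split2 us) λ (u₁ , u₂) →
    ∑ (DM k t₁ u₁) λ c₁ → ∑ (DM k t₂ u₂) λ c₂ → g (c₁ , c₂))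
DM-split k []       []       = sym (+-identityʳ _ ∙ +-identityʳ _)
DM-split k []       (u ∷ us) {g} = sym (+-identityʳ _ ∙ ∑-split-∷ u us ∙
  ∑-zeros (split2 us) (λ (a , b) → ∑-zero (DM k [] a)))
DM-split k (t ∷ ts) us {g} = begin
  ∑ (DM k (t ∷ ts) us) (λ c → ∑ (split2 c) g)
    ≡⟨ ∑-DM-∷ k t ts us ⟩
  (∑ (split2 us) λ (a , b) → ∑ (D k t a) λ x → ∑ (DM k ts b) λ c → ∑ (split2 (x ∷ c)) g)
    ≡⟨ ∑-cong (split2 us) (λ (a , b) → ∑-cong (D k t a) (λ x →
         ∑-cong (DM k ts b) (λ c → ∑-split-∷ x c ∙ ∑-+ (split2 c)) ∙ ∑-+ (DM k ts b) ∙
         cong₂ _+_ (DM-split k ts b) (DM-split k ts b)) ∙ ∑-+ (D k t a)) ∙ ∑-+ (split2 us) ⟩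
  (∑ (split2 us) λ (a , b) → ∑ (D k t a) λ x → ∑ (split2 ts) λ (t₁ , t₂) →
    ∑ (split2 b) λ (u₁ , u₂) → ∑ (DM k t₁ u₁) λ c₁ → ∑ (DM k t₂ u₂) λ c₂ → g (x ∷ c₁ , c₂)) +
  (∑ (split2 us) λ (a , b) → ∑ (D k t a) λ x → ∑ (split2 ts) λ (t₁ , t₂) →
    ∑ (split2 b) λ (u₁ , u₂) → ∑ (DM k t₁ u₁) λ c₁ → ∑ (DM k t₂ u₂) λ c₂ → g (c₁ , x ∷ c₂))
    ≡⟨ cong₂ _+_ (reorder (λ x c₁ c₂ → g (x ∷ c₁ , c₂))) (reorder (λ x c₁ c₂ → g (c₁ , x ∷ c₂))) ⟩
  (∑ (split2 ts) λ (t₁ , t₂) → ∑ (split2 us) λ (a , b) → ∑ (split2 b) λ (u₁ , u₂) →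
    H (λ x c₁ c₂ → g (x ∷ c₁ , c₂)) t₁ t₂ a u₁ u₂) +
  (∑ (split2 ts) λ (t₁ , t₂) → ∑ (split2 us) λ (a , b) → ∑ (split2 b) λ (u₁ , u₂) →
    H (λ x c₁ c₂ → g (c₁ , x ∷ c₂)) t₁ t₂ a u₁ u₂)
    ≡⟨ cong₂ _+_
         (∑-cong (split2 ts) (λ (t₁ , t₂) →
           splitʳ≡splitˡ us (H (λ x c₁ c₂ → g (x ∷ c₁ , c₂)) t₁ t₂) ∙
           ∑-cong (split2 us) (λ (v , w) →
             ∑-cong (split2 v) (λ (a , u₁) → refl) ∙ sym (∑-DM-∷ k t t₁ v))))
         (∑-cong (split2 ts) (λ (t₁ , t₂) →
           splitʳ≡splitᵐ us (H (λ x c₁ c₂ → g (c₁ , x ∷ c₂)) t₁ t₂) ∙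
           ∑-cong (split2 us) (λ (v , w) →
             ∑-cong (split2 w) (λ (a , u₂) → ∑-swap (D k t a) (DM k t₁ v)) ∙
             ∑-swap (split2 w) (DM k t₁ v) ∙
             ∑-cong (DM k t₁ v) (λ c₁ → sym (∑-DM-∷ k t t₂ w))))) ⟩
  (∑ (split2 ts) λ (t₁ , t₂) → ∑ (split2 us) λ (v , w) →
    ∑ (DM k (t ∷ t₁) v) λ c₁ → ∑ (DM k t₂ w) λ c₂ → g (c₁ , c₂)) +
  (∑ (split2 ts) λ (t₁ , t₂) → ∑ (split2 us) λ (v , w) →
    ∑ (DM k t₁ v) λ c₁ → ∑ (DM k (t ∷ t₂) w) λ c₂ → g (c₁ , c₂))
    ≡⟨ sym (∑-split-∷ t ts ∙ ∑-+ (split2 ts)) ⟩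
  (∑ (split2 (t ∷ ts)) λ (t₁ , t₂) → ∑ (split2 us) λ (v , w) →
    ∑ (DM k t₁ v) λ c₁ → ∑ (DM k t₂ w) λ c₂ → g (c₁ , c₂)) ∎
  where
  open ≡-Reasoning
  H : (Term → List Term → List Term → ℕ) →
      List Term → List Term → List Term → List Term → List Term → ℕ
  H g′ t₁ t₂ a u₁ u₂ = ∑ (D k t a) λ x → ∑ (DM k t₁ u₁) λ c₁ → ∑ (DM k t₂ u₂) λ c₂ → g′ x c₁ c₂
  reorder : ∀ g′ →
    (∑ (split2 us) λ (a , b) → ∑ (D k t a) λ x → ∑ (split2 ts) λ (t₁ , t₂) →
      ∑ (split2 b) λ (u₁ , u₂) → ∑ (DM k t₁ u₁) λ c₁ → ∑ (DM k t₂ u₂) λ c₂ → g′ x c₁ c₂) ≡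
    (∑ (split2 ts) λ (t₁ , t₂) → ∑ (split2 us) λ (a , b) → ∑ (split2 b) λ (u₁ , u₂) →
      H g′ t₁ t₂ a u₁ u₂)
  reorder g′ = ∑-cong (split2 us) (λ (a , b) → ∑-swap (D k t a) (split2 ts) ∙
      ∑-cong (split2 ts) (λ _ → ∑-swap (D k t a) (split2 b))) ∙
    ∑-swap (split2 us) (split2 ts)

DM-only : ∀ k ts us {x : A} {f} →
  ∑ (DM k ts us) (λ c → ∑ (only c x) f) ≡ ∑ (only ts tt) (λ _ → ∑ (only us x) f)
DM-only k []       []       = refl
DM-only k []       (_ ∷ _)  = refl
DM-only k (t ∷ ts) us       = ∑-DM-∷ k t ts us ∙
  ∑-zeros (split2 us) (λ (a , b) → ∑-zeros (D k t a) (λ x → ∑-zero (DM k ts b)))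

-- Taking the derivative in the outer variable of a derivative in the inner one.
Substitution : ℕ → ℕ → Term → Set
Substitution j k s = ∀ ts us {f : Term → ℕ} →
  ∑ (D j s ts) (λ x → ∑ (D (j + k) x us) f) ≡
  ∑ (split2 us) (λ (u₁ , u₂) → ∑ (D (suc (j + k)) s u₁) λ a →
    ∑ (DM k ts u₂) λ c → ∑ (D j a c) f)

SubstitutionM : ℕ → ℕ → Monomial → Set
SubstitutionM j k r = ∀ ts us {f : Monomial → ℕ} →
  ∑ (DM j r ts) (λ x → ∑ (DM (j + k) x us) f) ≡
  ∑ (split2 us) (λ (u₁ , u₂) → ∑ (DM (suc (j + k)) r u₁) λ a →
    ∑ (DM k ts u₂) λ c → ∑ (DM j a c) f)

-- Shared by applications and non-empty bags. An entry of us ends up in s, in r, or in a member of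
-- ts that itself goes into s or into r. The left side groups these four destinations by s and r,
-- the right side by direct or through ts; `split-exchange` mediates.
substitution-pair : ∀ j k s r → Substitution j k s → SubstitutionM j k r →
  ∀ ts us {f : Term → Monomial → ℕ} →
  ∑ (split2 ts) (λ (t₁ , t₂) → ∑ (D j s t₁) λ x → ∑ (DM j r t₂) λ y →
    ∑ (split2 us) λ (u₁ , u₂) → ∑ (D (j + k) x u₁) λ x′ → ∑ (DM (j + k) y u₂) λ y′ → f x′ y′) ≡
  ∑ (split2 us) (λ (v , w) → ∑ (split2 v) λ (p , q) →
    ∑ (D (suc (j + k)) s p) λ a → ∑ (DM (suc (j + k)) r q) λ b →
    ∑ (DM k ts w) λ c → ∑ (split2 c) λ (c₁ , c₂) →
    ∑ (D j a c₁) λ x′ → ∑ (DM j b c₂) λ y′ → f x′ y′)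
substitution-pair j k s r ihs ihr ts us {f} = begin
  (∑ (split2 ts) λ (t₁ , t₂) → ∑ (D j s t₁) λ x → ∑ (DM j r t₂) λ y →
    ∑ (split2 us) λ (u₁ , u₂) → ∑ (D (j + k) x u₁) λ x′ → ∑ (DM (j + k) y u₂) λ y′ → f x′ y′)
    ≡⟨ ∑-cong (split2 ts) (λ (t₁ , t₂) →
         ∑-cong (D j s t₁) (λ x → ∑-swap (DM j r t₂) (split2 us)) ∙
         ∑-swap (D j s t₁) (split2 us) ∙
         ∑-cong (split2 us) (λ (u₁ , u₂) → ∑-cong (D j s t₁) (λ x →
           ∑-swap (DM j r t₂) (D (j + k) x u₁)))) ⟩
  (∑ (split2 ts) λ (t₁ , t₂) → ∑ (split2 us) λ (u₁ , u₂) →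
    ∑ (D j s t₁) λ x → ∑ (D (j + k) x u₁) λ x′ →
    ∑ (DM j r t₂) λ y → ∑ (DM (j + k) y u₂) λ y′ → f x′ y′)
    ≡⟨ ∑-cong (split2 ts) (λ (t₁ , t₂) → ∑-cong (split2 us) (λ (u₁ , u₂) →
         ∑-cong (D j s t₁) (λ x → ∑-cong (D (j + k) x u₁) (λ x′ → ihr t₂ u₂)) ∙ ihs t₁ u₁)) ⟩
  (∑ (split2 ts) λ (t₁ , t₂) → ∑ (split2 us) λ (u₁ , u₂) → ∑ (split2 u₁) λ (p , p′) →
    ∑ (D K s p) λ a → ∑ (DM k t₁ p′) λ c₁ → ∑ (D j a c₁) λ x′ →
    ∑ (split2 u₂) λ (q , q′) → Y t₂ q q′ (f x′))
    ≡⟨ ∑-cong (split2 ts) (λ (t₁ , t₂) → ∑-cong (split2 us) (λ (u₁ , u₂) →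
         ∑-cong (split2 u₁) (λ (p , p′) →
           ∑-cong (D K s p) (λ a →
             ∑-cong (DM k t₁ p′) (λ c₁ → ∑-swap (D j a c₁) (split2 u₂)) ∙
             ∑-swap (DM k t₁ p′) (split2 u₂)) ∙
           ∑-swap (D K s p) (split2 u₂)))) ⟩
  (∑ (split2 ts) λ (t₁ , t₂) → ∑ (split2 us) λ (u₁ , u₂) → ∑ (split2 u₁) λ (p , p′) →
    ∑ (split2 u₂) λ (q , q′) → H t₁ t₂ p p′ q q′)
    ≡⟨ ∑-cong (split2 ts) (λ (t₁ , t₂) → split-exchange us) ⟩
  (∑ (split2 ts) λ (t₁ , t₂) → ∑ (split2 us) λ (v , w) → ∑ (split2 v) λ (p , q) →
    ∑ (split2 w) λ (p′ , q′) → H t₁ t₂ p p′ q q′)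
    ≡⟨ ∑-swap (split2 ts) (split2 us) ∙ ∑-cong (split2 us) (λ (v , w) →
         ∑-swap (split2 ts) (split2 v) ∙ ∑-cong (split2 v) (λ (p , q) → sym (unfold p q w))) ⟩
  (∑ (split2 us) λ (v , w) → ∑ (split2 v) λ (p , q) →
    ∑ (D K s p) λ a → ∑ (DM K r q) λ b →
    ∑ (DM k ts w) λ c → ∑ (split2 c) λ (c₁ , c₂) →
    ∑ (D j a c₁) λ x′ → ∑ (DM j b c₂) λ y′ → f x′ y′) ∎
  where
  open ≡-Reasoning
  K : ℕ
  K = suc (j + k)
  Y : List Term → List Term → List Term → (Monomial → ℕ) → ℕ
  Y t₂ q q′ g = ∑ (DM K r q) λ b → ∑ (DM k t₂ q′) λ c₂ → ∑ (DM j b c₂) g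
  H : List Term → List Term → List Term → List Term → List Term → List Term → ℕ
  H t₁ t₂ p p′ q q′ =
    ∑ (D K s p) λ a → ∑ (DM k t₁ p′) λ c₁ → ∑ (D j a c₁) λ x′ → Y t₂ q q′ (f x′)
  unfold : ∀ p q w →
    (∑ (D K s p) λ a → ∑ (DM K r q) λ b → ∑ (DM k ts w) λ c → ∑ (split2 c) λ (c₁ , c₂) →
      ∑ (D j a c₁) λ x′ → ∑ (DM j b c₂) λ y′ → f x′ y′) ≡
    (∑ (split2 ts) λ (t₁ , t₂) → ∑ (split2 w) λ (p′ , q′) → H t₁ t₂ p p′ q q′)
  unfold p q w =
    ∑-cong (D K s p) (λ a →
      ∑-cong (DM K r q) (λ b → DM-split k ts w) ∙
      ∑-swap (DM K r q) (split2 ts) ∙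
      ∑-cong (split2 ts) (λ (t₁ , t₂) →
        ∑-swap (DM K r q) (split2 w) ∙
        ∑-cong (split2 w) (λ (p′ , q′) →
          ∑-swap (DM K r q) (DM k t₁ p′) ∙
          ∑-cong (DM k t₁ p′) (λ c₁ →
            ∑-cong (DM K r q) (λ b → ∑-swap (DM k t₂ q′) (D j a c₁)) ∙
            ∑-swap (DM K r q) (D j a c₁))))) ∙
    ∑-swap (D K s p) (split2 ts) ∙
    ∑-cong (split2 ts) (λ _ → ∑-swap (D K s p) (split2 w))

substitution-var : ∀ j k y → Substitution j k (var y)
substitution-var j k y ts us {f} with cmp j y
... | lt p = ∑≡ (D-lt p ts) ∙ only-const ts (var y) ∙
  only-cong ts (∑≡ (D-lt (≤-trans p (m≤m+n j k)) us)) ∙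
  sym (DM-only k ts us) ∙
  ∑-cong (DM k ts us) (λ c → ∑≡ (sym (D-lt p c))) ∙
  sym (+-identityʳ _) ∙
  sym (split-[]ˡ us (λ u a b → refl)) ∙
  ∑-cong (split2 us) (λ (a , b) → ∑≡ (sym (D-lt (m≤n⇒m≤1+n (≤-trans p (m≤m+n j k))) a)))
-- The inner variable: it is replaced by the unique entry of ts, shifted by j, and `D-weaken` moves
-- the outer derivative under this shift. For other lengths of ts both sides vanish, since `DM`
-- preserves length.
... | eq = ∑≡ (D-eq j ts) ∙ hits ts ∙
  ∑-cong (DM k ts us) (λ c → ∑≡ (sym (D-eq j c))) ∙
  sym (+-identityʳ _) ∙
  sym (split-[]ˡ us (λ u a b → refl)) ∙
  ∑-cong (split2 us) (λ (a , b) → ∑≡ (sym (D-lt (s≤s (m≤m+n j k)) a)))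
  where
  hits : ∀ ts → ∑ (hit j ts) (λ x → ∑ (D (j + k) x us) f) ≡ ∑ (DM k ts us) (λ c → ∑ (hit j c) f)
  hits []       = sym (∑≡ (DM-[] k us) ∙ only-const us [] ∙ ∑-zero (only us tt))
  hits (t ∷ []) = +-identityʳ _ ∙ D-weaken 0 j k t us ∙
    ∑-cong (D k t us) (λ x → sym (+-identityʳ _) ∙ sym (+-identityʳ _)) ∙
    sym (split-[]ʳ us (λ a u b → ∑-zero (D k t a))) ∙
    ∑-cong (split2 us) (λ (a , b) → ∑-cong (D k t a) (λ x → ∑≡ (sym (DM-[] k b)))) ∙
    sym (∑-DM-∷ k t [] us)
  hits (t ∷ t′ ∷ ts) = sym (∑-DM-∷ k t (t′ ∷ ts) us ∙
    ∑-zeros (split2 us) (λ (a , b) → ∑-zeros (D k t a) (λ x → ∑-DM-∷ k t′ ts b ∙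
      ∑-zeros (split2 b) (λ (c , d) → ∑-zeros (D k t′ c) (λ x′ → ∑-zero (DM k ts d))))))
... | gt {y = y′} p with cmp (j + k) y′
... | lt q = ∑≡ (D-gt p ts) ∙ only-const ts (var y′) ∙
  only-cong ts (∑≡ (D-lt q us)) ∙
  sym (DM-only k ts us) ∙
  ∑-cong (DM k ts us) (λ c → ∑≡ (sym (D-gt p c))) ∙
  sym (+-identityʳ _) ∙
  sym (split-[]ˡ us (λ u a b → refl)) ∙
  ∑-cong (split2 us) (λ (a , b) → ∑≡ (sym (D-lt (s≤s q) a)))
... | gt {y = y″} q = ∑≡ (D-gt p ts) ∙ only-const ts (var y′) ∙
  only-cong ts (∑≡ (D-gt q us)) ∙
  sym (DM-only k ts us) ∙
  ∑-cong (DM k ts us) (λ c → ∑≡ (sym (D-gt (≤-trans (m≤m+n j k) q) c))) ∙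
  sym (+-identityʳ _) ∙
  sym (split-[]ˡ us (λ u a b → refl)) ∙
  ∑-cong (split2 us) (λ (a , b) → ∑≡ (sym (D-gt (s≤s q) a)))
-- The outer variable: on the right it is replaced by an entry of us shifted past the inner
-- variable, which is therefore absent from it; `D-cancel` evaluates the inner derivative.
... | eq = ∑≡ (D-gt p ts) ∙ only-const ts (var (j + k)) ∙
  only-cong ts (∑≡ (D-eq (j + k) us)) ∙
  outer us ∙
  sym (split-[]ʳ us (λ a u b → ∑-zeros (hit (suc (j + k)) a) (λ x → ∑-zero (only ts tt)))) ∙
  ∑-cong (split2 us) (λ (a , b) → inner a b ∙ ∑≡ (sym (D-eq (suc (j + k)) a)))
  where
  outer : ∀ us → ∑ (only ts tt) (λ _ → ∑ (hit (j + k) us) f) ≡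
    ∑ (hit (suc (j + k)) us) (λ _ → ∑ (only ts tt) λ _ → ∑ (hit (j + k) us) f + 0)
  outer []          = ∑-zero (only ts tt)
  outer (u ∷ [])    = only-cong ts (sym (+-identityʳ _)) ∙ sym (+-identityʳ _)
  outer (_ ∷ _ ∷ _) = ∑-zero (only ts tt)
  inner : ∀ a b →
    ∑ (hit (suc (j + k)) a) (λ _ → ∑ (only ts tt) λ _ → ∑ (only b tt) λ _ → ∑ (hit (j + k) a) f) ≡
    ∑ (hit (suc (j + k)) a) (λ x → ∑ (DM k ts b) λ c → ∑ (D j x c) f)
  inner []          b = refl
  inner (u ∷ [])    b = cong (_+ 0) (
    only-cong ts (only-cong b (+-identityʳ _)) ∙
    sym (DM-only k ts b) ∙
    ∑-cong (DM k ts b) (λ c → sym (D-cancel 0 j k u c)))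
  inner (_ ∷ _ ∷ _) b = refl

mutual
  substitution : ∀ j k s → Substitution j k s
  substitution j k (var y) ts us = substitution-var j k y ts us
  substitution j k (lam s) ts us = ∑-map lam (D (suc j) s ts) ∙
    ∑-cong (D (suc j) s ts) (λ x → ∑-map lam (D (suc (j + k)) x us)) ∙
    substitution (suc j) k s ts us ∙
    ∑-cong (split2 us) (λ (u₁ , u₂) →
      ∑-cong (D (suc (suc (j + k))) s u₁) (λ a → ∑-cong (DM k ts u₂) (λ c →
        sym (∑-map lam (D (suc j) a c)))) ∙
      sym (∑-map lam (D (suc (suc (j + k))) s u₁)))
  substitution j k (app s r) ts us = ∑-D-app j s r ts ∙
    ∑-cong (split2 ts) (λ (t₁ , t₂) → ∑-cong (D j s t₁) (λ x → ∑-cong (DM j r t₂) (λ y →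
      ∑-D-app (j + k) x y us))) ∙
    substitution-pair j k s r (substitution j k s) (substitutionM j k r) ts us ∙
    ∑-cong (split2 us) (λ (v , w) →
      ∑-cong (split2 v) (λ (p , q) → ∑-cong (D (suc (j + k)) s p) (λ a →
        ∑-cong (DM (suc (j + k)) r q) (λ b → ∑-cong (DM k ts w) (λ c → sym (∑-D-app j a b c))))) ∙
      sym (∑-D-app (suc (j + k)) s r v))
  substitution j k (inl s) ts us = ∑-map inl (D j s ts) ∙
    ∑-cong (D j s ts) (λ x → ∑-map inl (D (j + k) x us)) ∙
    substitution j k s ts us ∙
    ∑-cong (split2 us) (λ (u₁ , u₂) →
      ∑-cong (D (suc (j + k)) s u₁) (λ a → ∑-cong (DM k ts u₂) (λ c →
        sym (∑-map inl (D j a c)))) ∙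
      sym (∑-map inl (D (suc (j + k)) s u₁)))
  substitution j k (inr s) ts us = ∑-map inr (D j s ts) ∙
    ∑-cong (D j s ts) (λ x → ∑-map inr (D (j + k) x us)) ∙
    substitution j k s ts us ∙
    ∑-cong (split2 us) (λ (u₁ , u₂) →
      ∑-cong (D (suc (j + k)) s u₁) (λ a → ∑-cong (DM k ts u₂) (λ c →
        sym (∑-map inr (D j a c)))) ∙
      sym (∑-map inr (D (suc (j + k)) s u₁)))

  substitutionM : ∀ j k r → SubstitutionM j k r
  substitutionM j k []      []       []       = sym (+-identityʳ _ ∙ +-identityʳ _)
  substitutionM j k []      []       (u ∷ us) {f} = sym (∑-split-∷ u us ∙
    ∑-zeros (split2 us) (λ (a , b) → ∑-zero (DM (suc (j + k)) [] a)))
  substitutionM j k []      (t ∷ ts) us = sym (∑-zeros (split2 us) (λ (u₁ , u₂) →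
    ∑≡ (DM-[] (suc (j + k)) u₁) ∙ only-const u₁ [] ∙
    ∑-zeros (only u₁ tt) (λ _ → ∑-DM-∷ k t ts u₂ ∙
      ∑-zeros (split2 u₂) (λ (a , b) → ∑-zeros (D k t a) (λ x → ∑-zero (DM k ts b))))))
  substitutionM j k (s ∷ r) ts us = ∑-DM-∷ j s r ts ∙
    ∑-cong (split2 ts) (λ (t₁ , t₂) → ∑-cong (D j s t₁) (λ x → ∑-cong (DM j r t₂) (λ y →
      ∑-DM-∷ (j + k) x y us))) ∙
    substitution-pair j k s r (substitution j k s) (substitutionM j k r) ts us ∙
    ∑-cong (split2 us) (λ (v , w) →
      ∑-cong (split2 v) (λ (p , q) → ∑-cong (D (suc (j + k)) s p) (λ a →
        ∑-cong (DM (suc (j + k)) r q) (λ b → ∑-cong (DM k ts w) (λ c → sym (∑-DM-∷ j a b c))))) ∙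
      sym (∑-DM-∷ (suc (j + k)) s r v))

-- Invariant functionals and linear substitution.

infix 4 _⟶ᵇ_

-- The same steps as `_⟶ₘ_`, indexed by the position of the reduced entry instead of by a
-- concatenation, so that they can be followed through the recursions on bags.
data _⟶ᵇ_ : Monomial → List Monomial → Set where
  hd : ∀ {t ts T} → t ⟶ T → (t ∷ ts) ⟶ᵇ map (_∷ ts) T
  tl : ∀ {t ts T} → ts ⟶ᵇ T → (t ∷ ts) ⟶ᵇ map (t ∷_) T

⟶ₘ⇒⟶ᵇ : ∀ {ts T} → ts ⟶ₘ T → ts ⟶ᵇ T
⟶ₘ⇒⟶ᵇ (ctx-mono {l₁} p) = go l₁ p
  where
  go : ∀ l₁ {t l₂ T} → t ⟶ T → (l₁ ++ t ∷ l₂) ⟶ᵇ map (λ t′ → l₁ ++ t′ ∷ l₂) T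
  go []       p = hd p
  go (x ∷ l₁) {T = T} p = subst (_ ⟶ᵇ_) (sym (map-∘ T)) (tl (go l₁ p))

⟶ᵇ⇒⟶ₘ : ∀ {ts T} → ts ⟶ᵇ T → ts ⟶ₘ T
⟶ᵇ⇒⟶ₘ (hd p) = ctx-mono {[]} p
⟶ᵇ⇒⟶ₘ (tl {t} p) with ⟶ᵇ⇒⟶ₘ p
... | ctx-mono {l₁} {T = T} q = subst (_ ⟶ₘ_) (map-∘ T) (ctx-mono {t ∷ l₁} q)

Inv : (Term → ℕ) → Term → Set
Inv f x = ∀ {X} → x ⟶ X → f x ≡ ∑ X f

Invᵇ : (Monomial → ℕ) → Monomial → Set
Invᵇ f x = ∀ {X} → x ⟶ᵇ X → f x ≡ ∑ X f

Inv-lam : ∀ {f s} → Inv f (lam s) → Inv (λ x → f (lam x)) s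
Inv-lam h {X} p = h (ctx-lam p) ∙ ∑-map lam X

Inv-inl : ∀ {f s} → Inv f (inl s) → Inv (λ x → f (inl x)) s
Inv-inl h {X} p = h (ctx-inl p) ∙ ∑-map inl X

Inv-inr : ∀ {f s} → Inv f (inr s) → Inv (λ x → f (inr x)) s
Inv-inr h {X} p = h (ctx-inr p) ∙ ∑-map inr X

Inv-fun : ∀ {f s ts} → Inv f (app s ts) → Inv (λ x → f (app x ts)) s
Inv-fun {ts = ts} h {X} p = h (ctx-fun p) ∙ ∑-map (λ x → app x ts) X

Inv-arg : ∀ {f s ts} → Inv f (app s ts) → Invᵇ (λ x → f (app s x)) ts
Inv-arg {s = s} h {X} p = h (ctx-arg (⟶ᵇ⇒⟶ₘ p)) ∙ ∑-map (app s) X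

Inv-hd : ∀ {f t ts} → Invᵇ f (t ∷ ts) → Inv (λ x → f (x ∷ ts)) t
Inv-hd {ts = ts} h {X} p = h (hd p) ∙ ∑-map (_∷ ts) X

Inv-tl : ∀ {f t ts} → Invᵇ f (t ∷ ts) → Invᵇ (λ x → f (t ∷ x)) ts
Inv-tl {t = t} h {X} p = h (tl p) ∙ ∑-map (t ∷_) X

Inv-∑ : ∀ {x} (ys : List B) {f : Term → B → ℕ} → (∀ {y} → y ∈ ys → Inv (λ x → f x y) x) →
  Inv (λ x → ∑ ys (f x)) x
Inv-∑ ys h {X} p = ∑-cong-∈ ys (λ i → h i p) ∙ ∑-swap ys X

Invᵇ-∑ : ∀ {x} (ys : List B) {f : Monomial → B → ℕ} → (∀ {y} → y ∈ ys → Invᵇ (λ x → f x y) x) →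
  Invᵇ (λ x → ∑ ys (f x)) x
Invᵇ-∑ ys h {X} p = ∑-cong-∈ ys (λ i → h i p) ∙ ∑-swap ys X

∈-D-app : ∀ k s ts us {a b x y} → (a , b) ∈ split2 us → x ∈ D k s a → y ∈ DM k ts b →
  app x y ∈ D k (app s ts) us
∈-D-app k s ts us = ∈-Bilinear⁺ app (split2 us) (D k s) (DM k ts)

∈-DM-∷ : ∀ k t ts us {a b x y} → (a , b) ∈ split2 us → x ∈ D k t a → y ∈ DM k ts b →
  x ∷ y ∈ DM k (t ∷ ts) us
∈-DM-∷ k t ts us = ∈-Bilinear⁺ _∷_ (split2 us) (D k t) (DM k ts)

-- Reduction commutes with linear substitution.
mutual
  Inv-shift : ∀ c d {f s} → Inv f (shift c d s) → Inv (λ x → f (shift c d x)) s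
  Inv-shift c d h (β {s} {ts}) = h β ∙ sym (shift-D 0 c d s ts)
  Inv-shift c d h appL = h appL
  Inv-shift c d h appR = h appR
  Inv-shift c d h lamL = h lamL
  Inv-shift c d h lamR = h lamR
  Inv-shift c d {f} h (ctx-lam {s} {S} p) =
    Inv-shift (suc c) d {λ x → f (lam x)} {s} (Inv-lam h) p ∙ sym (∑-map lam S)
  Inv-shift c d {f} h (ctx-fun {s} {ts} {S} p) =
    Inv-shift c d {λ x → f (app x (shiftM c d ts))} {s} (Inv-fun h) p ∙
    sym (∑-map (λ s → app s ts) S)
  Inv-shift c d {f} h (ctx-arg {s} {ts} {T} p) =
    Invᵇ-shift c d {λ x → f (app (shift c d s) x)} {ts} (Inv-arg h) (⟶ₘ⇒⟶ᵇ p) ∙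
    sym (∑-map (app s) T)
  Inv-shift c d {f} h (ctx-inl {s} {S} p) =
    Inv-shift c d {λ x → f (inl x)} {s} (Inv-inl h) p ∙ sym (∑-map inl S)
  Inv-shift c d {f} h (ctx-inr {s} {S} p) =
    Inv-shift c d {λ x → f (inr x)} {s} (Inv-inr h) p ∙ sym (∑-map inr S)

  Invᵇ-shift : ∀ c d {f ts} → Invᵇ f (shiftM c d ts) → Invᵇ (λ x → f (shiftM c d x)) ts
  Invᵇ-shift c d {f} h (hd {t} {ts} {T} p) =
    Inv-shift c d {λ x → f (x ∷ shiftM c d ts)} {t} (Inv-hd h) p ∙ sym (∑-map (_∷ ts) T)
  Invᵇ-shift c d {f} h (tl {t} {ts} {T} p) =
    Invᵇ-shift c d {λ x → f (shift c d t ∷ x)} {ts} (Inv-tl h) p ∙ sym (∑-map (t ∷_) T)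

mutual
  -- A redex of s survives in every summand of its derivative, where invariance of f allows it to be
  -- contracted. For β the contracted summands are those of the substitution lemma at j = 0; the
  -- commuting rules hold by computation, and the context rules pass f through the context.
  D-step : ∀ k s us {f S} → s ⟶ S → (∀ {y} → y ∈ D k s us → Inv f y) →
    ∑ (D k s us) f ≡ ∑ S (λ x → ∑ (D k x us) f)
  D-step k (app (lam s) ts) us {f} β h = begin
    ∑ (D k (app (lam s) ts) us) f
      ≡⟨ ∑-D-app k (lam s) ts us ∙ ∑-cong (split2 us) (λ (a , b) →
           ∑-map lam (D (suc k) s a)) ⟩
    (∑ (split2 us) λ (a , b) → ∑ (D (suc k) s a) λ x → ∑ (DM k ts b) λ y → f (app (lam x) y))
      ≡⟨ ∑-cong-∈ (split2 us) (λ i → ∑-cong-∈ (D (suc k) s _) (λ j → ∑-cong-∈ (DM k ts _) (λ l →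
           h (∈-D-app k (lam s) ts us i (∈-map⁺ lam j) l) β))) ⟩
    (∑ (split2 us) λ (a , b) → ∑ (D (suc k) s a) λ x → ∑ (DM k ts b) λ y → ∑ (D 0 x y) f)
      ≡⟨ sym (substitution 0 k s ts us) ⟩
    ∑ (D 0 s ts) (λ x → ∑ (D k x us) f) ∎
    where open ≡-Reasoning
  D-step k (app (inl s) ts) us {f} appL h =
    ∑-D-app k (inl s) ts us ∙
    ∑-cong-∈ (split2 us) (λ {p} i → ∑-map inl (D k s (proj₁ p)) ∙
      ∑-cong-∈ (D k s _) (λ j → ∑-cong-∈ (DM k ts _) (λ l →
        h (∈-D-app k (inl s) ts us i (∈-map⁺ inl j) l) appL ∙ +-identityʳ _))) ∙
    sym (+-identityʳ _ ∙ ∑-map inl (D k (app s ts) us) ∙ ∑-D-app k s ts us)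
  D-step k (app (inr s) ts) us {f} appR h =
    ∑-D-app k (inr s) ts us ∙
    ∑-cong-∈ (split2 us) (λ {p} i → ∑-map inr (D k s (proj₁ p)) ∙
      ∑-cong-∈ (D k s _) (λ j → ∑-cong-∈ (DM k ts _) (λ l →
        h (∈-D-app k (inr s) ts us i (∈-map⁺ inr j) l) appR ∙ +-identityʳ _))) ∙
    sym (+-identityʳ _ ∙ ∑-map inr (D k (app s ts) us) ∙ ∑-D-app k s ts us)
  D-step k (lam (inl s)) us lamL h =
    ∑-map lam (map inl (D (suc k) s us)) ∙ ∑-map inl (D (suc k) s us) ∙
    ∑-cong-∈ (D (suc k) s us) (λ i → h (∈-map⁺ lam (∈-map⁺ inl i)) lamL ∙ +-identityʳ _) ∙
    sym (+-identityʳ _ ∙ ∑-map inl (D k (lam s) us) ∙ ∑-map lam (D (suc k) s us))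
  D-step k (lam (inr s)) us lamR h =
    ∑-map lam (map inr (D (suc k) s us)) ∙ ∑-map inr (D (suc k) s us) ∙
    ∑-cong-∈ (D (suc k) s us) (λ i → h (∈-map⁺ lam (∈-map⁺ inr i)) lamR ∙ +-identityʳ _) ∙
    sym (+-identityʳ _ ∙ ∑-map inr (D k (lam s) us) ∙ ∑-map lam (D (suc k) s us))
  D-step k (lam s) us (ctx-lam {S = S} p) h =
    ∑-map lam (D (suc k) s us) ∙
    D-step (suc k) s us p (λ i → Inv-lam (h (∈-map⁺ lam i))) ∙
    ∑-cong S (λ x → sym (∑-map lam (D (suc k) x us))) ∙ sym (∑-map lam S)
  D-step k (inl s) us (ctx-inl {S = S} p) h =
    ∑-map inl (D k s us) ∙
    D-step k s us p (λ i → Inv-inl (h (∈-map⁺ inl i))) ∙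
    ∑-cong S (λ x → sym (∑-map inl (D k x us))) ∙ sym (∑-map inl S)
  D-step k (inr s) us (ctx-inr {S = S} p) h =
    ∑-map inr (D k s us) ∙
    D-step k s us p (λ i → Inv-inr (h (∈-map⁺ inr i))) ∙
    ∑-cong S (λ x → sym (∑-map inr (D k x us))) ∙ sym (∑-map inr S)
  D-step k (app s ts) us {f} (ctx-fun {S = S} p) h =
    ∑-D-app k s ts us ∙
    ∑-cong-∈ (split2 us) (λ {q} i →
      D-step k s (proj₁ q) p (λ j → Inv-∑ (DM k ts (proj₂ q)) (λ l →
        Inv-fun (h (∈-D-app k s ts us i j l))))) ∙
    ∑-swap (split2 us) S ∙
    ∑-cong S (λ x → sym (∑-D-app k x ts us)) ∙ sym (∑-map (λ x → app x ts) S)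
  D-step k (app s ts) us {f} (ctx-arg {T = T} p) h =
    ∑-D-app k s ts us ∙
    ∑-cong-∈ (split2 us) (λ {q} i →
      ∑-cong-∈ (D k s (proj₁ q)) (λ j → DM-step k ts (proj₂ q) (⟶ₘ⇒⟶ᵇ p) (λ l →
        Inv-arg (h (∈-D-app k s ts us i j l)))) ∙
      ∑-swap (D k s (proj₁ q)) T) ∙
    ∑-swap (split2 us) T ∙
    ∑-cong T (λ x → sym (∑-D-app k s x us)) ∙ sym (∑-map (app s) T)

  DM-step : ∀ k ts us {f T} → ts ⟶ᵇ T → (∀ {y} → y ∈ DM k ts us → Invᵇ f y) →
    ∑ (DM k ts us) f ≡ ∑ T (λ x → ∑ (DM k x us) f)
  DM-step k (t ∷ ts) us {f} (hd {T = S} p) h =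
    ∑-DM-∷ k t ts us ∙
    ∑-cong-∈ (split2 us) (λ {q} i →
      D-step k t (proj₁ q) p (λ j → Inv-∑ (DM k ts (proj₂ q)) (λ l →
        Inv-hd (h (∈-DM-∷ k t ts us i j l))))) ∙
    ∑-swap (split2 us) S ∙
    ∑-cong S (λ x → sym (∑-DM-∷ k x ts us)) ∙ sym (∑-map (_∷ ts) S)
  DM-step k (t ∷ ts) us {f} (tl {T = T} p) h =
    ∑-DM-∷ k t ts us ∙
    ∑-cong-∈ (split2 us) (λ {q} i →
      ∑-cong-∈ (D k t (proj₁ q)) (λ j → DM-step k ts (proj₂ q) p (λ l →
        Inv-tl (h (∈-DM-∷ k t ts us i j l)))) ∙
      ∑-swap (D k t (proj₁ q)) T) ∙
    ∑-swap (split2 us) T ∙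
    ∑-cong T (λ x → sym (∑-DM-∷ k t x us)) ∙ sym (∑-map (t ∷_) T)

∈-split2-∷ˡ : ∀ u us {a b} → (a , b) ∈ split2 us → (u ∷ a , b) ∈ split2 (u ∷ us)
∈-split2-∷ˡ u us i = ∈-concatMap⁺ _ (lose i (here refl))

∈-split2-∷ʳ : ∀ u us {a b} → (a , b) ∈ split2 us → (a , u ∷ b) ∈ split2 (u ∷ us)
∈-split2-∷ʳ u us i = ∈-concatMap⁺ _ (lose i (there (here refl)))

-- The reduced entry lies in exactly one of the two bins, and the invariance of g in the
-- corresponding argument applies there.
split-step : ∀ us {U} (g : List Term → List Term → ℕ) → us ⟶ᵇ U →
  (∀ {a b} → (a , b) ∈ split2 us → Invᵇ (λ x → g x b) a × Invᵇ (g a) b) →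
  ∑ (split2 us) (λ (a , b) → g a b) ≡ ∑ U (λ u → ∑ (split2 u) λ (a , b) → g a b)
split-step (u ∷ us) g (hd {T = T} p) h =
  ∑-split-∷ u us ∙
  ∑-cong-∈ (split2 us) (λ i → cong₂ _+_
    (Inv-hd (proj₁ (h (∈-split2-∷ˡ u us i))) p) (Inv-hd (proj₂ (h (∈-split2-∷ʳ u us i))) p) ∙
    sym (∑-+ T)) ∙
  ∑-swap (split2 us) T ∙
  ∑-cong T (λ x → sym (∑-split-∷ x us)) ∙ sym (∑-map (_∷ us) T)
split-step (u ∷ us) g (tl {T = T} p) h =
  ∑-split-∷ u us ∙
  split-step us (λ a b → g (u ∷ a) b + g a (u ∷ b)) p (λ {a} {b} i →
    let h₁ = h (∈-split2-∷ˡ u us i); h₂ = h (∈-split2-∷ʳ u us i) in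
    (λ {X} q → cong₂ _+_ (Inv-tl (proj₁ h₁) q) (proj₁ h₂ q) ∙ sym (∑-+ X)) ,
    (λ {X} q → cong₂ _+_ (proj₂ h₁ q) (Inv-tl (proj₂ h₂) q) ∙ sym (∑-+ X))) ∙
  ∑-cong T (λ x → sym (∑-split-∷ u x)) ∙ sym (∑-map (u ∷_) T)

only-step : ∀ {us U} → us ⟶ᵇ U → (x : A) {f : A → ℕ} →
  ∑ (only us x) f ≡ ∑ U (λ u → ∑ (only u x) f)
only-step (hd {ts = ts} {T = T} p) x = sym (∑-map (_∷ ts) T ∙ ∑-zero T)
only-step (tl {t} {T = T} p)       x = sym (∑-map (t ∷_) T ∙ ∑-zero T)

-- Steps preserve the length of a bag, so a bag of two or more entries gives zero on both sides. For
-- a singleton the step has to be carried under the shift.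
hit-step : ∀ k {us U} {f} → us ⟶ᵇ U → (∀ {y} → y ∈ hit k us → Inv f y) →
  ∑ (hit k us) f ≡ ∑ U (λ u → ∑ (hit k u) f)
hit-step k {u ∷ []} {f = f} (hd {T = T} p) h =
  +-identityʳ _ ∙ Inv-shift 0 k (h (here refl)) p ∙
  ∑-cong T (λ x → sym (+-identityʳ _)) ∙ sym (∑-map (_∷ []) T)
hit-step k {u ∷ v ∷ us} (hd {T = T} p) h = sym (∑-map (_∷ v ∷ us) T ∙ ∑-zero T)
hit-step k {u ∷ v ∷ us} (tl (hd {T = T} p)) h =
  sym (∑-map (u ∷_) (map (_∷ us) T) ∙ ∑-map (_∷ us) T ∙ ∑-zero T)
hit-step k {u ∷ v ∷ us} (tl (tl {T = T} p)) h =
  sym (∑-map (u ∷_) (map (v ∷_) T) ∙ ∑-map (v ∷_) T ∙ ∑-zero T)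

mutual
  D-stepᵇ : ∀ k s us {f U} → us ⟶ᵇ U → (∀ {y} → y ∈ D k s us → Inv f y) →
    ∑ (D k s us) f ≡ ∑ U (λ u → ∑ (D k s u) f)
  D-stepᵇ k (var y) us {U = U} p h with cmp k y
  ... | lt q = ∑≡ (D-lt q us) ∙ only-step p (var y) ∙ ∑-cong U (λ u → ∑≡ (sym (D-lt q u)))
  ... | eq   = ∑≡ (D-eq k us) ∙
    hit-step k p (λ {y} i → h (subst (y ∈_) (sym (D-eq k us)) i)) ∙
    ∑-cong U (λ u → ∑≡ (sym (D-eq k u)))
  ... | gt {y = y′} q = ∑≡ (D-gt q us) ∙ only-step p (var y′) ∙ ∑-cong U (λ u → ∑≡ (sym (D-gt q u)))
  D-stepᵇ k (lam s) us {U = U} p h =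
    ∑-map lam (D (suc k) s us) ∙
    D-stepᵇ (suc k) s us p (λ i → Inv-lam (h (∈-map⁺ lam i))) ∙
    ∑-cong U (λ u → sym (∑-map lam (D (suc k) s u)))
  D-stepᵇ k (inl s) us {U = U} p h =
    ∑-map inl (D k s us) ∙
    D-stepᵇ k s us p (λ i → Inv-inl (h (∈-map⁺ inl i))) ∙
    ∑-cong U (λ u → sym (∑-map inl (D k s u)))
  D-stepᵇ k (inr s) us {U = U} p h =
    ∑-map inr (D k s us) ∙
    D-stepᵇ k s us p (λ i → Inv-inr (h (∈-map⁺ inr i))) ∙
    ∑-cong U (λ u → sym (∑-map inr (D k s u)))
  D-stepᵇ k (app s ts) us {f} {U} p h =
    ∑-D-app k s ts us ∙
    split-step us (λ a b → ∑ (D k s a) λ x → ∑ (DM k ts b) λ y → f (app x y)) p (λ {a} {b} i →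
      (λ q → D-stepᵇ k s a q (λ j → Inv-∑ (DM k ts b) (λ l →
        Inv-fun (h (∈-D-app k s ts us i j l))))) ,
      Invᵇ-∑ (D k s a) (λ j q → DM-stepᵇ k ts b q (λ l →
        Inv-arg (h (∈-D-app k s ts us i j l))))) ∙
    ∑-cong U (λ u → sym (∑-D-app k s ts u))

  DM-stepᵇ : ∀ k ts us {f U} → us ⟶ᵇ U → (∀ {y} → y ∈ DM k ts us → Invᵇ f y) →
    ∑ (DM k ts us) f ≡ ∑ U (λ u → ∑ (DM k ts u) f)
  DM-stepᵇ k [] us {U = U} p h =
    ∑≡ (DM-[] k us) ∙ only-step p [] ∙ ∑-cong U (λ u → ∑≡ (sym (DM-[] k u)))
  DM-stepᵇ k (t ∷ ts) us {f} {U} p h =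
    ∑-DM-∷ k t ts us ∙
    split-step us (λ a b → ∑ (D k t a) λ x → ∑ (DM k ts b) λ y → f (x ∷ y)) p (λ {a} {b} i →
      (λ q → D-stepᵇ k t a q (λ j → Inv-∑ (DM k ts b) (λ l →
        Inv-hd (h (∈-DM-∷ k t ts us i j l))))) ,
      Invᵇ-∑ (D k t a) (λ j q → DM-stepᵇ k ts b q (λ l →
        Inv-tl (h (∈-DM-∷ k t ts us i j l))))) ∙
    ∑-cong U (λ u → sym (∑-DM-∷ k t ts u))

-- Termination measure.

-- A β-step consumes an abstraction and an application; the second component
-- is a weight that drops when a sum constructor moves outwards.
mutual
  size : Term → ℕ
  size (var x)    = 0
  size (lam s)    = suc (size s)
  size (app s ts) = suc (size s + sizeM ts)
  size (inl s)    = size s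
  size (inr s)    = size s

  sizeM : Monomial → ℕ
  sizeM []       = 0
  sizeM (t ∷ ts) = size t + sizeM ts

mutual
  weight : Term → ℕ
  weight (var x)    = 0
  weight (lam s)    = weight s + weight s
  weight (app s ts) = weight s + weight s + weightM ts
  weight (inl s)    = suc (weight s)
  weight (inr s)    = suc (weight s)

  weightM : Monomial → ℕ
  weightM []       = 0
  weightM (t ∷ ts) = weight t + weightM ts

infix 4 _⊏_ _≺_ _≺ₘ_

_⊏_ : ℕ × ℕ → ℕ × ℕ → Set
_⊏_ = ×-Lex _≡_ _<_ _<_

_≺_ : Term → Term → Set
s ≺ t = (size s , weight s) ⊏ (size t , weight t)

_≺ₘ_ : Monomial → Monomial → Set
s ≺ₘ t = (sizeM s , weightM s) ⊏ (sizeM t , weightM t)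

≺-wellFounded : WellFounded _≺_
≺-wellFounded = On.wellFounded (λ s → size s , weight s)
  (×-wellFounded <-wellFounded <-wellFounded)

⊏-trans : ∀ {p q r} → p ⊏ q → q ⊏ r → p ⊏ r
⊏-trans (inj₁ p)       (inj₁ q)        = inj₁ (<-trans p q)
⊏-trans (inj₁ p)       (inj₂ (e , q))  = inj₁ (subst (_ <_) e p)
⊏-trans (inj₂ (e , p)) (inj₁ q)        = inj₁ (subst (_< _) (sym e) q)
⊏-trans (inj₂ (e , p)) (inj₂ (e′ , q)) = inj₂ ((e ∙ e′) , <-trans p q)

≺-trans : ∀ {s t u} → s ≺ t → t ≺ u → s ≺ u
≺-trans = ⊏-trans

≺ₘ-trans : ∀ {s t u} → s ≺ₘ t → t ≺ₘ u → s ≺ₘ u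
≺ₘ-trans = ⊏-trans

≺-lam : ∀ {s t} → s ≺ t → lam s ≺ lam t
≺-lam (inj₁ p)       = inj₁ (s≤s p)
≺-lam (inj₂ (e , p)) = inj₂ (cong suc e , +-mono-< p p)

≺-inl : ∀ {s t} → s ≺ t → inl s ≺ inl t
≺-inl (inj₁ p)       = inj₁ p
≺-inl (inj₂ (e , p)) = inj₂ (e , s≤s p)

≺-inr : ∀ {s t} → s ≺ t → inr s ≺ inr t
≺-inr (inj₁ p)       = inj₁ p
≺-inr (inj₂ (e , p)) = inj₂ (e , s≤s p)

≺-fun : ∀ {s t} ts → s ≺ t → app s ts ≺ app t ts
≺-fun ts (inj₁ p)       = inj₁ (s≤s (+-monoˡ-< (sizeM ts) p))
≺-fun ts (inj₂ (e , p)) = inj₂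
  (cong (λ n → suc (n + sizeM ts)) e , +-monoˡ-< (weightM ts) (+-mono-< p p))

≺-arg : ∀ s {ts us} → ts ≺ₘ us → app s ts ≺ app s us
≺-arg s (inj₁ p)       = inj₁ (s≤s (+-monoʳ-< (size s) p))
≺-arg s (inj₂ (e , p)) = inj₂ (cong (λ n → suc (size s + n)) e , +-monoʳ-< (weight s + weight s) p)

≺-hd : ∀ {s t} ts → s ≺ t → s ∷ ts ≺ₘ t ∷ ts
≺-hd ts (inj₁ p)       = inj₁ (+-monoˡ-< (sizeM ts) p)
≺-hd ts (inj₂ (e , p)) = inj₂ (cong (_+ sizeM ts) e , +-monoˡ-< (weightM ts) p)

≺-tl : ∀ t {ts us} → ts ≺ₘ us → t ∷ ts ≺ₘ t ∷ us
≺-tl t (inj₁ p)       = inj₁ (+-monoʳ-< (size t) p)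
≺-tl t (inj₂ (e , p)) = inj₂ (cong (size t +_) e , +-monoʳ-< (weight t) p)

mutual
  size-shift : ∀ c d s → size (shift c d s) ≡ size s
  size-shift c d (var x) with x <ᵇ c
  ... | true  = refl
  ... | false = refl
  size-shift c d (lam s)    = cong suc (size-shift (suc c) d s)
  size-shift c d (app s ts) = cong suc (cong₂ _+_ (size-shift c d s) (sizeM-shift c d ts))
  size-shift c d (inl s)    = size-shift c d s
  size-shift c d (inr s)    = size-shift c d s

  sizeM-shift : ∀ c d ts → sizeM (shiftM c d ts) ≡ sizeM ts
  sizeM-shift c d []       = refl
  sizeM-shift c d (t ∷ ts) = cong₂ _+_ (size-shift c d t) (sizeM-shift c d ts)

size-split2 : ∀ us {a b} → (a , b) ∈ split2 us → sizeM us ≡ sizeM a + sizeM b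
size-split2 []       (here refl) = refl
size-split2 (u ∷ us) {a} {b} i with ∈-split2-∷⁻ u us i
... | inj₁ (a′ , j , refl) = cong (size u +_) (size-split2 us j) ∙
  sym (+-assoc (size u) (sizeM a′) (sizeM b))
... | inj₂ (b′ , j , refl) = cong (size u +_) (size-split2 us j) ∙
  +-rotate (size u) (sizeM a) (sizeM b′)

mutual
  -- Linearity: each entry of us is used exactly once in every summand, neither copied nor erased.
  size-D : ∀ k s us {x} → x ∈ D k s us → size x ≡ size s + sizeM us
  size-D k (var y) us i with cmp k y
  size-D k (var y) us i | lt p rewrite D-lt p us with us | i
  ... | [] | here refl = refl
  size-D k (var y) us i | eq rewrite D-eq k us with us | i
  ... | u ∷ [] | here refl = size-shift 0 k u ∙ sym (+-identityʳ _)
  size-D k (var y) us i | gt p rewrite D-gt p us with us | i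
  ... | [] | here refl = refl
  size-D k (lam s) us i with ∈-map⁻ lam i
  ... | x , j , refl = cong suc (size-D (suc k) s us j)
  size-D k (inl s) us i with ∈-map⁻ inl i
  ... | x , j , refl = size-D k s us j
  size-D k (inr s) us i with ∈-map⁻ inr i
  ... | x , j , refl = size-D k s us j
  size-D k (app s ts) us i with ∈-Bilinear⁻ app (split2 us) (D k s) (DM k ts) i
  ... | a , b , x , y , j , l , m , refl = cong suc
    (cong₂ _+_ (size-D k s a l) (size-DM k ts b m) ∙
     +-exchange (size s) (sizeM a) (sizeM ts) (sizeM b) ∙
     cong (size s + sizeM ts +_) (sym (size-split2 us j)))

  size-DM : ∀ k ts us {x} → x ∈ DM k ts us → sizeM x ≡ sizeM ts + sizeM us
  size-DM k []       []      (here refl) = refl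
  size-DM k (t ∷ ts) us i with ∈-Bilinear⁻ _∷_ (split2 us) (D k t) (DM k ts) i
  ... | a , b , x , y , j , l , m , refl =
    cong₂ _+_ (size-D k t a l) (size-DM k ts b m) ∙
    +-exchange (size t) (sizeM a) (sizeM ts) (sizeM b) ∙
    cong (size t + sizeM ts +_) (sym (size-split2 us j))

≺-β : ∀ {s ts x} → x ∈ D 0 s ts → x ≺ app (lam s) ts
≺-β {s} {ts} i rewrite size-D 0 s ts i = inj₁ (s≤s (n≤1+n _))

-- The doubling in `weight` is made for this: an injection counts twice in head position and once
-- outside, so moving it out lowers the weight by one at equal size. The body of an abstraction is
-- doubled for the same purpose.
≺-appL : ∀ s ts → inl (app s ts) ≺ app (inl s) ts
≺-appL s ts = inj₂
  (refl , s≤s (+-monoˡ-≤ (weightM ts) (≤-reflexive (sym (+-suc (weight s) (weight s))))))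

≺-appR : ∀ s ts → inr (app s ts) ≺ app (inr s) ts
≺-appR = ≺-appL

≺-lamL : ∀ s → inl (lam s) ≺ lam (inl s)
≺-lamL s = inj₂ (refl , s≤s (≤-reflexive (sym (+-suc (weight s) (weight s)))))

≺-lamR : ∀ s → inr (lam s) ≺ lam (inr s)
≺-lamR = ≺-lamL

mutual
  step-≺ : ∀ s {S x} → s ⟶ S → x ∈ S → x ≺ s
  step-≺ (app (lam s) ts) β i = ≺-β {s} {ts} i
  step-≺ (app (inl s) ts) appL (here refl) = ≺-appL s ts
  step-≺ (app (inr s) ts) appR (here refl) = ≺-appR s ts
  step-≺ (lam (inl s)) lamL (here refl) = ≺-lamL s
  step-≺ (lam (inr s)) lamR (here refl) = ≺-lamR s
  step-≺ (lam s) (ctx-lam p) i with ∈-map⁻ lam i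
  ... | x , j , refl = ≺-lam {x} {s} (step-≺ s p j)
  step-≺ (app s ts) (ctx-fun p) i with ∈-map⁻ _ i
  ... | x , j , refl = ≺-fun {x} {s} ts (step-≺ s p j)
  step-≺ (app s ts) (ctx-arg p) i with ∈-map⁻ _ i
  ... | x , j , refl = ≺-arg s {x} {ts} (step-≺ₘ ts (⟶ₘ⇒⟶ᵇ p) j)
  step-≺ (inl s) (ctx-inl p) i with ∈-map⁻ inl i
  ... | x , j , refl = ≺-inl {x} {s} (step-≺ s p j)
  step-≺ (inr s) (ctx-inr p) i with ∈-map⁻ inr i
  ... | x , j , refl = ≺-inr {x} {s} (step-≺ s p j)

  step-≺ₘ : ∀ ts {T x} → ts ⟶ᵇ T → x ∈ T → x ≺ₘ ts
  step-≺ₘ (t ∷ ts) (hd p) i with ∈-map⁻ _ i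
  ... | x , j , refl = ≺-hd {x} {t} ts (step-≺ t p j)
  step-≺ₘ (t ∷ ts) (tl p) i with ∈-map⁻ _ i
  ... | x , j , refl = ≺-tl t {x} {ts} (step-≺ₘ ts p j)

-- Local confluence, seen by a functional that is invariant below the peak.
Below : (Term → ℕ) → Term → Set
Below f e = ∀ x → x ≺ e → Inv f x

-- If the body begins with an injection and `lam` was commuted with it, two further steps (move the
-- injection out of the application, then β below it) lead to `map inl (D 0 s ts)`, which is what
-- the direct β-step computes; dually for `inr`. A step inside the body is handled by `D-step`.
β-fun : ∀ {s ts S f} → Below f (app (lam s) ts) → lam s ⟶ S →
  ∑ (D 0 s ts) f ≡ ∑ (map (λ x → app x ts) S) f
β-fun {inl s} {ts} {f = f} h lamL =
  sym (+-identityʳ _ ∙ h t₁ (step-≺ t₀ (ctx-fun lamL) (here refl)) appL ∙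
    +-identityʳ _ ∙ h t₂ (≺-trans {t₂} {t₁} {t₀} (≺-appL (lam s) ts)
      (step-≺ t₀ (ctx-fun lamL) (here refl))) (ctx-inl β))
  where
  t₀ t₁ t₂ : Term
  t₀ = app (lam (inl s)) ts
  t₁ = app (inl (lam s)) ts
  t₂ = inl (app (lam s) ts)
β-fun {inr s} {ts} {f = f} h lamR =
  sym (+-identityʳ _ ∙ h t₁ (step-≺ t₀ (ctx-fun lamR) (here refl)) appR ∙
    +-identityʳ _ ∙ h t₂ (≺-trans {t₂} {t₁} {t₀} (≺-appR (lam s) ts)
      (step-≺ t₀ (ctx-fun lamR) (here refl))) (ctx-inr β))
  where
  t₀ t₁ t₂ : Term
  t₀ = app (lam (inr s)) ts
  t₁ = app (inr (lam s)) ts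
  t₂ = inr (app (lam s) ts)
β-fun {s} {ts} {f = f} h (ctx-lam {S = S} p) =
  D-step 0 s ts p (λ {y} i → h y (≺-β {s} {ts} i)) ∙
  ∑-cong-∈ S (λ {x} i → sym (h (app (lam x) ts)
    (step-≺ (app (lam s) ts) (ctx-fun (ctx-lam p)) (∈-map⁺ _ (∈-map⁺ lam i))) β)) ∙
  sym (∑-map (λ x → app x ts) (map lam S) ∙ ∑-map lam S)

β-arg : ∀ {s ts T f} → Below f (app (lam s) ts) → ts ⟶ᵇ T →
  ∑ (D 0 s ts) f ≡ ∑ (map (app (lam s)) T) f
β-arg {s} {ts} {T} h p =
  D-stepᵇ 0 s ts p (λ {y} i → h y (≺-β {s} {ts} i)) ∙
  ∑-cong-∈ T (λ {x} i → sym (h (app (lam s) x) (≺-arg (lam s) {x} {ts} (step-≺ₘ ts p i)) β)) ∙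
  sym (∑-map (app (lam s)) T)

-- A redex C whose contraction only moves the sum constructor ι outwards
-- commutes with a step inside C.
slide : ∀ {f : Term → ℕ} (C ι : A → Term) (ctx : A → List A → Set) →
  (∀ x → C x ⟶ (ι x ∷ [])) → (∀ {x X} → ctx x X → ι x ⟶ map ι X) →
  (∀ {x X y} → ctx x X → y ∈ X → C y ≺ C x) → (∀ x → ι x ≺ C x) →
  ∀ {x X} → Below f (C x) → ctx x X → ∑ (ι x ∷ []) f ≡ ∑ (map C X) f
slide C ι ctx move inner dec dec-ι {x} {X} h p =
  +-identityʳ _ ∙ h (ι x) (dec-ι x) (inner p) ∙ ∑-map ι X ∙
  ∑-cong-∈ X (λ {y} i → sym (+-identityʳ _) ∙ sym (h (C y) (dec p i) (move y))) ∙
  sym (∑-map C X)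

appL-fun : ∀ {s ts S f} → Below f (app (inl s) ts) → inl s ⟶ S →
  ∑ (inl (app s ts) ∷ []) f ≡ ∑ (map (λ x → app x ts) S) f
appL-fun {ts = ts} h (ctx-inl {s} {S} p) =
  slide (λ x → app (inl x) ts) (λ x → inl (app x ts)) _⟶_ (λ _ → appL)
    (λ {x} {X} q → subst (_ ⟶_) (sym (map-∘ X)) (ctx-inl (ctx-fun q)))
    (λ {x} {X} {y} q i → ≺-fun {inl y} {inl x} ts (≺-inl {y} {x} (step-≺ x q i)))
    (λ x → ≺-appL x ts) h p ∙ ∑≡ (map-∘ S)

appR-fun : ∀ {s ts S f} → Below f (app (inr s) ts) → inr s ⟶ S →
  ∑ (inr (app s ts) ∷ []) f ≡ ∑ (map (λ x → app x ts) S) f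
appR-fun {ts = ts} h (ctx-inr {s} {S} p) =
  slide (λ x → app (inr x) ts) (λ x → inr (app x ts)) _⟶_ (λ _ → appR)
    (λ {x} {X} q → subst (_ ⟶_) (sym (map-∘ X)) (ctx-inr (ctx-fun q)))
    (λ {x} {X} {y} q i → ≺-fun {inr y} {inr x} ts (≺-inr {y} {x} (step-≺ x q i)))
    (λ x → ≺-appR x ts) h p ∙ ∑≡ (map-∘ S)

appL-arg : ∀ {s ts T f} → Below f (app (inl s) ts) → ts ⟶ᵇ T →
  ∑ (inl (app s ts) ∷ []) f ≡ ∑ (map (app (inl s)) T) f
appL-arg {s} = slide (app (inl s)) (λ x → inl (app s x)) _⟶ᵇ_ (λ _ → appL)
  (λ {x} {X} q → subst (_ ⟶_) (sym (map-∘ X)) (ctx-inl (ctx-arg (⟶ᵇ⇒⟶ₘ q))))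
  (λ {x} {X} {y} q i → ≺-arg (inl s) {y} {x} (step-≺ₘ x q i)) (λ x → ≺-appL s x)

appR-arg : ∀ {s ts T f} → Below f (app (inr s) ts) → ts ⟶ᵇ T →
  ∑ (inr (app s ts) ∷ []) f ≡ ∑ (map (app (inr s)) T) f
appR-arg {s} = slide (app (inr s)) (λ x → inr (app s x)) _⟶ᵇ_ (λ _ → appR)
  (λ {x} {X} q → subst (_ ⟶_) (sym (map-∘ X)) (ctx-inr (ctx-arg (⟶ᵇ⇒⟶ₘ q))))
  (λ {x} {X} {y} q i → ≺-arg (inr s) {y} {x} (step-≺ₘ x q i)) (λ x → ≺-appR s x)

lamL-lam : ∀ {s S f} → Below f (lam (inl s)) → inl s ⟶ S →
  ∑ (inl (lam s) ∷ []) f ≡ ∑ (map lam S) f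
lamL-lam h (ctx-inl {s} {S} p) =
  slide (λ x → lam (inl x)) (λ x → inl (lam x)) _⟶_ (λ _ → lamL)
    (λ {x} {X} q → subst (_ ⟶_) (sym (map-∘ X)) (ctx-inl (ctx-lam q)))
    (λ {x} {X} {y} q i → ≺-lam {inl y} {inl x} (≺-inl {y} {x} (step-≺ x q i)))
    ≺-lamL h p ∙ ∑≡ (map-∘ S)

lamR-lam : ∀ {s S f} → Below f (lam (inr s)) → inr s ⟶ S →
  ∑ (inr (lam s) ∷ []) f ≡ ∑ (map lam S) f
lamR-lam h (ctx-inr {s} {S} p) =
  slide (λ x → lam (inr x)) (λ x → inr (lam x)) _⟶_ (λ _ → lamR)
    (λ {x} {X} q → subst (_ ⟶_) (sym (map-∘ X)) (ctx-inr (ctx-lam q)))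
    (λ {x} {X} {y} q i → ≺-lam {inr y} {inr x} (≺-inr {y} {x} (step-≺ x q i)))
    ≺-lamR h p ∙ ∑≡ (map-∘ S)

-- Disjoint redexes: each side, after the other step, is the double sum over S and T, and the two
-- orders of summation agree.
fun-arg : ∀ {s ts S T f} → Below f (app s ts) → s ⟶ S → ts ⟶ᵇ T →
  ∑ (map (λ x → app x ts) S) f ≡ ∑ (map (app s) T) f
fun-arg {s} {ts} {S} {T} {f} h p q =
  ∑-map _ S ∙
  ∑-cong-∈ S (λ {x} i → Inv-arg {f} (h (app x ts) (≺-fun {x} {s} ts (step-≺ s p i))) q) ∙
  ∑-swap S T ∙
  ∑-cong-∈ T (λ {x} i → sym (Inv-fun {f} (h (app s x) (≺-arg s {x} {ts} (step-≺ₘ ts q i))) p)) ∙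
  sym (∑-map (app s) T)

hd-tl : ∀ {t ts S T f} → (∀ x → x ≺ₘ t ∷ ts → Invᵇ f x) → t ⟶ S → ts ⟶ᵇ T →
  ∑ (map (_∷ ts) S) f ≡ ∑ (map (t ∷_) T) f
hd-tl {s} {ts} {S} {T} {f} h p q =
  ∑-map _ S ∙
  ∑-cong-∈ S (λ {x} i → Inv-tl {f} (h (x ∷ ts) (≺-hd {x} {s} ts (step-≺ s p i))) q) ∙
  ∑-swap S T ∙
  ∑-cong-∈ T (λ {x} i → sym (Inv-hd {f} (h (s ∷ x) (≺-tl s {x} {ts} (step-≺ₘ ts q i))) p)) ∙
  sym (∑-map (s ∷_) T)

mutual
  -- When both steps take place in the same subterm, the induction runs on f composed with the
  -- surrounding context, which inherits invariance because both reduction and `_≺_` are closed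
  -- under contexts.
  local-confluence : ∀ e {E₁ E₂ f} → Below f e → e ⟶ E₁ → e ⟶ E₂ → ∑ E₁ f ≡ ∑ E₂ f
  local-confluence (app (lam s) ts) h β β = refl
  local-confluence (app (lam s) ts) h β (ctx-fun q) = β-fun h q
  local-confluence (app (lam s) ts) h β (ctx-arg q) = β-arg h (⟶ₘ⇒⟶ᵇ q)
  local-confluence (app (lam s) ts) h (ctx-fun p) β = sym (β-fun h p)
  local-confluence (app (lam s) ts) h (ctx-arg p) β = sym (β-arg h (⟶ₘ⇒⟶ᵇ p))
  local-confluence (app (inl s) ts) h appL appL = refl
  local-confluence (app (inl s) ts) h appL (ctx-fun q) = appL-fun h q
  local-confluence (app (inl s) ts) h appL (ctx-arg q) = appL-arg h (⟶ₘ⇒⟶ᵇ q)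
  local-confluence (app (inl s) ts) h (ctx-fun p) appL = sym (appL-fun h p)
  local-confluence (app (inl s) ts) h (ctx-arg p) appL = sym (appL-arg h (⟶ₘ⇒⟶ᵇ p))
  local-confluence (app (inr s) ts) h appR appR = refl
  local-confluence (app (inr s) ts) h appR (ctx-fun q) = appR-fun h q
  local-confluence (app (inr s) ts) h appR (ctx-arg q) = appR-arg h (⟶ₘ⇒⟶ᵇ q)
  local-confluence (app (inr s) ts) h (ctx-fun p) appR = sym (appR-fun h p)
  local-confluence (app (inr s) ts) h (ctx-arg p) appR = sym (appR-arg h (⟶ₘ⇒⟶ᵇ p))
  local-confluence (app s ts) {f = f} h (ctx-fun {S = S} p) (ctx-fun {S = T} q) =
    ∑-map _ S ∙
    local-confluence s {f = λ x → f (app x ts)}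
      (λ x r → Inv-fun (h (app x ts) (≺-fun {x} {s} ts r))) p q ∙
    sym (∑-map _ T)
  local-confluence (app s ts) h (ctx-fun p) (ctx-arg q) = fun-arg h p (⟶ₘ⇒⟶ᵇ q)
  local-confluence (app s ts) h (ctx-arg p) (ctx-fun q) = sym (fun-arg h q (⟶ₘ⇒⟶ᵇ p))
  local-confluence (app s ts) {f = f} h (ctx-arg {T = S} p) (ctx-arg {T = T} q) =
    ∑-map _ S ∙
    local-confluenceᵇ ts {f = λ x → f (app s x)}
      (λ x r → Inv-arg (h (app s x) (≺-arg s {x} {ts} r)))
      (⟶ₘ⇒⟶ᵇ p) (⟶ₘ⇒⟶ᵇ q) ∙
    sym (∑-map _ T)
  local-confluence (lam (inl s)) h lamL lamL = refl
  local-confluence (lam (inl s)) h lamL (ctx-lam q) = lamL-lam h q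
  local-confluence (lam (inl s)) h (ctx-lam p) lamL = sym (lamL-lam h p)
  local-confluence (lam (inr s)) h lamR lamR = refl
  local-confluence (lam (inr s)) h lamR (ctx-lam q) = lamR-lam h q
  local-confluence (lam (inr s)) h (ctx-lam p) lamR = sym (lamR-lam h p)
  local-confluence (lam s) {f = f} h (ctx-lam {S = S} p) (ctx-lam {S = T} q) =
    ∑-map lam S ∙
    local-confluence s {f = λ x → f (lam x)} (λ x r → Inv-lam (h (lam x) (≺-lam {x} {s} r))) p q ∙
    sym (∑-map lam T)
  local-confluence (inl s) {f = f} h (ctx-inl {S = S} p) (ctx-inl {S = T} q) =
    ∑-map inl S ∙
    local-confluence s {f = λ x → f (inl x)} (λ x r → Inv-inl (h (inl x) (≺-inl {x} {s} r))) p q ∙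
    sym (∑-map inl T)
  local-confluence (inr s) {f = f} h (ctx-inr {S = S} p) (ctx-inr {S = T} q) =
    ∑-map inr S ∙
    local-confluence s {f = λ x → f (inr x)} (λ x r → Inv-inr (h (inr x) (≺-inr {x} {s} r))) p q ∙
    sym (∑-map inr T)

  local-confluenceᵇ : ∀ e {E₁ E₂ f} → (∀ x → x ≺ₘ e → Invᵇ f x) →
    e ⟶ᵇ E₁ → e ⟶ᵇ E₂ → ∑ E₁ f ≡ ∑ E₂ f
  local-confluenceᵇ (t ∷ ts) {f = f} h (hd {T = S} p) (hd {T = T} q) =
    ∑-map _ S ∙
    local-confluence t {f = λ x → f (x ∷ ts)}
      (λ x r → Inv-hd (h (x ∷ ts) (≺-hd {x} {t} ts r))) p q ∙
    sym (∑-map _ T)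
  local-confluenceᵇ (t ∷ ts) h (hd p) (tl q) = hd-tl h p q
  local-confluenceᵇ (t ∷ ts) h (tl p) (hd q) = sym (hd-tl h q p)
  local-confluenceᵇ (t ∷ ts) {f = f} h (tl {T = S} p) (tl {T = T} q) =
    ∑-map _ S ∙
    local-confluenceᵇ ts {f = λ x → f (t ∷ x)}
      (λ x r → Inv-tl (h (t ∷ x) (≺-tl t {x} {ts} r))) p q ∙
    sym (∑-map _ T)

-- Parallel reduction and its progress.

Normalᵗ : Term → Set
Normalᵗ s = ∀ {S} → ¬ s ⟶ S

Normalᵇ : Monomial → Set
Normalᵇ ts = ∀ {T} → ¬ ts ⟶ᵇ T

-- A parallel reduction that acts uniformly on all elements of a bag, so that
-- coherent expressions are reduced in lockstep.
lam′ : Term → Term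
lam′ (inl s) = inl (lam s)
lam′ (inr s) = inr (lam s)
lam′ s       = lam s

app′ : Term → Monomial → List Term
app′ (lam s) ts = D 0 s ts
app′ (inl s) ts = inl (app s ts) ∷ []
app′ (inr s) ts = inr (app s ts) ∷ []
app′ s       ts = app s ts ∷ []

mutual
  P : Term → List Term
  P (var x)    = var x ∷ []
  P (lam s)    = map lam′ (P s)
  P (app s ts) = concatMap (λ x → concatMap (app′ x) (PM ts)) (P s)
  P (inl s)    = map inl (P s)
  P (inr s)    = map inr (P s)

  PM : Monomial → List Monomial
  PM []       = [] ∷ []
  PM (t ∷ ts) = concatMap (λ x → map (x ∷_) (PM ts)) (P t)

∑-P-app : ∀ s ts {f} → ∑ (P (app s ts)) f ≡ ∑ (P s) (λ x → ∑ (PM ts) λ y → ∑ (app′ x y) f)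
∑-P-app s ts = ∑-concatMap _ (P s) ∙ ∑-cong (P s) (λ x → ∑-concatMap (app′ x) (PM ts))

∑-PM-∷ : ∀ t ts {f} → ∑ (PM (t ∷ ts)) f ≡ ∑ (P t) (λ x → ∑ (PM ts) λ y → f (x ∷ y))
∑-PM-∷ t ts = ∑-concatMap _ (P t) ∙ ∑-cong (P t) (λ x → ∑-map (x ∷_) (PM ts))

∈-P-app : ∀ s ts {z} → z ∈ P (app s ts) → ∃[ x ] ∃[ y ] x ∈ P s × y ∈ PM ts × z ∈ app′ x y
∈-P-app s ts i with find (∈-concatMap⁻ (λ x → concatMap (app′ x) (PM ts)) {xs = P s} i)
... | x , j , k with find (∈-concatMap⁻ (app′ x) {xs = PM ts} k)
... | y , l , m = x , y , j , l , m

∈-PM-∷ : ∀ t ts {z} → z ∈ PM (t ∷ ts) → ∃[ x ] ∃[ y ] x ∈ P t × y ∈ PM ts × z ≡ x ∷ y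
∈-PM-∷ t ts i with find (∈-concatMap⁻ (λ x → map (x ∷_) (PM ts)) {xs = P t} i)
... | x , j , k with ∈-map⁻ (x ∷_) k
... | y , l , e = x , y , j , l , e

lam′-progress : ∀ s → (lam′ s ≡ lam s × (∀ {S} → lam s ⟶ S → ∃ (s ⟶_))) ⊎
                      (lam′ s ≺ lam s × ∃ (lam s ⟶_))
lam′-progress (var x)    = inj₁ (refl , λ { (ctx-lam p) → _ , p })
lam′-progress (lam s)    = inj₁ (refl , λ { (ctx-lam p) → _ , p })
lam′-progress (app s ts) = inj₁ (refl , λ { (ctx-lam p) → _ , p })
lam′-progress (inl s)    = inj₂ (≺-lamL s , _ , lamL)
lam′-progress (inr s)    = inj₂ (≺-lamR s , _ , lamR)

app′-progress : ∀ s ts →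
  (app′ s ts ≡ app s ts ∷ [] × (∀ {S} → app s ts ⟶ S → ∃ (s ⟶_) ⊎ ∃ (ts ⟶ᵇ_))) ⊎
  ((∀ {x} → x ∈ app′ s ts → x ≺ app s ts) × ∃ (app s ts ⟶_))
app′-progress (var x)    ts = inj₁
  (refl , λ { (ctx-fun p) → inj₁ (_ , p) ; (ctx-arg p) → inj₂ (_ , ⟶ₘ⇒⟶ᵇ p) })
app′-progress (app s us) ts = inj₁
  (refl , λ { (ctx-fun p) → inj₁ (_ , p) ; (ctx-arg p) → inj₂ (_ , ⟶ₘ⇒⟶ᵇ p) })
app′-progress (lam s)    ts = inj₂ ((λ i → ≺-β {s} {ts} i) , _ , β)
app′-progress (inl s)    ts = inj₂ ((λ { (here refl) → ≺-appL s ts }) , _ , appL)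
app′-progress (inr s)    ts = inj₂ ((λ { (here refl) → ≺-appR s ts }) , _ , appR)

lam′-≺ : ∀ {x s} → x ≺ s → lam′ x ≺ lam s
lam′-≺ {x} {s} p with lam′-progress x
... | inj₁ (e , _) rewrite e = ≺-lam {x} {s} p
... | inj₂ (q , _) = ≺-trans {lam′ x} {lam x} {lam s} q (≺-lam {x} {s} p)

app′-≺ : ∀ {x y s ts} → app x y ≺ app s ts → ∀ {z} → z ∈ app′ x y → z ≺ app s ts
app′-≺ {x} {y} {s} {ts} p {z} i with app′-progress x y
... | inj₁ (e , _) with here refl ← subst (z ∈_) e i = p
... | inj₂ (q , _) = ≺-trans {z} {app x y} {app s ts} (q i) p

-- The decrease of `P` drives the induction on coherent pairs, and the step in the second
-- alternative drives normalisation. In the first alternative `P` leaves a normal term in place, so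
-- it can wait while its partner still reduces.
Progress : Term → Set
Progress s = (Normalᵗ s × P s ≡ s ∷ []) ⊎ ((∀ {x} → x ∈ P s → x ≺ s) × ∃ (s ⟶_))

Progressᵇ : Monomial → Set
Progressᵇ ts = (Normalᵇ ts × PM ts ≡ ts ∷ []) ⊎ ((∀ {x} → x ∈ PM ts → x ≺ₘ ts) × ∃ (ts ⟶ᵇ_))

mutual
  progress : ∀ s → Progress s
  progress (var x) = inj₁ ((λ ()) , refl)
  progress (lam s) with progress s
  ... | inj₂ (dec , _ , p) = inj₂ (smaller , _ , ctx-lam p)
    where
    smaller : ∀ {x} → x ∈ map lam′ (P s) → x ≺ lam s
    smaller i with ∈-map⁻ lam′ i
    ... | y , j , refl = lam′-≺ {y} {s} (dec j)
  ... | inj₁ (n , e) rewrite e with lam′-progress s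
  ... | inj₁ (e′ , inv) rewrite e′ = inj₁ ((λ p → n (proj₂ (inv p))) , refl)
  ... | inj₂ (q , p) = inj₂ ((λ { (here refl) → q }) , p)
  progress (inl s) with progress s
  ... | inj₁ (n , e) rewrite e = inj₁ ((λ { (ctx-inl p) → n p }) , refl)
  ... | inj₂ (dec , _ , p) = inj₂ (smaller , _ , ctx-inl p)
    where
    smaller : ∀ {x} → x ∈ map inl (P s) → x ≺ inl s
    smaller i with ∈-map⁻ inl i
    ... | y , j , refl = ≺-inl {y} {s} (dec j)
  progress (inr s) with progress s
  ... | inj₁ (n , e) rewrite e = inj₁ ((λ { (ctx-inr p) → n p }) , refl)
  ... | inj₂ (dec , _ , p) = inj₂ (smaller , _ , ctx-inr p)
    where
    smaller : ∀ {x} → x ∈ map inr (P s) → x ≺ inr s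
    smaller i with ∈-map⁻ inr i
    ... | y , j , refl = ≺-inr {y} {s} (dec j)
  progress (app s ts) with progress s | progressᵇ ts
  ... | inj₁ (n , e) | inj₁ (nᵇ , eᵇ) rewrite e | eᵇ with app′-progress s ts
  ...   | inj₁ (e′ , inv) rewrite e′ =
    inj₁ ((λ p → [ (λ q → n (proj₂ q)) , (λ q → nᵇ (proj₂ q)) ]′ (inv p)) , refl)
  ...   | inj₂ (dec , p) = inj₂ (smaller , p)
    where
    smaller : ∀ {x} → x ∈ (app′ s ts ++ []) ++ [] → x ≺ app s ts
    smaller {x} i = dec (subst (x ∈_) (++-identityʳ _ ∙ ++-identityʳ _) i)
  progress (app s ts) | inj₁ (n , e) | inj₂ (dec , _ , p) =
    inj₂ (smaller , _ , ctx-arg (⟶ᵇ⇒⟶ₘ p))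
    where
    smaller : ∀ {x} → x ∈ P (app s ts) → x ≺ app s ts
    smaller i with ∈-P-app s ts i
    ... | x , y , j , l , m with here refl ← subst (x ∈_) e j =
      app′-≺ {x} {y} {s} {ts} (≺-arg s {y} {ts} (dec l)) m
  progress (app s ts) | inj₂ (dec , _ , p) | q = inj₂ (smaller , _ , ctx-fun p)
    where
    smaller : ∀ {x} → x ∈ P (app s ts) → x ≺ app s ts
    smaller i with ∈-P-app s ts i
    ... | x , y , j , l , m = app′-≺ {x} {y} {s} {ts} (bigger q) m
      where
      bigger : Progressᵇ ts → app x y ≺ app s ts
      bigger (inj₁ (_ , e)) with here refl ← subst (y ∈_) e l = ≺-fun {x} {s} y (dec j)
      bigger (inj₂ (dec′ , _)) = ≺-trans {app x y} {app x ts} {app s ts}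
        (≺-arg x {y} {ts} (dec′ l)) (≺-fun {x} {s} ts (dec j))

  progressᵇ : ∀ ts → Progressᵇ ts
  progressᵇ [] = inj₁ ((λ ()) , refl)
  progressᵇ (t ∷ ts) with progress t | progressᵇ ts
  ... | inj₁ (n , e) | inj₁ (nᵇ , eᵇ) rewrite e | eᵇ =
    inj₁ ((λ { (hd p) → n p ; (tl p) → nᵇ p }) , refl)
  ... | inj₁ (n , e) | inj₂ (dec , _ , p) = inj₂ (smaller , _ , tl p)
    where
    smaller : ∀ {x} → x ∈ PM (t ∷ ts) → x ≺ₘ t ∷ ts
    smaller i with ∈-PM-∷ t ts i
    ... | x , y , j , l , refl with here refl ← subst (x ∈_) e j = ≺-tl t {y} {ts} (dec l)
  ... | inj₂ (dec , _ , p) | q = inj₂ (smaller , _ , hd p)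
    where
    smaller : ∀ {x} → x ∈ PM (t ∷ ts) → x ≺ₘ t ∷ ts
    smaller i with ∈-PM-∷ t ts i
    ... | x , y , j , l , refl = bigger q
      where
      bigger : Progressᵇ ts → x ∷ y ≺ₘ t ∷ ts
      bigger (inj₁ (_ , e)) with here refl ← subst (y ∈_) e l = ≺-hd {x} {t} y (dec j)
      bigger (inj₂ (dec′ , _)) = ≺ₘ-trans {x ∷ y} {x ∷ ts} {t ∷ ts}
        (≺-tl x {y} {ts} (dec′ l)) (≺-hd {x} {t} ts (dec j))

-- Normalisation and uniqueness of normal forms.

infix 4 _⇓_ _⇓*_

mutual
  -- Each summand follows a reduction of its own, with arbitrary steps, so that normal forms
  -- obtained by different strategies can be compared.
  data _⇓_ : Term → List Term → Set where
    done : ∀ {s} → Normalᵗ s → s ⇓ s ∷ []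
    step : ∀ {s S N} → s ⟶ S → S ⇓* N → s ⇓ N

  data _⇓*_ : List Term → List Term → Set where
    []  : [] ⇓* []
    _∷_ : ∀ {s S N M} → s ⇓ N → S ⇓* M → (s ∷ S) ⇓* (N ++ M)

⇓*-concatMap : ∀ (h : Term → List Term) S → (∀ {x} → x ∈ S → x ⇓ h x) → S ⇓* concatMap h S
⇓*-concatMap h []      p = []
⇓*-concatMap h (x ∷ S) p = p (here refl) ∷ ⇓*-concatMap h S (p ∘ there)

⇓*-exists : ∀ S → (∀ {x} → x ∈ S → ∃ (x ⇓_)) → ∃ (S ⇓*_)
⇓*-exists []      p = [] , []
⇓*-exists (x ∷ S) p = _ , proj₂ (p (here refl)) ∷ proj₂ (⇓*-exists S (p ∘ there))

normalisation : ∀ s → Acc _≺_ s → ∃ (s ⇓_)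
normalisation s (acc rec) with progress s
... | inj₁ (n , _)         = _ , done n
... | inj₂ (_ , S , p) with ⇓*-exists S (λ {x} i → normalisation x (rec (step-≺ s p i)))
... | N , ps = N , step p ps

nf : Term → List Term
nf s = proj₁ (normalisation s (≺-wellFounded s))

⇓-nf : ∀ s → s ⇓ nf s
⇓-nf s = proj₂ (normalisation s (≺-wellFounded s))

⇓-step : ∀ {s S} → s ⟶ S → s ⇓ concatMap nf S
⇓-step {S = S} p = step p (⇓*-concatMap nf S (λ {x} _ → ⇓-nf x))

-- Newman's lemma, one functional at a time.
module _ (g : Term → ℕ) where
  W : Term → ℕ
  W s = ∑ (nf s) g

  ⇓*-∑ : ∀ {S N} → (∀ {x N} → x ∈ S → x ⇓ N → ∑ N g ≡ W x) → S ⇓* N → ∑ N g ≡ ∑ S W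
  ⇓*-∑ h [] = refl
  ⇓*-∑ h (_∷_ {N = N} p ps) = ∑-++ N ∙ cong₂ _+_ (h (here refl) p) (⇓*-∑ (h ∘ there) ps)

  -- The functional g itself need not be invariant. The induction hypothesis says that `W`, the
  -- value of g on normal forms, is invariant below s, so local confluence is applied to `W`.
  ⇓-unique : ∀ s → Acc _≺_ s → ∀ {N M} → s ⇓ N → s ⇓ M → ∑ N g ≡ ∑ M g
  ⇓-unique s _ (done n) (done _)   = refl
  ⇓-unique s _ (done n) (step p _) = ⊥-elim (n p)
  ⇓-unique s _ (step p _) (done n) = ⊥-elim (n p)
  ⇓-unique s (acc rec) (step p ps) (step q qs) =
    ⇓*-∑ (λ {x} i r → ⇓-unique x (rec (step-≺ s p i)) r (⇓-nf x)) ps ∙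
    local-confluence s (λ x x≺s {X} r →
      ⇓-unique x (rec x≺s) (⇓-nf x) (⇓-step r) ∙ ∑-concatMap nf X) p q ∙
    sym (⇓*-∑ (λ {x} i r → ⇓-unique x (rec (step-≺ s q i)) r (⇓-nf x)) qs)

  W-Inv : ∀ s → Inv W s
  W-Inv s {S} p = ⇓-unique s (≺-wellFounded s) (⇓-nf s) (⇓-step p) ∙ ∑-concatMap nf S

  W-normal : ∀ {s} → Normalᵗ s → W s ≡ g s
  W-normal {s} n = ⇓-unique s (≺-wellFounded s) (⇓-nf s) (done n) ∙ +-identityʳ _

-- Invariance under parallel reduction.

lam′-Inv : ∀ {f} → (∀ s → Inv f s) → ∀ s → f (lam s) ≡ f (lam′ s)
lam′-Inv h (var x)    = refl
lam′-Inv h (lam s)    = refl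
lam′-Inv h (app s ts) = refl
lam′-Inv h (inl s)    = h _ lamL ∙ +-identityʳ _
lam′-Inv h (inr s)    = h _ lamR ∙ +-identityʳ _

app′-Inv : ∀ {f} → (∀ s → Inv f s) → ∀ s ts → f (app s ts) ≡ ∑ (app′ s ts) f
app′-Inv h (var x)    ts = sym (+-identityʳ _)
app′-Inv h (app s us) ts = sym (+-identityʳ _)
app′-Inv h (lam s)    ts = h _ β
app′-Inv h (inl s)    ts = h _ appL
app′-Inv h (inr s)    ts = h _ appR

mutual
  -- `P` is a composite of ordinary steps in contexts. Following an invariant functional through
  -- them replaces the construction of a reduction sequence between sums.
  P-Inv : ∀ s {f} → (∀ s → Inv f s) → f s ≡ ∑ (P s) f
  P-Inv (var x) h = sym (+-identityʳ _)
  P-Inv (lam s) {f} h = P-Inv s (λ x → Inv-lam (h (lam x))) ∙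
    ∑-cong (P s) (lam′-Inv h) ∙ sym (∑-map lam′ (P s))
  P-Inv (inl s) {f} h = P-Inv s (λ x → Inv-inl (h (inl x))) ∙ sym (∑-map inl (P s))
  P-Inv (inr s) {f} h = P-Inv s (λ x → Inv-inr (h (inr x))) ∙ sym (∑-map inr (P s))
  P-Inv (app s ts) {f} h =
    P-Inv s {λ x → f (app x ts)} (λ x → Inv-fun (h (app x ts))) ∙
    ∑-cong (P s) (λ x → PM-Inv ts {λ y → f (app x y)} (λ y → Inv-arg (h (app x y))) ∙
      ∑-cong (PM ts) (λ y → app′-Inv h x y)) ∙
    sym (∑-P-app s ts)

  PM-Inv : ∀ ts {f} → (∀ ts → Invᵇ f ts) → f ts ≡ ∑ (PM ts) f
  PM-Inv [] h = sym (+-identityʳ _)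
  PM-Inv (t ∷ ts) {f} h =
    P-Inv t {λ x → f (x ∷ ts)} (λ x → Inv-hd (h (x ∷ ts))) ∙
    ∑-cong (P t) (λ x → PM-Inv ts {λ y → f (x ∷ y)} (λ y → Inv-tl (h (x ∷ y)))) ∙
    sym (∑-PM-∷ t ts)

-- The nested `All` inside `mono≍` is traversed here once and for all; the induction hypothesis for
-- a bag becomes a statement about any two members of the combined bags.
≍-elim : (R : Term → Term → Set) →
  (∀ x → R (var x) (var x)) →
  (∀ {s s′} → R s s′ → R (lam s) (lam s′)) →
  (∀ {s s′ ts ts′} → R s s′ → (∀ {t t′} → t ∈ ts ++ ts′ → t′ ∈ ts ++ ts′ → R t t′) →
    R (app s ts) (app s′ ts′)) →
  (∀ {s s′} → R s s′ → R (inl s) (inl s′)) →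
  (∀ {s s′} → R s s′ → R (inr s) (inr s′)) →
  (∀ {s s′} → R (inl s) (inr s′)) →
  (∀ {s s′} → R (inr s) (inl s′)) →
  ∀ {s s′} → s ≍ s′ → R s s′
≍-elim R v l a il ir lr rl = go
  where
  mutual
    go : ∀ {s s′} → s ≍ s′ → R s s′
    go var≍     = v _
    go (lam≍ p) = l (go p)
    go (app≍ p (mono≍ q)) = a (go p) (λ i j → All.lookup (All.lookup (go-rows q) i) j)
    go (inl≍ p) = il (go p)
    go (inr≍ p) = ir (go p)
    go inl-inr≍ = lr
    go inr-inl≍ = rl

    go-rows : ∀ {ts us} → All (λ t → All (t ≍_) us) ts → All (λ t → All (R t) us) ts
    go-rows []       = []
    go-rows (p ∷ ps) = go-row p ∷ go-rows ps

    go-row : ∀ {t us} → All (t ≍_) us → All (R t) us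
    go-row []       = []
    go-row (p ∷ ps) = go p ∷ go-row ps

-- Coherence under shifts, linear substitution and parallel reduction.

Clique : List Term → Set
Clique L = ∀ {t u} → t ∈ L → u ∈ L → t ≍ u

≍ₘ⇒Clique : ∀ {ts us} → ts ≍ₘ us → Clique (ts ++ us)
≍ₘ⇒Clique (mono≍ p) i j = All.lookup (All.lookup p i) j

Clique⇒≍ₘ : ∀ {ts us} → Clique (ts ++ us) → ts ≍ₘ us
Clique⇒≍ₘ h = mono≍ (All.tabulate (λ i → All.tabulate (λ j → h i j)))

union : ∀ {Q : Term → Term → Set} {x y ts us} →
  (∀ {z} → z ∈ x → ∃[ t ] t ∈ ts × Q z t) → (∀ {z} → z ∈ y → ∃[ u ] u ∈ us × Q z u) →
  ∀ {z} → z ∈ x ++ y → ∃[ t ] t ∈ ts ++ us × Q z t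
union {x = x} {ts = ts} f g i with ∈-++⁻ x i
... | inj₁ j with f j
...   | t , k , q = t , ∈-++⁺ˡ k , q
union {x = x} {ts = ts} f g i | inj₂ j with g j
...   | t , k , q = t , ∈-++⁺ʳ ts k , q

-- An operation that transforms bags entrywise preserves their coherence as soon as images of
-- coherent entries are coherent. `Q` links an entry of the result to its origin.
from-≍ₘ : ∀ {Q : Term → Term → Set} {x y ts us} →
  (∀ {z} → z ∈ x → ∃[ t ] t ∈ ts × Q z t) → (∀ {z} → z ∈ y → ∃[ u ] u ∈ us × Q z u) →
  (∀ {t u z w} → t ∈ ts ++ us → u ∈ ts ++ us → Q z t → Q w u → z ≍ w) → x ≍ₘ y
from-≍ₘ {Q} f g h = Clique⇒≍ₘ λ i j →
  let (_ , k , q) = union {Q} f g i; (_ , l , r) = union {Q} f g j in h k l q r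

∈-shiftM⁻ : ∀ c d ts {z} → z ∈ shiftM c d ts → ∃[ t ] t ∈ ts × z ≡ shift c d t
∈-shiftM⁻ c d (t ∷ ts) (here refl) = t , here refl , refl
∈-shiftM⁻ c d (t ∷ ts) (there i) with ∈-shiftM⁻ c d ts i
... | u , j , e = u , there j , e

≍-shift : ∀ {s t} → s ≍ t → ∀ c d → shift c d s ≍ shift c d t
≍-shift = ≍-elim (λ s t → ∀ c d → shift c d s ≍ shift c d t)
  var-case
  (λ h c d → lam≍ (h (suc c) d))
  (λ {_} {_} {ts} {ts′} h k c d → app≍ (h c d)
    (from-≍ₘ {λ z t → z ≡ shift c d t} (∈-shiftM⁻ c d ts) (∈-shiftM⁻ c d ts′)
      (λ { i j refl refl → k i j c d })))
  (λ h c d → inl≍ (h c d)) (λ h c d → inr≍ (h c d)) (λ c d → inl-inr≍) (λ c d → inr-inl≍)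
  where
  var-case : ∀ x c d → shift c d (var x) ≍ shift c d (var x)
  var-case x c d with x <ᵇ c
  ... | true  = var≍
  ... | false = var≍

∈-split2 : ∀ us {a b} → (a , b) ∈ split2 us → All (_∈ us) a × All (_∈ us) b
∈-split2 []       (here refl) = [] , []
∈-split2 (u ∷ us) i with ∈-split2-∷⁻ u us i
... | inj₁ (_ , j , refl) =
  here refl ∷ All.map there (proj₁ (∈-split2 us j)) , All.map there (proj₂ (∈-split2 us j))
... | inj₂ (_ , j , refl) =
  All.map there (proj₁ (∈-split2 us j)) , here refl ∷ All.map there (proj₂ (∈-split2 us j))

-- Both sides of a coherent pair are derived along different bags, and recursion splits these
-- further. A single clique that contains all their entries is stable under splitting and makes any
-- two inserted terms coherent.
module _ {L : List Term} (clique : Clique L) where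
  ∈-DM⁻ : ∀ k ts us {x z} → All (_∈ L) us → x ∈ DM k ts us → z ∈ x →
    ∃[ t ] t ∈ ts × ∃[ a ] All (_∈ L) a × z ∈ D k t a
  ∈-DM⁻ k []       []      us⊆L (here refl) ()
  ∈-DM⁻ k (t ∷ ts) us us⊆L i j with ∈-Bilinear⁻ _∷_ (split2 us) (D k t) (DM k ts) i
  ∈-DM⁻ k (t ∷ ts) us us⊆L i (here refl) | a , b , x , y , l , m , n , refl =
    t , here refl , a , All.map (All.lookup us⊆L) (proj₁ (∈-split2 us l)) , m
  ∈-DM⁻ k (t ∷ ts) us us⊆L i (there j) | a , b , x , y , l , m , n , refl
    with ∈-DM⁻ k ts b (All.map (All.lookup us⊆L) (proj₂ (∈-split2 us l))) n j
  ... | u , o , q = u , there o , q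

  DCoherent : Term → Term → Set
  DCoherent s s′ = ∀ k {us us′ x y} → All (_∈ L) us → All (_∈ L) us′ →
    x ∈ D k s us → y ∈ D k s′ us′ → x ≍ y

  ≍-D : ∀ {s s′} → s ≍ s′ → DCoherent s s′
  ≍-D = ≍-elim DCoherent var-case
    (λ {s} {s′} h → lam-case {s} {s′} h)
    (λ {s} {s′} {ts} {ts′} h h′ → app-case {s} {s′} {ts} {ts′} h h′)
    (λ {s} {s′} h → inl-case {s} {s′} h)
    (λ {s} {s′} h → inr-case {s} {s′} h)
    (λ {s} {s′} → lr-case {s} {s′})
    (λ {s} {s′} → rl-case {s} {s′})
    where
    var-case : ∀ z → DCoherent (var z) (var z)
    var-case z k {us} {us′} p q i j with cmp k z
    var-case z k {us} {us′} p q i j | lt r rewrite D-lt r us | D-lt r us′ with us | us′ | i | j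
    ... | [] | [] | here refl | here refl = var≍
    var-case z k {us} {us′} p q i j | eq rewrite D-eq k us | D-eq k us′
      with us | us′ | p | q | i | j
    ... | u ∷ [] | u′ ∷ [] | p ∷ [] | q ∷ [] | here refl | here refl = ≍-shift (clique p q) 0 k
    var-case z k {us} {us′} p q i j | gt r rewrite D-gt r us | D-gt r us′ with us | us′ | i | j
    ... | [] | [] | here refl | here refl = var≍
    lam-case : ∀ {s s′} → DCoherent s s′ → DCoherent (lam s) (lam s′)
    lam-case h k p q i j with ∈-map⁻ lam i | ∈-map⁻ lam j
    ... | _ , i , refl | _ , j , refl = lam≍ (h (suc k) p q i j)
    app-case : ∀ {s s′ ts ts′} → DCoherent s s′ →
      (∀ {t t′} → t ∈ ts ++ ts′ → t′ ∈ ts ++ ts′ → DCoherent t t′) →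
      DCoherent (app s ts) (app s′ ts′)
    app-case {s} {s′} {ts} {ts′} h h′ k {us} {us′} p q i j
      with ∈-Bilinear⁻ app (split2 us) (D k s) (DM k ts) i
         | ∈-Bilinear⁻ app (split2 us′) (D k s′) (DM k ts′) j
    ... | a , b , x , y , l , m , n , refl | a′ , b′ , x′ , y′ , l′ , m′ , n′ , refl = app≍
      (h k (All.map (All.lookup p) (proj₁ (∈-split2 us l)))
           (All.map (All.lookup q) (proj₁ (∈-split2 us′ l′))) m m′)
      (from-≍ₘ {λ z t → ∃[ a ] All (_∈ L) a × z ∈ D k t a}
        (∈-DM⁻ k ts b (All.map (All.lookup p) (proj₂ (∈-split2 us l))) n)
        (∈-DM⁻ k ts′ b′ (All.map (All.lookup q) (proj₂ (∈-split2 us′ l′))) n′)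
        (λ { i j (_ , p , m) (_ , q , n) → h′ i j k p q m n }))
    inl-case : ∀ {s s′} → DCoherent s s′ → DCoherent (inl s) (inl s′)
    inl-case h k p q i j with ∈-map⁻ inl i | ∈-map⁻ inl j
    ... | _ , i , refl | _ , j , refl = inl≍ (h k p q i j)
    inr-case : ∀ {s s′} → DCoherent s s′ → DCoherent (inr s) (inr s′)
    inr-case h k p q i j with ∈-map⁻ inr i | ∈-map⁻ inr j
    ... | _ , i , refl | _ , j , refl = inr≍ (h k p q i j)
    lr-case : ∀ {s s′} → DCoherent (inl s) (inr s′)
    lr-case k p q i j with ∈-map⁻ inl i | ∈-map⁻ inr j
    ... | _ , i , refl | _ , j , refl = inl-inr≍
    rl-case : ∀ {s s′} → DCoherent (inr s) (inl s′)
    rl-case k p q i j with ∈-map⁻ inr i | ∈-map⁻ inl j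
    ... | _ , i , refl | _ , j , refl = inr-inl≍

≍-lam′ : ∀ {s s′} → s ≍ s′ → lam′ s ≍ lam′ s′
≍-lam′ var≍       = lam≍ var≍
≍-lam′ (lam≍ p)   = lam≍ (lam≍ p)
≍-lam′ (app≍ p q) = lam≍ (app≍ p q)
≍-lam′ (inl≍ p)   = inl≍ (lam≍ p)
≍-lam′ (inr≍ p)   = inr≍ (lam≍ p)
≍-lam′ inl-inr≍   = inl-inr≍
≍-lam′ inr-inl≍   = inr-inl≍

≍-app′ : ∀ {s s′ ts ts′ x y} → s ≍ s′ → ts ≍ₘ ts′ → x ∈ app′ s ts → y ∈ app′ s′ ts′ → x ≍ y
≍-app′ var≍       q (here refl) (here refl) = app≍ var≍ q
≍-app′ (app≍ p r) q (here refl) (here refl) = app≍ (app≍ p r) q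
≍-app′ {ts = ts} (lam≍ p) q i j = ≍-D (≍ₘ⇒Clique q) p 0
  (All.tabulate (λ k → ∈-++⁺ˡ k)) (All.tabulate (λ k → ∈-++⁺ʳ ts k)) i j
≍-app′ (inl≍ p)   q (here refl) (here refl) = inl≍ (app≍ p q)
≍-app′ (inr≍ p)   q (here refl) (here refl) = inr≍ (app≍ p q)
≍-app′ inl-inr≍   q (here refl) (here refl) = inl-inr≍
≍-app′ inr-inl≍   q (here refl) (here refl) = inr-inl≍

∈-PM⁻ : ∀ ts {x z} → x ∈ PM ts → z ∈ x → ∃[ t ] t ∈ ts × z ∈ P t
∈-PM⁻ []       (here refl) ()
∈-PM⁻ (t ∷ ts) i j with ∈-PM-∷ t ts i
∈-PM⁻ (t ∷ ts) i (here refl) | x , y , l , m , refl = t , here refl , l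
∈-PM⁻ (t ∷ ts) i (there j)   | x , y , l , m , refl with ∈-PM⁻ ts m j
... | u , k , n = u , there k , n

≍-P : ∀ {s s′} → s ≍ s′ → ∀ {x y} → x ∈ P s → y ∈ P s′ → x ≍ y
≍-P = ≍-elim (λ s s′ → ∀ {x y} → x ∈ P s → y ∈ P s′ → x ≍ y)
  (λ { x (here refl) (here refl) → var≍ })
  (λ h i j → lam-case h (∈-map⁻ lam′ i) (∈-map⁻ lam′ j))
  (λ {s} {s′} {ts} {ts′} h h′ i j → app-case ts ts′ h h′ (∈-P-app s ts i) (∈-P-app s′ ts′ j))
  (λ h i j → inl-case h (∈-map⁻ inl i) (∈-map⁻ inl j))
  (λ h i j → inr-case h (∈-map⁻ inr i) (∈-map⁻ inr j))
  (λ i j → lr-case (∈-map⁻ inl i) (∈-map⁻ inr j))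
  (λ i j → rl-case (∈-map⁻ inr i) (∈-map⁻ inl j))
  where
  From : (Term → Term) → List Term → Term → Set
  From c L x = ∃[ x′ ] x′ ∈ L × x ≡ c x′
  lam-case : ∀ {L M x y} → (∀ {x y} → x ∈ L → y ∈ M → x ≍ y) → From lam′ L x → From lam′ M y → x ≍ y
  lam-case h (_ , i , refl) (_ , j , refl) = ≍-lam′ (h i j)
  inl-case : ∀ {L M x y} → (∀ {x y} → x ∈ L → y ∈ M → x ≍ y) → From inl L x → From inl M y → x ≍ y
  inl-case h (_ , i , refl) (_ , j , refl) = inl≍ (h i j)
  inr-case : ∀ {L M x y} → (∀ {x y} → x ∈ L → y ∈ M → x ≍ y) → From inr L x → From inr M y → x ≍ y
  inr-case h (_ , i , refl) (_ , j , refl) = inr≍ (h i j)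
  lr-case : ∀ {L M x y} → From inl L x → From inr M y → x ≍ y
  lr-case (_ , i , refl) (_ , j , refl) = inl-inr≍
  rl-case : ∀ {L M x y} → From inr L x → From inl M y → x ≍ y
  rl-case (_ , i , refl) (_ , j , refl) = inr-inl≍
  Apps : List Term → Monomial → Term → Set
  Apps L ts z = ∃[ x ] ∃[ y ] x ∈ L × y ∈ PM ts × z ∈ app′ x y
  app-case : ∀ {L M x y} ts ts′ → (∀ {x y} → x ∈ L → y ∈ M → x ≍ y) →
    (∀ {t t′} → t ∈ ts ++ ts′ → t′ ∈ ts ++ ts′ → ∀ {x y} → x ∈ P t → y ∈ P t′ → x ≍ y) →
    Apps L ts x → Apps M ts′ y → x ≍ y
  app-case ts ts′ h h′ (_ , _ , i , j , k) (_ , _ , l , m , n) =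
    ≍-app′ (h i l) (from-≍ₘ {λ z t → z ∈ P t} (∈-PM⁻ ts j) (∈-PM⁻ ts′ m) (λ i j → h′ i j)) k n

-- The uniformity identity.

mutual
  -- A shift is injective on variables and keeps every constructor.
  iso-shift : ∀ c d s t → iso (shift c d s) (shift c d t) ≡ iso s t
  iso-shift c d (var x) (var y) with x <? c | y <? c
  ... | yes p | yes q rewrite shift-< d p | shift-< d q = refl
  ... | yes p | no q  rewrite shift-< d p | shift-≥ d (≮⇒≥ q)
    | ≡ᵇ-false (<⇒≢ (<-≤-trans p (≤-trans (≮⇒≥ q) (m≤m+n y d))))
    | ≡ᵇ-false (<⇒≢ (<-≤-trans p (≮⇒≥ q))) = refl
  ... | no p  | yes q rewrite shift-≥ d (≮⇒≥ p) | shift-< d q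
    | ≡ᵇ-false (λ e → <⇒≢ (<-≤-trans q (≤-trans (≮⇒≥ p) (m≤m+n x d))) (sym e))
    | ≡ᵇ-false (λ e → <⇒≢ (<-≤-trans q (≮⇒≥ p)) (sym e)) = refl
  ... | no p  | no q  rewrite shift-≥ d (≮⇒≥ p) | shift-≥ d (≮⇒≥ q) | +-comm x d | +-comm y d =
    cong (if_then 1 else 0) (cancel d)
    where
    cancel : ∀ d → (d + x ≡ᵇ d + y) ≡ (x ≡ᵇ y)
    cancel zero    = refl
    cancel (suc d) = cancel d
  iso-shift c d (lam s)    (lam t)    = iso-shift (suc c) d s t
  iso-shift c d (app s ss) (app t ts) = cong₂ _*_ (iso-shift c d s t) (isoM-shift c d ss ts)
  iso-shift c d (inl s)    (inl t)    = iso-shift c d s t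
  iso-shift c d (inr s)    (inr t)    = iso-shift c d s t
  iso-shift c d (var x)    (lam t)    with x <ᵇ c
  ... | true  = refl
  ... | false = refl
  iso-shift c d (var x)    (app t ts) with x <ᵇ c
  ... | true  = refl
  ... | false = refl
  iso-shift c d (var x)    (inl t)    with x <ᵇ c
  ... | true  = refl
  ... | false = refl
  iso-shift c d (var x)    (inr t)    with x <ᵇ c
  ... | true  = refl
  ... | false = refl
  iso-shift c d (lam s)    (var y)    with y <ᵇ c
  ... | true  = refl
  ... | false = refl
  iso-shift c d (app s ss) (var y)    with y <ᵇ c
  ... | true  = refl
  ... | false = refl
  iso-shift c d (inl s)    (var y)    with y <ᵇ c
  ... | true  = refl
  ... | false = refl
  iso-shift c d (inr s)    (var y)    with y <ᵇ c
  ... | true  = refl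
  ... | false = refl
  iso-shift c d (lam s)    (app t ts) = refl
  iso-shift c d (lam s)    (inl t)    = refl
  iso-shift c d (lam s)    (inr t)    = refl
  iso-shift c d (app s ss) (lam t)    = refl
  iso-shift c d (app s ss) (inl t)    = refl
  iso-shift c d (app s ss) (inr t)    = refl
  iso-shift c d (inl s)    (lam t)    = refl
  iso-shift c d (inl s)    (app t ts) = refl
  iso-shift c d (inl s)    (inr t)    = refl
  iso-shift c d (inr s)    (lam t)    = refl
  iso-shift c d (inr s)    (app t ts) = refl
  iso-shift c d (inr s)    (inl t)    = refl

  isoM-shift : ∀ c d ss ts → isoM (shiftM c d ss) (shiftM c d ts) ≡ isoM ss ts
  isoM-shift c d []       []      = refl
  isoM-shift c d []       (_ ∷ _) = refl
  isoM-shift c d (s ∷ ss) ts      = pick-shiftM ts ∙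
    ∑-cong (pick ts) (λ (t , ts′) → cong₂ _*_ (iso-shift c d s t) (isoM-shift c d ss ts′))
    where
    pick-shiftM : ∀ ts {f} →
      ∑ (pick (shiftM c d ts)) f ≡ ∑ (pick ts) (λ (t , ts′) → f (shift c d t , shiftM c d ts′))
    pick-shiftM []       = refl
    pick-shiftM (t ∷ ts) {f} = ∑-pick-∷ (shift c d t) (shiftM c d ts) ∙
      cong (f (shift c d t , shiftM c d ts) +_) (pick-shiftM ts) ∙ sym (∑-pick-∷ t ts)

-- Membership in `DM` fixes splittings of us as a list. Taking an entry out of the middle of the
-- derived bag reorders the shares, hence us is recorded only up to permutation.
data DerivedBag (k : ℕ) : Monomial → List Term → Monomial → Set where
  []  : DerivedBag k [] [] []
  cons : ∀ {t ts us a b x xs} →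
    x ∈ D k t a → DerivedBag k ts b xs → us ↭ a ++ b → DerivedBag k (t ∷ ts) us (x ∷ xs)

∈-DM⇒DerivedBag : ∀ k ts us {x} → x ∈ DM k ts us → DerivedBag k ts us x
∈-DM⇒DerivedBag k []       []  (here refl) = []
∈-DM⇒DerivedBag k (t ∷ ts) us i with ∈-Bilinear⁻ _∷_ (split2 us) (D k t) (DM k ts) i
... | a , b , x , y , j , l , m , refl = cons l (∈-DM⇒DerivedBag k ts b m) (∈-split2-↭ us j)

-- Positions of c correspond to positions of ts: the chosen entry comes with its own share a of us,
-- and the remaining bag is derived along the rest b.
pick-DerivedBag : ∀ {k ts us c} → DerivedBag k ts us c → {g h : Term × Monomial → ℕ} →
  (∀ {t ts′ v c′ a b} → (t , ts′) ∈ pick ts → v ∈ D k t a → DerivedBag k ts′ b c′ → us ↭ a ++ b →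
    g (v , c′) ≡ h (t , ts′)) →
  ∑ (pick c) g ≡ ∑ (pick ts) h
pick-DerivedBag [] H = refl
pick-DerivedBag (cons {t} {ts} {a = a} {xs = xs} i r p) H =
  ∑-pick-∷ _ xs ∙
  cong₂ _+_ (H (here refl) i r p)
    (pick-DerivedBag r (λ {_} {_} {_} {_} {a′} {b′} j l r′ p′ →
      H (there (∈-map⁺ _ j)) l (cons i r′ refl)
      (↭-trans p (↭-trans (++⁺ˡ a p′) (shifts a a′))))) ∙
  sym (∑-pick-∷ t ts)

∈-pick-⊆ : ∀ {x : A} {xs′} xs → (x , xs′) ∈ pick xs → x ∈ xs × (∀ {y} → y ∈ xs′ → y ∈ xs)
∈-pick-⊆ {x = x} xs i with ∈-pick⁻ xs i
... | l₁ , l₂ , refl , refl = ∈-++⁺ʳ l₁ (here refl) ,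
  λ j → [ ∈-++⁺ˡ , (λ k → ∈-++⁺ʳ l₁ (there k)) ]′ (∈-++⁻ l₁ j)

Coherent : List Term → List Term → Set
Coherent ts us = ∀ {t u} → t ∈ ts → u ∈ us → t ≍ u

≍ₘ⇒Coherent : ∀ {ts us} → ts ≍ₘ us → Coherent ts us
≍ₘ⇒Coherent {ts} p i j = ≍ₘ⇒Clique p (∈-++⁺ˡ i) (∈-++⁺ʳ ts j)

-- Laplace expansion with constant factors: b was built with us₀ distributed as a and b, and summing
-- over all distributions of us recovers the whole permanent.
split-iso : ∀ us {a b us₀} m n → us₀ ↭ a ++ b →
  ∑ (split2 us) (λ (u , v) → (m * isoM u a) * (n * isoM v b)) ≡ m * n * isoM us us₀
split-iso us {a} {b} m n p =
  ∑-cong (split2 us) (λ (u , v) → *-exchange m (isoM u a) n (isoM v b)) ∙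
  ∑-*ˡ (m * n) (split2 us) ∙
  cong (m * n *_) (isoM-split us a b ∙ sym (isoM-↭ʳ us p))

only-iso : ∀ y us → ∑ (only us (var y)) (λ x → iso x (var y)) ≡ isoM us [] + 0
only-iso y []       rewrite ≡ᵇ-refl y = refl
only-iso y (_ ∷ us) = refl

-- The left-hand side is m(b) times the coefficient of b in ∂ s · us. Since the
-- right-hand side vanishes unless s ≈ s₀ and us ≈ us₀, this also says that b
-- determines the derivative it comes from.
mutual
  D-iso : ∀ k {s s₀} us us₀ {b} → s ≍ s₀ → b ∈ D k s₀ us₀ →
    ∑ (D k s us) (λ x → iso x b) ≡ iso s s₀ * isoM us us₀
  D-iso k {var y} us us₀ {b} var≍ i with cmp k y
  ... | lt p rewrite D-lt p us | D-lt p us₀ | ≡ᵇ-refl y with us₀ | i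
  ...   | [] | here refl = only-iso y us
  D-iso k {var y} us us₀ {b} var≍ i | eq rewrite D-eq k us | D-eq k us₀ | ≡ᵇ-refl k with us₀ | i
  ...   | u₀ ∷ [] | here refl = hits us
    where
    hits : ∀ us → ∑ (hit k us) (λ x → iso x (shift 0 k u₀)) ≡ isoM us (u₀ ∷ []) + 0
    hits []          = refl
    hits (u ∷ [])    = cong (_+ 0) (iso-shift 0 k u u₀ ∙ sym (*-identityʳ _)) ∙ sym (+-identityʳ _)
    hits (u ∷ v ∷ us) = sym (+-identityʳ _ ∙ +-identityʳ _ ∙ *-zeroʳ (iso u u₀))
  D-iso k {var (suc y)} us us₀ {b} var≍ i | gt p rewrite D-gt p us | D-gt p us₀ | ≡ᵇ-refl y
    with us₀ | i
  ...   | [] | here refl = only-iso y us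
  D-iso k {lam s} {lam s₀} us us₀ (lam≍ p) i with ∈-map⁻ lam i
  ... | b , j , refl = ∑-map lam (D (suc k) s us) ∙ D-iso (suc k) us us₀ p j
  D-iso k {inl s} {inl s₀} us us₀ (inl≍ p) i with ∈-map⁻ inl i
  ... | b , j , refl = ∑-map inl (D k s us) ∙ D-iso k us us₀ p j
  D-iso k {inr s} {inr s₀} us us₀ (inr≍ p) i with ∈-map⁻ inr i
  ... | b , j , refl = ∑-map inr (D k s us) ∙ D-iso k us us₀ p j
  -- Nothing is known about s and s₀ here, but opposite injections survive the derivative, so both
  -- sides are zero.
  D-iso k {inl s} {inr s₀} us us₀ inl-inr≍ i with ∈-map⁻ inr i
  ... | b , j , refl = ∑-map inl (D k s us) ∙ ∑-zero (D k s us)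
  D-iso k {inr s} {inl s₀} us us₀ inr-inl≍ i with ∈-map⁻ inl i
  ... | b , j , refl = ∑-map inr (D k s us) ∙ ∑-zero (D k s us)
  D-iso k {app s ts} {app s₀ ts₀} us us₀ (app≍ p q) i
    with ∈-Bilinear⁻ app (split2 us₀) (D k s₀) (DM k ts₀) i
  ... | a , b , x , y , j , l , m , refl =
    ∑-D-app k s ts us ∙
    ∑-cong (split2 us) (λ (u , v) → ∑-* (D k s u) (DM k ts v) ∙
      cong₂ _*_ (D-iso k u a p l)
        (DM-iso k ts v (≍ₘ⇒Coherent q) (∈-DM⇒DerivedBag k ts₀ b m))) ∙
    split-iso us (iso s s₀) (isoM ts ts₀) (∈-split2-↭ us₀ j)

  DM-iso : ∀ k ts {ts₀} us {us₀ c} → Coherent ts ts₀ → DerivedBag k ts₀ us₀ c →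
    ∑ (DM k ts us) (λ x → isoM x c) ≡ isoM ts ts₀ * isoM us us₀
  DM-iso k []       []       coh []           = refl
  DM-iso k []       (_ ∷ us) coh []           = refl
  DM-iso k []       []       coh (cons _ _ _) = refl
  DM-iso k []       (_ ∷ us) coh (cons _ _ _) = refl
  DM-iso k (t ∷ ts) {ts₀} us {us₀} {c} coh r = begin
    ∑ (DM k (t ∷ ts) us) (λ x → isoM x c)
      ≡⟨ ∑-DM-∷ k t ts us ⟩
    (∑ (split2 us) λ (a , b) → ∑ (D k t a) λ x → ∑ (DM k ts b) λ y →
      ∑ (pick c) λ (v , c′) → iso x v * isoM y c′)
      ≡⟨ ∑-cong (split2 us) (λ (a , b) →
           ∑-cong (D k t a) (λ x → ∑-swap (DM k ts b) (pick c)) ∙ ∑-swap (D k t a) (pick c)) ∙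
         ∑-swap (split2 us) (pick c) ⟩
    (∑ (pick c) λ (v , c′) → ∑ (split2 us) λ (a , b) →
      ∑ (D k t a) λ x → ∑ (DM k ts b) λ y → iso x v * isoM y c′)
      -- The entry v derives from t₀ along a₀ and c′ from the other entries along b₀, so both
      -- identities apply by recursion. Their product always contains the factor `isoM us us₀`,
      -- whatever v was chosen.
      ≡⟨ pick-DerivedBag r (λ {t₀} {ts₀′} {v} {c′} {a₀} {b₀} i j r′ p →
           ∑-cong (split2 us) (λ (a , b) → ∑-* (D k t a) (DM k ts b) ∙
             cong₂ _*_ (D-iso k a a₀ (coh (here refl) (proj₁ (∈-pick-⊆ ts₀ i))) j)
               (DM-iso k ts b (λ l m → coh (there l) (proj₂ (∈-pick-⊆ ts₀ i) m)) r′)) ∙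
           split-iso us (iso t t₀) (isoM ts ts₀′) p) ⟩
    ∑ (pick ts₀) (λ (t₀ , ts₀′) → iso t t₀ * isoM ts ts₀′ * isoM us us₀)
      ≡⟨ ∑-*ʳ (isoM us us₀) (pick ts₀) ⟩
    isoM (t ∷ ts) ts₀ * isoM us us₀ ∎
    where open ≡-Reasoning

lam′-iso : ∀ {s s₀} → s ≍ s₀ → iso (lam′ s) (lam′ s₀) ≡ iso s s₀
lam′-iso var≍       = refl
lam′-iso (lam≍ p)   = refl
lam′-iso (app≍ p q) = refl
lam′-iso (inl≍ p)   = refl
lam′-iso (inr≍ p)   = refl
lam′-iso inl-inr≍   = refl
lam′-iso inr-inl≍   = refl

app′-iso : ∀ {s s₀} ts ts₀ {b} → s ≍ s₀ → b ∈ app′ s₀ ts₀ →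
  ∑ (app′ s ts) (λ x → iso x b) ≡ iso s s₀ * isoM ts ts₀
app′-iso ts ts₀ var≍       (here refl) = +-identityʳ _
app′-iso ts ts₀ (app≍ p q) (here refl) = +-identityʳ _
app′-iso ts ts₀ (lam≍ p)   i           = D-iso 0 ts ts₀ p i
app′-iso ts ts₀ (inl≍ p)   (here refl) = +-identityʳ _
app′-iso ts ts₀ (inr≍ p)   (here refl) = +-identityʳ _
app′-iso ts ts₀ inl-inr≍   (here refl) = refl
app′-iso ts ts₀ inr-inl≍   (here refl) = refl

pick-PM : ∀ ts {c} → c ∈ PM ts → {g h : Term × Monomial → ℕ} →
  (∀ {t ts′ v c′} → (t , ts′) ∈ pick ts → v ∈ P t → c′ ∈ PM ts′ → g (v , c′) ≡ h (t , ts′)) →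
  ∑ (pick c) g ≡ ∑ (pick ts) h
pick-PM []       (here refl) H = refl
pick-PM (t ∷ ts) i H with ∈-PM-∷ t ts i
... | x , y , j , l , refl = ∑-pick-∷ x y ∙
  cong₂ _+_ (H (here refl) j l)
    (pick-PM ts l (λ {t′} {ts′} m n o → H (there (∈-map⁺ _ m)) n
      (∈-concatMap⁺ (λ z → map (z ∷_) (PM ts′)) (lose j (∈-map⁺ (x ∷_) o))))) ∙
  sym (∑-pick-∷ t ts)

mutual
  -- The reduced parts are coherent by `≍-P`. At the root, then, the same rule fires on both sides,
  -- or the parts are opposite injections and contribute zero.
  P-iso : ∀ {s s₀ b} → s ≍ s₀ → b ∈ P s₀ → ∑ (P s) (λ x → iso x b) ≡ iso s s₀
  P-iso var≍ (here refl) = +-identityʳ _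
  P-iso (lam≍ {s} {s₀} p) i with ∈-map⁻ lam′ i
  ... | y , j , refl = ∑-map lam′ (P s) ∙
    ∑-cong-∈ (P s) (λ l → lam′-iso (≍-P p l j)) ∙ P-iso p j
  P-iso (inl≍ {s} p) i with ∈-map⁻ inl i
  ... | y , j , refl = ∑-map inl (P s) ∙ P-iso p j
  P-iso (inr≍ {s} p) i with ∈-map⁻ inr i
  ... | y , j , refl = ∑-map inr (P s) ∙ P-iso p j
  P-iso (inl-inr≍ {s}) i with ∈-map⁻ inr i
  ... | y , j , refl = ∑-map inl (P s) ∙ ∑-zero (P s)
  P-iso (inr-inl≍ {s}) i with ∈-map⁻ inl i
  ... | y , j , refl = ∑-map inr (P s) ∙ ∑-zero (P s)
  P-iso {app s ts} {app s₀ ts₀} (app≍ p q) i with ∈-P-app s₀ ts₀ i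
  ... | x₀ , y₀ , j , l , m = ∑-P-app s ts ∙
    ∑-cong-∈ (P s) (λ n → ∑-cong (PM ts) (λ y → app′-iso y y₀ (≍-P p n j) m)) ∙
    ∑-* (P s) (PM ts) ∙
    cong₂ _*_ (P-iso p j) (PM-iso ts (≍ₘ⇒Coherent q) l)

  PM-iso : ∀ ts {ts₀ c} → Coherent ts ts₀ → c ∈ PM ts₀ →
    ∑ (PM ts) (λ x → isoM x c) ≡ isoM ts ts₀
  PM-iso [] {[]}      coh (here refl) = refl
  PM-iso [] {t ∷ ts₀} coh i with ∈-PM-∷ t ts₀ i
  ... | _ , _ , _ , _ , refl = refl
  PM-iso (t ∷ ts) {ts₀} {c} coh i = ∑-PM-∷ t ts ∙
    ∑-cong (P t) (λ x → ∑-swap (PM ts) (pick c)) ∙ ∑-swap (P t) (pick c) ∙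
    pick-PM ts₀ i (λ j l m → ∑-* (P t) (PM ts) ∙
      cong₂ _*_ (P-iso (coh (here refl) (proj₁ (∈-pick-⊆ ts₀ j))) l)
        (PM-iso ts (λ n o → coh (there n) (proj₂ (∈-pick-⊆ ts₀ j) o)) m))

-- Two accessibility proofs are carried because one term may become normal before the other; each
-- round of `P` decreases at least one of them.
W-coherent : ∀ b {s s₀} → Acc _≺_ s → Acc _≺_ s₀ → s ≍ s₀ →
  0 < W (λ x → iso x b) s₀ → W (λ x → iso x b) s ≡ iso s s₀
W-coherent b {s} {s₀} (acc rec) (acc rec₀) p pos = cases (progress s) (progress s₀)
  where
  g : Term → ℕ
  g x = iso x b
  reduce : (∀ {x x₀} → x ∈ P s → x₀ ∈ P s₀ → 0 < W g x₀ → W g x ≡ iso x x₀) → W g s ≡ iso s s₀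
  -- Positivity selects one reduct x₀ whose normal form contains b. All reducts of s are compared
  -- with this same x₀, which leaves precisely the sum evaluated by `P-iso`.
  reduce ih with 0<∑ (P s₀) (subst (0 <_) (P-Inv s₀ (W-Inv g)) pos)
  ... | x₀ , i₀ , pos₀ = P-Inv s (W-Inv g) ∙ ∑-cong-∈ (P s) (λ i → ih i i₀ pos₀) ∙ P-iso p i₀
  cases : Progress s → Progress s₀ → W g s ≡ iso s s₀
  -- The normal form of s₀ is s₀ alone, so positivity means that s₀ ≈ b.
  cases (inj₁ (n , _)) (inj₁ (n₀ , _)) = W-normal g n ∙
    iso-sym s b ∙ sym (iso-≈ (0<iso⇒≈ s₀ b (subst (0 <_) (W-normal g n₀) pos)) s) ∙ iso-sym s₀ s
  cases (inj₁ (_ , e)) (inj₂ (dec₀ , _)) = reduce go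
    where
    go : ∀ {x x₀} → x ∈ P s → x₀ ∈ P s₀ → 0 < W g x₀ → W g x ≡ iso x x₀
    go {x} {x₀} i i₀ with here refl ← subst (x ∈_) e i =
      W-coherent b (acc rec) (rec₀ (dec₀ i₀)) (≍-P p i i₀)
  cases (inj₂ (dec , _)) (inj₁ (_ , e₀)) = reduce go
    where
    go : ∀ {x x₀} → x ∈ P s → x₀ ∈ P s₀ → 0 < W g x₀ → W g x ≡ iso x x₀
    go {x} {x₀} i i₀ with here refl ← subst (x₀ ∈_) e₀ i₀ =
      W-coherent b (rec (dec i)) (acc rec₀) (≍-P p i i₀)
  cases (inj₂ (dec , _)) (inj₂ (dec₀ , _)) = reduce λ i i₀ →
    W-coherent b (rec (dec i)) (rec₀ (dec₀ i₀)) (≍-P p i i₀)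

-- Multiplicity as the number of automorphisms.

∑-pick-replicate : ∀ n (x : A) {f} →
  ∑ (pick (replicate (suc n) x)) f ≡ suc n * f (x , replicate n x)
∑-pick-replicate zero    x = refl
∑-pick-replicate (suc n) x {f} = ∑-pick-∷ x (replicate (suc n) x) {f} ∙
  cong (f (x , replicate (suc n) x) +_) (∑-pick-replicate n x {λ (y , ys) → f (y , x ∷ ys)})

-- A row of t meets its n equal columns with the same contribution and every other column with zero;
-- iterating gives the factorial.
isoM-replicate : ∀ n t us → (∀ {u} → u ∈ us → iso t u ≡ 0) →
  isoM (replicate n t ++ us) (replicate n t ++ us) ≡ n ! * iso t t ^ n * isoM us us
isoM-replicate zero    t us h = sym (+-identityʳ _)
isoM-replicate (suc n) t us h = begin
  ∑ (pick (tⁿ⁺¹ ++ us)) (λ (v , vs) → iso t v * isoM (tⁿ ++ us) vs)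
    ≡⟨ ∑-pick-++ tⁿ⁺¹ us ⟩
  ∑ (pick tⁿ⁺¹) (λ (v , vs) → iso t v * isoM (tⁿ ++ us) (vs ++ us)) +
  ∑ (pick us) (λ (v , vs) → iso t v * isoM (tⁿ ++ us) (tⁿ⁺¹ ++ vs))
    ≡⟨ cong₂ _+_ (∑-pick-replicate n t)
         (∑-cong-∈ (pick us) (λ {(v , vs)} i → cong (_* isoM (tⁿ ++ us) (tⁿ⁺¹ ++ vs))
            (h (proj₁ (∈-pick-⊆ us i)))) ∙ ∑-zero (pick us)) ⟩
  suc n * (iso t t * isoM (tⁿ ++ us) (tⁿ ++ us)) + 0
    ≡⟨ cong (λ m → suc n * (iso t t * m) + 0) (isoM-replicate n t us h) ⟩
  suc n * (iso t t * (n ! * iso t t ^ n * isoM us us)) + 0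
    ≡⟨ rearrange (suc n) (iso t t) (n !) (iso t t ^ n) (isoM us us) ⟩
  (suc n) ! * iso t t ^ suc n * isoM us us ∎
  where
  open ≡-Reasoning
  tⁿ tⁿ⁺¹ : List Term
  tⁿ   = replicate n t
  tⁿ⁺¹ = replicate (suc n) t
  rearrange : ∀ a b c d e → a * (b * (c * d * e)) + 0 ≡ a * c * (b * d) * e
  rearrange = solve-∀

blocks : List Block → Monomial
blocks = concatMap (λ b → replicate (cnt b) (tm b))

∈-replicate⁻ : ∀ n {x y : A} → y ∈ replicate n x → y ≡ x
∈-replicate⁻ (suc n) (here e)  = e
∈-replicate⁻ (suc n) (there i) = ∈-replicate⁻ n i

≉⇒iso≡0 : ∀ s t → ¬ s ≈ t → iso s t ≡ 0
≉⇒iso≡0 s t h with iso s t in e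
... | zero  = refl
... | suc n = ⊥-elim (h (0<iso⇒≈ s t (subst (0 <_) (sym e) (s≤s z≤n))))

isoM-blocks : ∀ bs → AllPairs (λ b b′ → ¬ (tm b ≈ tm b′)) bs →
  All (λ b → iso (tm b) (tm b) ≡ mul b) bs →
  isoM (blocks bs) (blocks bs) ≡ product (map (λ b → (cnt b !) * (mul b ^ cnt b)) bs)
isoM-blocks []       []       []       = refl
isoM-blocks (b ∷ bs) (d ∷ ds) (e ∷ es) = isoM-replicate (cnt b) (tm b) (blocks bs) apart ∙
  cong₂ _*_ (cong (λ m → cnt b ! * m ^ cnt b) e) (isoM-blocks bs ds es)
  where
  apart : ∀ {u} → u ∈ blocks bs → iso (tm b) u ≡ 0
  apart i with find (∈-concatMap⁻ (λ b → replicate (cnt b) (tm b)) {xs = bs} i)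
  ... | b′ , j , k with refl ← ∈-replicate⁻ (cnt b′) k = ≉⇒iso≡0 (tm b) (tm b′) (All.lookup d j)

isoM-≈-refl : ∀ {us vs} → us ≈ₘ vs → isoM us us ≡ isoM vs vs
isoM-≈-refl {us} {vs} p = isoM-≈ p us ∙ isoM-sym vs us ∙ isoM-≈ p vs

mutual
  -- In a bag, distinct blocks make the matrix block diagonal. Since `isoM` respects `_≈ₘ_`, the
  -- chosen block decomposition and its representatives do not influence the value.
  Mult⇒iso : ∀ {s μ} → Mult s μ → iso s s ≡ μ
  Mult⇒iso (mvar {x}) rewrite ≡ᵇ-refl x = refl
  Mult⇒iso (mlam p)   = Mult⇒iso p
  Mult⇒iso (mapp p q) = cong₂ _*_ (Mult⇒iso p) (MultM⇒isoM q)
  Mult⇒iso (minl p)   = Mult⇒iso p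
  Mult⇒iso (minr p)   = Mult⇒iso p

  MultM⇒isoM : ∀ {ts μ} → MultM ts μ → isoM ts ts ≡ μ
  MultM⇒isoM (mmono bs ds _ ms p) = isoM-≈-refl p ∙ isoM-blocks bs ds (Mults⇒iso ms)

  Mults⇒iso : ∀ {bs} → All (λ b → Mult (tm b) (mul b)) bs → All (λ b → iso (tm b) (tm b) ≡ mul b) bs
  Mults⇒iso []       = []
  Mults⇒iso (m ∷ ms) = Mult⇒iso m ∷ Mults⇒iso ms

-- Transfer to bags and formal sums.

-- ⟨x⟩[-] creates no redex and has multiplicity 1, so bags are reduced to terms.
embed : (σ : Sort) → Exp σ → Term
embed term s  = s
embed mono ts = app (var 0) ts

embed-step : ∀ σ {e E} → StepE σ e E → embed σ e ⟶ map (embed σ) E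
embed-step term {E = E} p = subst (_ ⟶_) (sym (map-id E)) p
embed-step mono p = ctx-arg p

embed-normal : ∀ σ {N x} → Normal σ N → x ∈ N → Normalᵗ (embed σ x)
embed-normal term n i p with ∈-∃++ i
... | _ , _ , refl = n (sum-step p)
embed-normal mono n i (ctx-arg p) with ∈-∃++ i
... | _ , _ , refl = n (sum-step p)

embed-≍ : ∀ σ {e e′} → CohE σ e e′ → embed σ e ≍ embed σ e′
embed-≍ term p = p
embed-≍ mono p = app≍ var≍ p

embed-≈ : ∀ σ {e e′} → EqE σ e e′ → embed σ e ≈ embed σ e′
embed-≈ term p = p
embed-≈ mono p = app≈ var≈ p

embed-≈⁻ : ∀ σ {e e′} → embed σ e ≈ embed σ e′ → EqE σ e e′
embed-≈⁻ term p          = p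
embed-≈⁻ mono (app≈ _ p) = p

embed-Mult : ∀ σ {e μ} → MultE σ e μ → iso (embed σ e) (embed σ e) ≡ μ
embed-Mult term m = Mult⇒iso m
embed-Mult mono m = +-identityʳ _ ∙ MultM⇒isoM m

-- This connects an arbitrary reduction of sums with the chosen normal forms: an invariant
-- functional has the same value all along it.
StepΣ-∑ : ∀ σ {f E E′} → (∀ s → Inv f s) → StepΣ σ E E′ →
  ∑ E (λ e → f (embed σ e)) ≡ ∑ E′ (λ e → f (embed σ e))
StepΣ-∑ σ {f} h (sum-step {F₁} {e} {F₂} {E′} p) =
  ∑-++ F₁ ∙ cong (∑ F₁ _ +_)
    (cong (_+ ∑ F₂ _) (h (embed σ e) (embed-step σ p) ∙ ∑-map (embed σ) E′) ∙
    sym (∑-++ E′)) ∙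
  sym (∑-++ F₁)

StepΣ*-∑ : ∀ σ {f E E′} → (∀ s → Inv f s) → StepΣ* σ E E′ →
  ∑ E (λ e → f (embed σ e)) ≡ ∑ E′ (λ e → f (embed σ e))
StepΣ*-∑ σ h ε        = refl
StepΣ*-∑ σ h (p ◅ ps) = StepΣ-∑ σ h p ∙ StepΣ*-∑ σ h ps

-- Entries equal to e all contribute the same number of automorphisms and the others contribute
-- zero, so coefficients are read off without any division.
Coef⇒∑ : ∀ σ {E e k} → Coef σ E e k →
  ∑ E (λ x → iso (embed σ x) (embed σ e)) ≡ k * iso (embed σ e) (embed σ e)
Coef⇒∑ σ c-nil = refl
Coef⇒∑ σ {e = e} (c-yes p c) = cong₂ _+_ (iso-≈ (embed-≈ σ p) (embed σ e)) (Coef⇒∑ σ c)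
Coef⇒∑ σ {e = e} (c-no {x} p c) =
  cong₂ _+_ (≉⇒iso≡0 (embed σ x) (embed σ e) (p ∘ embed-≈⁻ σ)) (Coef⇒∑ σ c)

theorem6p9 : (σ : Sort) (e : Exp σ) → CohE σ e e →
    (N : Sum σ) → IsNF σ (e ∷ []) N →
    (e' : Exp σ) (k : ℕ) → Coef σ N e' k → 0 < k →
    (μ μ' : ℕ) → MultE σ e μ → MultE σ e' μ' →
    k * μ' ≡ μ
theorem6p9 σ e coh N (red , normal) e' k c 0<k μ μ' m m' = begin
  k * μ'
    ≡⟨ cong (k *_) (sym (embed-Mult σ m')) ⟩
  k * iso b b
    ≡⟨ sym W≡k ⟩
  W g s
    ≡⟨ W-coherent b (≺-wellFounded s) (≺-wellFounded s) (embed-≍ σ coh)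
         (subst (0 <_) (sym W≡k) (*-mono-≤ 0<k (0<iso-refl b))) ⟩
  iso s s
    ≡⟨ embed-Mult σ m ⟩
  μ ∎
  where
  open ≡-Reasoning
  s b : Term
  s = embed σ e
  b = embed σ e'
  g : Term → ℕ
  g x = iso x b
  W≡k : W g s ≡ k * iso b b
  -- `W` is constant along the given reduction and agrees with g on the normal summands of N, where
  -- the sum is the coefficient times the multiplicity of b.
  W≡k = sym (+-identityʳ _) ∙ StepΣ*-∑ σ (W-Inv g) red ∙
    ∑-cong-∈ N (λ i → W-normal g (embed-normal σ normal i)) ∙ Coef⇒∑ σ c
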